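{- Let $q=p^r$ with $p\neq 2$ prime, $r\ge 1$, and $q\neq 5,9$. Put $\mathbb{F}_q'=\mathbb{F}_q[x]/(x^2+1)=\{a+bi\mid a,b\in\mathbb{F}_q\}$, $i^2=-1$. A map $\varphi:\mathbb{F}_q'\to\mathbb{F}_q'$ is an automorphism of $\mathbb{F}_q'$ with respect to $\Delta$ if and only if it is a finite composition of maps of the following four types: (1) $z\mapsto z+s$ with $s\in\mathbb{F}_q'$; (2) $a+bi\mapsto b+ai$; (3) $z\mapsto zy$ with $y$ a unit of $\mathbb{F}_q'$ such that $y\overline{y}=r'^2$ for some $r'\in\mathbb{F}_q^*$; (4) $a+bi\mapsto a^{p^j}+b^{p^j}i$ with $j\in\mathbb{N}$.
   Context: For a commutative ring $\mathcal{R}$ with $1$, let $\mathcal{R}'=\mathcal{R}[x]/(x^2+1)$, with $i$ the class of $x$; its elements are written uniquely as $a+bi$ with $a,b\in\mathcal{R}$, and $\mathcal{R}'$ is identified with $\mathcal{R}^2$ via $(a,b)\mapsto a+bi$. Put $\overline{a+bi}=a-bi$. The squared distance is $d^2(a+bi,c+di)=(a-c)^2+(b-d)^2\in\mathcal{R}$. Two points are at integral distance if their squared distance equals $t^2$ for some $t\in\mathcal{R}$ (so $0$ counts as an integral distance). Define $\Delta(u,v)=1$ if $u,v$ are at integral distance and $\Delta(u,v)=0$ otherwise. An automorphism of $\mathcal{R}'$ with respect to $\Delta$ is a bijection $\varphi:\mathcal{R}'\to\mathcal{R}'$ such that for all $a,b,c,d\in\mathcal{R}$: (i) $\Delta(a+bi,c+di)=\Delta(\varphi(a+bi),\varphi(c+di))$;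 and (ii) there exist $a',b',c',d'\in\mathcal{R}$ with $\{\varphi(a+bi+t(c+di))\mid t\in\mathcal{R}\}=\{a'+b'i+t(c'+d'i)\mid t\in\mathcal{R}\}$. -}

module Defs where

open import Algebra.Bundles using (CommutativeRing; AbelianGroup)
import Algebra.Consequences.Setoid as Consequences
open import Algebra.Construct.DirectProduct using (abelianGroup)
open import Algebra.Definitions using (Commutative; Invertible)
import Algebra.Properties.Ring as RingProperties
import Algebra.Properties.Semiring.Exp as Exp
import Algebra.Solver.Ring.NaturalCoefficients.Default as SemiringSolver
open import Data.Bool.Base using (if_then_else_)
open import Data.Fin.Base using (Fin)
import Data.Fin.Properties as Fin
open import Data.List.Base using (List; foldr)
open import Data.Nat.Base as ℕ using (ℕ)
open import Data.Product.Base using (_×_; _,_; ∃; ∃₂)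
open import Function.Base using (_∘_; id)
open import Function.Bundles using (Inverse)
open import Function.Structures using (IsBijection)
open import Level using (Level; _⊔_; suc)
open import Relation.Binary.Definitions using (Decidable)
open import Relation.Binary.PropositionalEquality.Core using (_≡_)
open import Relation.Binary.PropositionalEquality.Properties using (setoid)
open import Relation.Nullary.Decidable using (Dec; does; map′)
open import Relation.Nullary.Negation using (¬_)
open import Relation.Unary using (Pred; _≐_)

private
  variable
    c ℓ : Level
    q : ℕ

record IsField (R : CommutativeRing c ℓ) : Set (c ⊔ ℓ) where
  open CommutativeRing R
  field
    0≉1      : ¬ 0# ≈ 1#
    inverses : ∀ x → ¬ x ≈ 0# → Invertible _≈_ 1# _*_ x

record FiniteField (c ℓ : Level) (q : ℕ) : Set (suc (c ⊔ ℓ)) where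
  field
    commutativeRing : CommutativeRing c ℓ
    isField         : IsField commutativeRing
    enumeration     : Inverse (CommutativeRing.setoid commutativeRing) (setoid (Fin q))

IsSquare : (R : CommutativeRing c ℓ) → CommutativeRing.Carrier R → Set (c ⊔ ℓ)
IsSquare R x = ∃ λ t → x ≈ t * t
  where open CommutativeRing R

-- R[x]/(x² + 1): a + b i is the pair (a , b), and products are reduced
-- with i² = -1.
module Adjoin-i (R : CommutativeRing c ℓ) where
  open CommutativeRing R

  private
    additive : AbelianGroup c ℓ
    additive = abelianGroup +-abelianGroup +-abelianGroup

  infixl 7 _*′_

  _*′_ : Carrier × Carrier → Carrier × Carrier → Carrier × Carrier
  (a , b) *′ (c , d) = a * c - b * d , a * d + b * c

  ring′ : CommutativeRing c ℓ
  ring′ = record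
    { _+_ = AbelianGroup._∙_ additive
    ; _*_ = _*′_
    ; -_  = AbelianGroup._⁻¹ additive
    ; 0#  = 0# , 0#
    ; 1#  = 1# , 0#
    ; isCommutativeRing = record
      { isRing = record
        { +-isAbelianGroup = AbelianGroup.isAbelianGroup additive
        ; *-cong     = λ (p , q) (r , s) →
            +-cong (*-cong p r) (-‿cong (*-cong q s)) , +-cong (*-cong p s) (*-cong q r)
        ; *-assoc    = λ (a , b) (c , d) (e , f) → assoc₁ a b c d e f , assoc₂ a b c d e f
        ; *-identity = comm∧idˡ⇒id commutes λ (a , b) →
            trans (+-cong (*-identityˡ a) (trans (-‿cong (zeroˡ b)) -0#≈0#)) (+-identityʳ a)
          , trans (+-cong (*-identityˡ b) (zeroˡ a)) (+-identityʳ b)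
        ; distrib    = comm∧distrˡ⇒distr AdditiveGroup.∙-cong commutes λ (a , b) (c , d) (e , f) →
            dist₁ a b c d e f , dist₂ a b c d e f
        }
      ; *-comm = commutes
      }
    }
    where
    module AdditiveGroup = AbelianGroup additive
    open Consequences AdditiveGroup.setoid using (comm∧idˡ⇒id; comm∧distrˡ⇒distr)
    open RingProperties ring using (-0#≈0#; -1*x≈-x)
    open SemiringSolver commutativeSemiring using (solve; _:=_; _:+_; _:*_)

    neg : ∀ x → - x ≈ - 1# * x
    neg x = sym (-1*x≈-x x)

    assoc₁ : ∀ a b c d e f → (a * c - b * d) * e - (a * d + b * c) * f
                           ≈ a * (c * e - d * f) - b * (c * f + d * e)
    assoc₁ a b c d e f =
      trans (+-cong (*-congʳ (+-congˡ (neg _))) (neg _))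
      (trans (solve 7 (λ n a b c d e f →
          (a :* c :+ n :* (b :* d)) :* e :+ n :* ((a :* d :+ b :* c) :* f) :=
          a :* (c :* e :+ n :* (d :* f)) :+ n :* (b :* (c :* f :+ d :* e)))
          refl (- 1#) a b c d e f)
      (sym (+-cong (*-congˡ (+-congˡ (neg _))) (neg _))))

    assoc₂ : ∀ a b c d e f → (a * c - b * d) * f + (a * d + b * c) * e
                           ≈ a * (c * f + d * e) + b * (c * e - d * f)
    assoc₂ a b c d e f =
      trans (+-congʳ (*-congʳ (+-congˡ (neg _))))
      (trans (solve 7 (λ n a b c d e f →
          (a :* c :+ n :* (b :* d)) :* f :+ (a :* d :+ b :* c) :* e :=
          a :* (c :* f :+ d :* e) :+ b :* (c :* e :+ n :* (d :* f)))
          refl (- 1#) a b c d e f)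
      (sym (+-congˡ (*-congˡ (+-congˡ (neg _))))))

    dist₁ : ∀ a b c d e f → a * (c + e) - b * (d + f) ≈ (a * c - b * d) + (a * e - b * f)
    dist₁ a b c d e f =
      trans (+-congˡ (neg _))
      (trans (solve 7 (λ n a b c d e f →
          a :* (c :+ e) :+ n :* (b :* (d :+ f)) :=
          (a :* c :+ n :* (b :* d)) :+ (a :* e :+ n :* (b :* f)))
          refl (- 1#) a b c d e f)
      (sym (+-cong (+-congˡ (neg _)) (+-congˡ (neg _)))))

    dist₂ : ∀ a b c d e f → a * (d + f) + b * (c + e) ≈ (a * d + b * c) + (a * f + b * e)
    dist₂ = solve 6 (λ a b c d e f →
      a :* (d :+ f) :+ b :* (c :+ e) := (a :* d :+ b :* c) :+ (a :* f :+ b :* e)) refl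

    commutes : Commutative AdditiveGroup._≈_ _*′_
    commutes (a , b) (c , d) =
        +-cong (*-comm a c) (-‿cong (*-comm b d))
      , trans (+-comm (a * d) (b * c)) (+-cong (*-comm b c) (*-comm a d))

  open CommutativeRing ring′ public using ()
    renaming (Carrier to Carrier′; _≈_ to _≈′_; _+_ to _+′_; 1# to 1′)

  ι : Carrier → Carrier′
  ι a = a , 0#

  conj : Carrier′ → Carrier′
  conj (a , b) = a , - b

  d² : Carrier′ → Carrier′ → Carrier
  d² (a , b) (c , d) = (a - c) * (a - c) + (b - d) * (b - d)

  AtIntegralDistance : Carrier′ → Carrier′ → Set (c ⊔ ℓ)
  AtIntegralDistance u v = IsSquare R (d² u v)

  IsUnit : Carrier′ → Set (c ⊔ ℓ)
  IsUnit = Invertible _≈′_ 1′ _*′_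

  -- The set { f t ∣ t ∈ R }.
  Range : (Carrier → Carrier′) → Pred Carrier′ (c ⊔ ℓ)
  Range f z = ∃ λ t → z ≈′ f t

module _ (F : FiniteField c ℓ q) where
  open FiniteField F
  open CommutativeRing commutativeRing hiding (setoid)
  open Exp semiring using (_^_)
  open Adjoin-i commutativeRing
  open Inverse enumeration using (to; from; strictlyInverseʳ; to-cong; from-cong)

  _≈?_ : Decidable _≈_
  x ≈? y = map′
    (λ e → trans (sym (strictlyInverseʳ x)) (trans (from-cong e) (strictlyInverseʳ y)))
    to-cong
    (to x Fin.≟ to y)

  isSquare? : ∀ x → Dec (IsSquare commutativeRing x)
  isSquare? x = map′
    (λ (k , e) → from k , e)
    (λ (t , e) → let t≈ = sym (strictlyInverseʳ t) in to t , trans e (*-cong t≈ t≈))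
    (Fin.any? (λ k → x ≈? (from k * from k)))

  Point : Set c
  Point = Carrier′

  atIntegralDistance? : Decidable AtIntegralDistance
  atIntegralDistance? u v = isSquare? (d² u v)

  Δ : Point → Point → ℕ
  Δ u v = if does (atIntegralDistance? u v) then 1 else 0

  record IsAutomorphism (φ : Point → Point) : Set (c ⊔ ℓ) where
    field
      isBijection : IsBijection _≈′_ _≈′_ φ
      preserves-Δ : ∀ u v → Δ u v ≡ Δ (φ u) (φ v)
      preserves-lines : ∀ u v → ∃₂ λ u′ v′ →
        Range (λ t → φ (u +′ ι t *′ v)) ≐ Range (λ t → u′ +′ ι t *′ v′)

  data Generator : Set (c ⊔ ℓ) where
    translate : Point → Generator
    swap      : Generator
    multiply  : (y : Point) → IsUnit y →
                (∃ λ r → ¬ r ≈ 0# × y *′ conj y ≈′ ι (r * r)) → Generator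
    frobenius : ℕ → Generator

  module _ (p : ℕ) where

    ⟦_⟧ : Generator → Point → Point
    ⟦ translate s ⟧ z         = z +′ s
    ⟦ swap ⟧ (a , b)          = b , a
    ⟦ multiply y _ _ ⟧ z      = z *′ y
    ⟦ frobenius j ⟧ (a , b)   = a ^ (p ℕ.^ j) , b ^ (p ℕ.^ j)

    -- The empty composition is the identity, i.e. translation by 0.
    compose : List Generator → Point → Point
    compose = foldr (λ g f → ⟦ g ⟧ ∘ f) id

    IsComposition : (Point → Point) → Set (c ⊔ ℓ)
    IsComposition φ = ∃ λ gs → ∀ z → φ z ≈′ compose gs z

-- A bijection that maps lines onto lines preserves parallelism.  In the affine
-- frame formed by the images of 0, 1 and i it therefore acts on both coordinates
-- through the same map σ : 𝔽_q → 𝔽_q, and σ is additive and multiplicative.  Some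
-- moment Σₓ σ(x) xᵏ is nonzero, and substituting yx for x shows σ(y) = yᵐ with
-- m = q - 1 - k.  Since the coefficient of X in (1 + X)ᵐ is m, additivity forces
-- m to be a power of p.
--
-- After composing with a Frobenius the map is affine, and its linear part A sends
-- vectors whose norm x² + y² is a square to such vectors.  Then A is a similarity,
-- i.e. one of the maps z ↦ zy or z ↦ z̄y:
--   * If -1 = j², the norm is uv in the coordinates u, v = x ± jy.  By Euler's
--     criterion the hypothesis at u = 1, v = w² reads
--     (a + bX)ᵐ(c + dX) = (a + bX)(c + dX)ᵐ for X = w², where m = (q + 1)/2.
--     The coefficients of 1 and X² show that A is monomial or ad + bc = 0.  In the
--     second case the same alternative for A · diag(w², 1) · A gives a⁴w⁹ = d⁴w for
--     all w, which is impossible for q > 9.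
--   * If -1 is not a square, 𝔽_q′ is the field with q² elements, whose q-th power
--     map is conjugation.  Writing 2A as Y ↦ αY + βȲ and putting X = Ȳ/Y, the
--     hypothesis at squares Y gives (α + βX)ᵐ = (β̄ + ᾱX)ᵐ with Xᵐ = 1, and the
--     coefficients of X and X² give α = 0 or β = 0.
module Submission where

open import Defs
open import Algebra.Bundles using (CommutativeMonoid; CommutativeRing)
import Algebra.Properties.AbelianGroup as AbelianGroupProperties
import Algebra.Properties.CommutativeMonoid.Sum as Sum
import Algebra.Properties.CommutativeSemiring.Binomial as Binomial
import Algebra.Properties.CommutativeSemiring.Exp as Exp
import Algebra.Properties.Monoid.Mult as MonoidMult
import Algebra.Properties.Ring as RingProperties
import Algebra.Properties.Semiring.Mult as Mult
import Algebra.Properties.Semiring.Mult.TCOptimised as MultTCO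
import Algebra.Properties.Semiring.Sum as SemiringSum
import Algebra.Solver.Ring
open import Algebra.Solver.Ring.AlmostCommutativeRing using (_-Raw-AlmostCommutative⟶_; fromCommutativeRing)
open import Data.Bool.Base using (if_then_else_)
open import Data.Empty using (⊥; ⊥-elim)
open import Data.Fin.Base as Fin using (Fin; fromℕ; inject₁; punchIn; suc; toℕ; zero)
import Data.Fin.Permutation as Perm
import Data.Fin.Properties as Fin
open import Data.Integer.Base as ℤ using (+_; -[1+_]; ℤ)
import Data.Integer.Properties as ℤ
open import Data.List.Base using ([]; _∷_)
open import Data.Maybe.Base as Maybe using (Maybe)
open import Data.Nat.Base as ℕ using (suc; s≤s; zero; z≤n; ℕ)
open import Data.Nat.Combinatorics using (_C_; nC1≡n; nCk+nC[k+1]≡[n+1]C[k+1]; nCn≡1)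
open import Data.Nat.Coprimality as Coprime using (Coprime; coprime-Bézout)
open import Data.Nat.Divisibility using (_∣?_; _∣_; divides; m∣m*n; ∣⇒≤)
open import Data.Nat.GCD using (module Bézout)
open import Data.Nat.Primality using (Prime; euclidsLemma; prime⇒irreducible; prime⇒nonTrivial; prime⇒nonZero)
import Data.Nat.Properties as ℕ
import Data.Nat.Solver as ℕSolver
open import Data.Product.Base using (_,_; _×_; proj₁; proj₂; ∃; ∃₂)
import Data.Sign.Base as Sign
open import Data.Sum.Base using ([_,_]′; _⊎_; inj₁; inj₂)
open import Data.Vec.Base as Vec using (Vec; []; _∷_)
open import Data.Vec.Relation.Unary.All as All using (All; []; _∷_)
open import Function.Base using (_∘_; id)
open import Function.Bundles using (Inverse; mk⇔; _⇔_)
open import Function.Structures using (IsBijection)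
open import Level using (Level; _⊔_)
open import Relation.Binary.PropositionalEquality.Core as ≡ using (_≡_; _≢_)
open import Relation.Binary.PropositionalEquality.Properties using (module ≡-Reasoning)
import Relation.Binary.Reasoning.Setoid as SetoidReasoning
open import Relation.Nullary.Decidable using (Dec; dec⇒maybe; does; no; yes; ¬?)
open import Relation.Nullary.Negation using (contradiction; ¬_)
open import Relation.Unary using (_≐_)

-- The hypothesis is available only at squares X = w². The polynomials are therefore read in w:
-- degree at most (q - 1)/2 in X is degree at most q - 1 in w, and the q available values of w just
-- suffice to kill every coefficient. To get down to that degree, powers from Xᵐ on are lowered by a
-- relation valid at the nodes, Xᵐ = X in the first case and Xᵐ = 1 in the second. What is lowered
-- from Xᵐ lands on X and on 1 respectively, and this decides which coefficients can be compared.
-- (In the first case Xᵐ⁺¹ would land on X², but its coefficient vanishes by the hypothesis at u =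
-- 0, v = 1.) The numbers m and m(m - 1)/2 that occur as binomial coefficients are nonzero in every
-- odd characteristic, because 2m = q + 1 = 1 in the field. The values 5 and 9 are lost at one
-- place: a⁴w⁹ - d⁴w has ten coefficients, so q ≥ 10 is required, and among prime powers q ≡ 1 mod 4
-- only these two fail. For q = 3 there is m = 2, so X² is itself the top power; that field is
-- treated separately.

private
  variable
    c ℓ : Level
    q : ℕ

-- A ring solver with integer coefficients.

module IntegerSolver (R : CommutativeRing c ℓ) where
  open CommutativeRing R
  open RingProperties ring using (-0#≈0#; -‿distribˡ-*; -‿distribʳ-*)
  open AbelianGroupProperties +-abelianGroup using (⁻¹-∙-comm; ⁻¹-involutive)
  open MultTCO semiring using (×-homo-+; ×1-homo-*; 1+×) renaming (_×_ to _×ₙ_)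
  open SetoidReasoning setoid

  private
    -- These multiples satisfy `1 ×ₙ 1# = 1#` by computation, without a trailing `0#`. Hence
    -- `con (+ 1)` and `con (+ 0)` denote `1#` and `0#` literally, and solved equations match the
    -- goals.
    ⟪_⟫ : ℤ → Carrier
    ⟪ + n ⟫      = n ×ₙ 1#
    ⟪ -[1+ n ] ⟫ = - (ℕ.suc n ×ₙ 1#)

    -‿homo : ∀ i → ⟪ ℤ.- i ⟫ ≈ - ⟪ i ⟫
    -‿homo (+ ℕ.zero)  = sym -0#≈0#
    -‿homo (+ ℕ.suc n) = refl
    -‿homo -[1+ n ]    = sym (⁻¹-involutive _)

    -‿cancel : ∀ x y → (1# + x) - (1# + y) ≈ x - y
    -‿cancel x y = begin
      (1# + x) - (1# + y)      ≈⟨ +-cong (+-comm 1# x) (sym (⁻¹-∙-comm 1# y)) ⟩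
      (x + 1#) + (- 1# - y)    ≈⟨ +-assoc x 1# (- 1# - y) ⟩
      x + (1# + (- 1# - y))    ≈⟨ +-congˡ (sym (+-assoc 1# (- 1#) (- y))) ⟩
      x + ((1# - 1#) - y)      ≈⟨ +-congˡ (+-congʳ (-‿inverseʳ 1#)) ⟩
      x + (0# - y)             ≈⟨ +-congˡ (+-identityˡ (- y)) ⟩
      x - y                    ∎

    ⊖-homo : ∀ m n → ⟪ m ℤ.⊖ n ⟫ ≈ m ×ₙ 1# - n ×ₙ 1#
    ⊖-homo m           ℕ.zero      = sym (trans (+-congˡ -0#≈0#) (+-identityʳ _))
    ⊖-homo ℕ.zero      (ℕ.suc n)   = sym (+-identityˡ _)
    ⊖-homo (ℕ.suc m)   (ℕ.suc n)   = begin
      ⟪ ℕ.suc m ℤ.⊖ ℕ.suc n ⟫          ≡⟨ ≡.cong ⟪_⟫ (ℤ.[1+m]⊖[1+n]≡m⊖n m n) ⟩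
      ⟪ m ℤ.⊖ n ⟫                      ≈⟨ ⊖-homo m n ⟩
      m ×ₙ 1# - n ×ₙ 1#                  ≈⟨ -‿cancel _ _ ⟨
      (1# + m ×ₙ 1#) - (1# + n ×ₙ 1#)    ≈⟨ +-cong (1+× m 1#) (-‿cong (1+× n 1#)) ⟨
      ℕ.suc m ×ₙ 1# - ℕ.suc n ×ₙ 1#      ∎

    +-homo : ∀ i j → ⟪ i ℤ.+ j ⟫ ≈ ⟪ i ⟫ + ⟪ j ⟫
    +-homo (+ m)    (+ n)    = ×-homo-+ 1# m n
    +-homo (+ m)    -[1+ n ] = ⊖-homo m (ℕ.suc n)
    +-homo -[1+ m ] (+ n)    = trans (⊖-homo n (ℕ.suc m)) (+-comm _ _)
    +-homo -[1+ m ] -[1+ n ] = begin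
      - (ℕ.suc (ℕ.suc (m ℕ.+ n)) ×ₙ 1#)       ≡⟨ ≡.cong (λ k → - (ℕ.suc k ×ₙ 1#)) (≡.sym (ℕ.+-suc m n)) ⟩
      - ((ℕ.suc m ℕ.+ ℕ.suc n) ×ₙ 1#)         ≈⟨ -‿cong (×-homo-+ 1# (ℕ.suc m) (ℕ.suc n)) ⟩
      - (ℕ.suc m ×ₙ 1# + ℕ.suc n ×ₙ 1#)        ≈⟨ ⁻¹-∙-comm _ _ ⟨
      - (ℕ.suc m ×ₙ 1#) - ℕ.suc n ×ₙ 1#        ∎

    ◃-homo : ∀ n → ⟪ Sign.- ℤ.◃ n ⟫ ≈ - (n ×ₙ 1#)
    ◃-homo ℕ.zero    = sym -0#≈0#
    ◃-homo (ℕ.suc n) = refl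

    *-homo : ∀ i j → ⟪ i ℤ.* j ⟫ ≈ ⟪ i ⟫ * ⟪ j ⟫
    *-homo (+ m)    (+ n)    =
      trans (reflexive (≡.cong ⟪_⟫ (ℤ.+◃n≡+n (m ℕ.* n)))) (×1-homo-* m n)
    *-homo (+ m)    -[1+ n ] = begin
      ⟪ Sign.- ℤ.◃ m ℕ.* ℕ.suc n ⟫     ≈⟨ ◃-homo (m ℕ.* ℕ.suc n) ⟩
      - ((m ℕ.* ℕ.suc n) ×ₙ 1#)         ≈⟨ -‿cong (×1-homo-* m (ℕ.suc n)) ⟩
      - (m ×ₙ 1# * ℕ.suc n ×ₙ 1#)        ≈⟨ -‿distribʳ-* _ _ ⟩
      m ×ₙ 1# * - (ℕ.suc n ×ₙ 1#)        ∎
    *-homo -[1+ m ] (+ n)    = begin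
      ⟪ Sign.- ℤ.◃ ℕ.suc m ℕ.* n ⟫     ≈⟨ ◃-homo (ℕ.suc m ℕ.* n) ⟩
      - ((ℕ.suc m ℕ.* n) ×ₙ 1#)         ≈⟨ -‿cong (×1-homo-* (ℕ.suc m) n) ⟩
      - (ℕ.suc m ×ₙ 1# * n ×ₙ 1#)        ≈⟨ -‿distribˡ-* _ _ ⟩
      - (ℕ.suc m ×ₙ 1#) * n ×ₙ 1#        ∎
    *-homo -[1+ m ] -[1+ n ] = begin
      (ℕ.suc m ℕ.* ℕ.suc n) ×ₙ 1#                ≈⟨ ×1-homo-* (ℕ.suc m) (ℕ.suc n) ⟩
      ℕ.suc m ×ₙ 1# * ℕ.suc n ×ₙ 1#               ≈⟨ ⁻¹-involutive _ ⟨
      - - (ℕ.suc m ×ₙ 1# * ℕ.suc n ×ₙ 1#)         ≈⟨ -‿cong (-‿distribˡ-* _ _) ⟩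
      - (- (ℕ.suc m ×ₙ 1#) * ℕ.suc n ×ₙ 1#)       ≈⟨ -‿distribʳ-* _ _ ⟩
      - (ℕ.suc m ×ₙ 1#) * - (ℕ.suc n ×ₙ 1#)       ∎

    homomorphism : ℤ.+-*-rawRing -Raw-AlmostCommutative⟶ fromCommutativeRing R
    homomorphism = record
      { ⟦_⟧    = ⟪_⟫
      ; +-homo = +-homo
      ; *-homo = *-homo
      ; -‿homo = -‿homo
      ; 0-homo = refl
      ; 1-homo = refl
      }

    coeff≟ : ∀ i j → Maybe (⟪ i ⟫ ≈ ⟪ j ⟫)
    coeff≟ i j = Maybe.map (λ e → reflexive (≡.cong ⟪_⟫ e)) (dec⇒maybe (i ℤ.≟ j))

  open Algebra.Solver.Ring ℤ.+-*-rawRing (fromCommutativeRing R) homomorphism coeff≟ public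
    using (solve; con; _:=_; _:+_; _:*_; _:-_; :-_; _:^_)

-- Polynomials as coefficient vectors; root counting over a commutative ring.

module Polynomials (R : CommutativeRing c ℓ) where
  open CommutativeRing R renaming (zero to *-zero)
  open IntegerSolver R
  open Exp commutativeSemiring
  open SetoidReasoning setoid

  private
    variable
      n : ℕ

  -≈0⇒≈ : ∀ {x y} → x - y ≈ 0# → x ≈ y
  -≈0⇒≈ {x} {y} e = trans (solve 2 (λ x y → x := (x :- y) :+ y) refl x y)
                          (trans (+-congʳ e) (+-identityˡ y))

  ≈⇒-≈0 : ∀ {x y} → x ≈ y → x - y ≈ 0#
  ≈⇒-≈0 {x} {y} e = trans (+-congʳ e) (-‿inverseʳ y)

  -- Root counting needs only that differences of nodes are not zero divisors. In this form the same
  -- lemmas serve both 𝔽_q and 𝔽_q′, without packaging the latter as a field.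
  Regular : Carrier → Set (c ⊔ ℓ)
  Regular x = ∀ y → x * y ≈ 0# → y ≈ 0#

  eval : Vec Carrier n → Carrier → Carrier
  eval []       x = 0#
  eval (a ∷ as) x = a + x * eval as x

  -- Synthetic division: the tails of Horner's scheme at y are the coefficients of (f(X) - f(y)) /
  -- (X - y).
  quot : Carrier → Vec Carrier (suc n) → Vec Carrier n
  quot y (a ∷ [])     = []
  quot y (a ∷ b ∷ as) = eval (b ∷ as) y ∷ quot y (b ∷ as)

  quot-correct : ∀ (as : Vec Carrier (suc n)) x y →
                 eval as x - eval as y ≈ (x - y) * eval (quot y as) x
  quot-correct (a ∷ [])     x y = solve 3
    (λ a x y → (a :+ x :* con (+ 0)) :- (a :+ y :* con (+ 0)) := (x :- y) :* con (+ 0)) refl a x y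
  quot-correct (a ∷ b ∷ as) x y = begin
    (a + x * f x) - (a + y * f y)
      ≈⟨ solve 5 (λ a x y u v → (a :+ x :* u) :- (a :+ y :* v) := (x :- y) :* v :+ x :* (u :- v))
           refl a x y (f x) (f y) ⟩
    (x - y) * f y + x * (f x - f y)
      ≈⟨ +-congˡ (*-congˡ (quot-correct (b ∷ as) x y)) ⟩
    (x - y) * f y + x * ((x - y) * g)
      ≈⟨ solve 4 (λ x y v g → (x :- y) :* v :+ x :* ((x :- y) :* g) := (x :- y) :* (v :+ x :* g))
           refl x y (f y) g ⟩
    (x - y) * (f y + x * g)  ∎
    where
    f = eval (b ∷ as)
    g = eval (quot y (b ∷ as)) x

  private
    constant-term : ∀ {a x u} → a + x * u ≈ 0# → u ≈ 0# → a ≈ 0#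
    constant-term {a} {x} {u} p q = begin
      a           ≈⟨ solve 2 (λ a x → a := a :+ x :* con (+ 0)) refl a x ⟩
      a + x * 0#  ≈⟨ +-congˡ (*-congˡ (sym q)) ⟩
      a + x * u   ≈⟨ p ⟩
      0#          ∎

    quot-zero : ∀ (as : Vec Carrier (suc n)) y → eval as y ≈ 0# →
                All (_≈ 0#) (quot y as) → All (_≈ 0#) as
    quot-zero (a ∷ [])     y e []       = constant-term e refl ∷ []
    quot-zero (a ∷ b ∷ as) y e (z ∷ zs) = constant-term e z ∷ quot-zero (b ∷ as) y z zs

    -- Divide by X - `x zero`: the quotient has one coefficient fewer, and regularity of
    -- `x (suc i) - x zero` passes the remaining roots on to it.
    roots⇒zero′ : (as : Vec Carrier n) (x : Fin n → Carrier) →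
                  (∀ i j → i ≢ j → Regular (x i - x j)) →
                  (∀ i → eval as (x i) ≈ 0#) → All (_≈ 0#) as
    roots⇒zero′ {n = zero}  []         x regular root = []
    roots⇒zero′ {n = suc n} as@(_ ∷ _) x regular root =
      quot-zero as (x zero) (root zero)
        (roots⇒zero′ (quot (x zero) as) (x ∘ suc)
          (λ i j i≢j → regular (suc i) (suc j) (i≢j ∘ Fin.suc-injective))
          (λ i → regular (suc i) zero (λ ()) _ (begin
            (x (suc i) - x zero) * eval (quot (x zero) as) (x (suc i))  ≈⟨ quot-correct as (x (suc i)) (x zero) ⟨
            eval as (x (suc i)) - eval as (x zero)                      ≈⟨ +-cong (root (suc i)) (-‿cong (root zero)) ⟩
            0# - 0#                                                     ≈⟨ -‿inverseʳ 0# ⟩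
            0#                                                          ∎)))

  roots⇒zero : ∀ {N} → n ℕ.≤ N → (as : Vec Carrier n) (x : Fin N → Carrier) →
               (∀ i j → i ≢ j → Regular (x i - x j)) →
               (∀ i → eval as (x i) ≈ 0#) → All (_≈ 0#) as
  roots⇒zero n≤N as x regular root = roots⇒zero′ as (x ∘ ι)
    (λ i j i≢j → regular (ι i) (ι j) (i≢j ∘ Fin.inject≤-injective n≤N n≤N i j))
    (root ∘ ι)
    where ι = λ i → Fin.inject≤ i n≤N

  -- `n` counts coefficients, so the degree is below `n`. The existential keeps the tails of
  -- expansions anonymous: only the coefficients under comparison are ever written down.
  IsPoly : ℕ → (Carrier → Carrier) → Set (c ⊔ ℓ)
  IsPoly n f = ∃ λ (as : Vec Carrier n) → ∀ x → f x ≈ eval as x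

  private
    variable
      f g : Carrier → Carrier

  poly-cong : (∀ x → f x ≈ g x) → IsPoly n g → IsPoly n f
  poly-cong f≈g (as , e) = as , λ x → trans (f≈g x) (e x)

  poly-0 : IsPoly n (λ _ → 0#)
  poly-0 {n = zero}  = [] , λ x → refl
  poly-0 {n = suc n} with poly-0 {n = n}
  ... | as , e = 0# ∷ as , λ x → trans
    (solve 1 (λ x → con (+ 0) := con (+ 0) :+ x :* con (+ 0)) refl x)
    (+-congˡ (*-congˡ (e x)))

  poly-const+X* : ∀ a → IsPoly n f → IsPoly (suc n) (λ x → a + x * f x)
  poly-const+X* a (as , e) = a ∷ as , λ x → +-congˡ (*-congˡ (e x))

  poly-const : ∀ a → IsPoly (suc n) (λ _ → a)
  poly-const a = poly-cong (λ x → solve 2 (λ a x → a := a :+ x :* con (+ 0)) refl a x)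
                           (poly-const+X* a poly-0)

  poly-X* : IsPoly n f → IsPoly (suc n) (λ x → x * f x)
  poly-X* p = poly-cong (λ x → sym (+-identityˡ _)) (poly-const+X* 0# p)

  poly-+ : IsPoly n f → IsPoly n g → IsPoly n (λ x → f x + g x)
  poly-+ (as , d) (bs , e) = Vec.zipWith _+_ as bs ,
    λ x → trans (+-cong (d x) (e x)) (eval-+ as bs x)
    where
    eval-+ : ∀ (as bs : Vec Carrier n) x → eval as x + eval bs x ≈ eval (Vec.zipWith _+_ as bs) x
    eval-+ []       []       x = +-identityˡ 0#
    eval-+ (a ∷ as) (b ∷ bs) x = trans
      (solve 5 (λ a b x u v → (a :+ x :* u) :+ (b :+ x :* v) := (a :+ b) :+ x :* (u :+ v))
        refl a b x _ _)
      (+-congˡ (*-congˡ (eval-+ as bs x)))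

  poly-scale : ∀ k → IsPoly n f → IsPoly n (λ x → k * f x)
  poly-scale k (as , e) = Vec.map (k *_) as , λ x → trans (*-congˡ (e x)) (eval-* as x)
    where
    eval-* : ∀ (as : Vec Carrier n) x → k * eval as x ≈ eval (Vec.map (k *_) as) x
    eval-* []       x = zeroʳ k
    eval-* (a ∷ as) x = trans
      (solve 4 (λ k a x u → k :* (a :+ x :* u) := k :* a :+ x :* (k :* u)) refl k a x _)
      (+-congˡ (*-congˡ (eval-* as x)))

  poly-lift : IsPoly n f → IsPoly (suc n) f
  poly-lift (as , e) = as Vec.∷ʳ 0# , λ x → trans (e x) (eval-∷ʳ as x)
    where
    eval-∷ʳ : ∀ (as : Vec Carrier n) x → eval as x ≈ eval (as Vec.∷ʳ 0#) x
    eval-∷ʳ []       x = sym (trans (+-congˡ (zeroʳ x)) (+-identityˡ 0#))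
    eval-∷ʳ (a ∷ as) x = +-congˡ (*-congˡ (eval-∷ʳ as x))

  poly-linear* : ∀ a b → IsPoly n f → IsPoly (suc n) (λ x → (a + b * x) * f x)
  poly-linear* a b p = poly-cong
    (λ x → solve 4 (λ a b x u → (a :+ b :* x) :* u := a :* u :+ x :* (b :* u)) refl a b x _)
    (poly-+ (poly-lift (poly-scale a p)) (poly-X* (poly-scale b p)))

  poly-linear^ : ∀ a b n → IsPoly (suc n) (λ x → (a + b * x) ^ n)
  poly-linear^ a b zero    = poly-const 1#
  poly-linear^ a b (suc n) = poly-linear* a b (poly-linear^ a b n)

  poly-^ : ∀ n → IsPoly (suc n) (_^ n)
  poly-^ n = poly-cong
    (λ x → ^-congˡ n (solve 1 (λ x → x := con (+ 0) :+ con (+ 1) :* x) refl x))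
    (poly-linear^ 0# 1# n)

  private
    split-top : (as : Vec Carrier (suc n)) →
                ∃ λ k → ∃ λ g → IsPoly n g × ∀ x → eval as x ≈ g x + k * x ^ n
    split-top (a ∷ [])     = a , (λ _ → 0#) , poly-0 , λ x →
      solve 2 (λ a x → a :+ x :* con (+ 0) := con (+ 0) :+ a :* con (+ 1)) refl a x
    split-top {n = suc n} (a ∷ b ∷ as) with k , g , p , d ← split-top (b ∷ as) =
      k , (λ x → a + x * g x) , poly-const+X* a p , λ x → trans (+-congˡ (*-congˡ (d x)))
        (solve 5 (λ a x u k z → a :+ x :* (u :+ k :* z) := (a :+ x :* u) :+ k :* (x :* z)) refl a x (g x) k (x ^ n))

  -- Isolates the coefficient that a relation such as Xᵐ = X will move to a lower degree.
  poly-split-top : IsPoly (suc n) f → ∃ λ k → ∃ λ g → IsPoly n g × ∀ x → f x ≈ g x + k * x ^ n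
  poly-split-top (as , e) with k , g , p , d ← split-top as = k , g , p , λ x → trans (e x) (d x)

  private
    -- Interleaving zeros gives the coefficients of f(X²), so n + 1 entries become 2n + 1.
    spread : ∀ n (as : Vec Carrier (suc n)) → ∃ λ (bs : Vec Carrier (suc (n ℕ.+ n))) →
             (∀ x → eval bs x ≈ eval as (x * x)) × (All (_≈ 0#) bs → All (_≈ 0#) as)
    spread zero    (a ∷ [])     = a ∷ [] ,
      (λ x → solve 2 (λ a x → a :+ x :* con (+ 0) := a :+ x :* x :* con (+ 0)) refl a x) ,
      λ { (a≈0 ∷ []) → a≈0 ∷ [] }
    spread (suc n) (a ∷ b ∷ as) rewrite ℕ.+-suc n n with bs , e , z ← spread n (b ∷ as) =
      a ∷ 0# ∷ bs ,
      (λ x → trans (solve 3 (λ a x u → a :+ x :* (con (+ 0) :+ x :* u) := a :+ x :* x :* u) refl a x (eval bs x))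
                   (+-congˡ (*-congˡ (e x)))) ,
      λ { (a≈0 ∷ _ ∷ bs≈0) → a≈0 ∷ z bs≈0 }

  -- The nodes counted are the `x i` and not their squares, so the number of distinct squares never
  -- enters. For n = (q - 1)/2 the bound is exactly q.
  square-roots⇒zero : ∀ {N} → suc (n ℕ.+ n) ℕ.≤ N → (as : Vec Carrier (suc n)) (x : Fin N → Carrier) →
                      (∀ i j → i ≢ j → Regular (x i - x j)) →
                      (∀ i → eval as (x i * x i) ≈ 0#) → All (_≈ 0#) as
  square-roots⇒zero {n = n} n≤N as x regular root with bs , e , z ← spread n as =
    z (roots⇒zero n≤N bs x regular λ i → trans (e (x i)) (root i))

-- Binomial coefficients and parity.

absorption : ∀ n k → suc k ℕ.* (suc n C suc k) ≡ suc n ℕ.* (n C k)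
absorption n       zero    = ≡.trans (ℕ.+-identityʳ _) (≡.trans (nC1≡n (suc n)) (≡.sym (ℕ.*-identityʳ (suc n))))
absorption zero    (suc k) = ℕ.*-zeroʳ (suc (suc k))
absorption (suc n) (suc k) = begin
  suc (suc k) ℕ.* (suc (suc n) C suc (suc k))
    ≡⟨ ≡.cong (suc (suc k) ℕ.*_) (≡.sym (nCk+nC[k+1]≡[n+1]C[k+1] (suc n) (suc k))) ⟩
  suc (suc k) ℕ.* (B ℕ.+ (suc n C suc (suc k)))
    ≡⟨ ℕ.*-distribˡ-+ (suc (suc k)) B _ ⟩
  (B ℕ.+ suc k ℕ.* B) ℕ.+ suc (suc k) ℕ.* (suc n C suc (suc k))
    ≡⟨ ≡.cong₂ (λ u v → (B ℕ.+ u) ℕ.+ v) (absorption n k) (absorption n (suc k)) ⟩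
  (B ℕ.+ suc n ℕ.* (n C k)) ℕ.+ suc n ℕ.* (n C suc k)
    ≡⟨ ℕ.+-assoc B _ _ ⟩
  B ℕ.+ (suc n ℕ.* (n C k) ℕ.+ suc n ℕ.* (n C suc k))
    ≡⟨ ≡.cong (B ℕ.+_) (≡.sym (ℕ.*-distribˡ-+ (suc n) (n C k) _)) ⟩
  B ℕ.+ suc n ℕ.* (n C k ℕ.+ n C suc k)
    ≡⟨ ≡.cong (λ u → B ℕ.+ suc n ℕ.* u) (nCk+nC[k+1]≡[n+1]C[k+1] n k) ⟩
  suc (suc n) ℕ.* B  ∎
  where
  open ≡-Reasoning
  B = suc n C suc k

-- By absorption the prime `suc p` divides `suc k` times the binomial coefficient, and `suc k` is
-- positive and smaller than the prime.
prime∣binomial : ∀ {p k} → Prime (suc p) → k ℕ.< p → suc p ∣ (suc p C suc k)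
prime∣binomial {p} {k} pr k<p with euclidsLemma (suc k) (suc p C suc k) pr
  (≡.subst (suc p ∣_) (≡.sym (absorption p k)) (m∣m*n (p C k)))
... | inj₁ p∣k = contradiction (∣⇒≤ p∣k) (ℕ.<⇒≱ (s≤s k<p))
... | inj₂ p∣C = p∣C

odd-^ : ∀ {p} → (∃ λ k → p ≡ suc (k ℕ.+ k)) → ∀ r → ∃ λ n → p ℕ.^ r ≡ suc (n ℕ.+ n)
odd-^ _ zero = 0 , ≡.refl
odd-^ (k , ≡.refl) (suc r) with odd-^ (k , ≡.refl) r
... | n , e = (n ℕ.+ k ℕ.* suc (n ℕ.+ n)) , ≡.trans (≡.cong (suc (k ℕ.+ k) ℕ.*_) e)
  (solve 2 (λ k n → (con 1 :+ (k :+ k)) :* (con 1 :+ (n :+ n)) :=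
    con 1 :+ ((n :+ k :* (con 1 :+ (n :+ n))) :+ (n :+ k :* (con 1 :+ (n :+ n))))) ≡.refl k n)
  where open ℕSolver.+-*-Solver

parity : ∀ n → (∃ λ k → n ≡ k ℕ.+ k) ⊎ (∃ λ k → n ≡ suc (k ℕ.+ k))
parity zero = inj₁ (0 , ≡.refl)
parity (suc n) with parity n
... | inj₁ (k , ≡.refl) = inj₂ (k , ≡.refl)
... | inj₂ (k , ≡.refl) = inj₁ (suc k , ≡.cong suc (≡.sym (ℕ.+-suc k k)))

-- An even p = 2k would divide 2 or k: the first forces p = 2, the second fails by size.
oddPrime : ∀ {p} → Prime p → p ≢ 2 → ∃ λ k → p ≡ suc (k ℕ.+ k)
oddPrime {p} pr p≢2 with parity p
... | inj₂ odd = odd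
... | inj₁ (k , e) with euclidsLemma 2 k pr (divides 1 (≡.trans (≡.cong (k ℕ.+_) (ℕ.+-identityʳ k)) (≡.trans (≡.sym e) (≡.sym (ℕ.+-identityʳ p)))))
...   | inj₁ p∣2 = contradiction (ℕ.≤-antisym (∣⇒≤ p∣2) (ℕ.nonTrivial⇒n>1 p {{prime⇒nonTrivial pr}})) p≢2
oddPrime pr p≢2 | inj₁ (zero , ≡.refl) | inj₂ p∣k = contradiction ≡.refl (ℕ.≢-nonZero⁻¹ 0 {{prime⇒nonZero pr}})
oddPrime pr p≢2 | inj₁ (suc k , ≡.refl) | inj₂ p∣k = contradiction (∣⇒≤ p∣k) (ℕ.<⇒≱ (ℕ.m<m+n (suc k) (s≤s z≤n)))

-- The Frobenius map and powers of linear polynomials.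

module Frobenius (R : CommutativeRing c ℓ) where
  open Polynomials R
  open CommutativeRing R renaming (zero to *-zero)
  open Exp commutativeSemiring
  open Binomial commutativeSemiring using (theorem; binomialTerm)
  open Sum +-commutativeMonoid
  open Mult semiring using (×-homo-1; ×1-homo-*; ×-assoc-*) renaming (_×_ to _×ₙ_)
  open SetoidReasoning setoid

  multiple-zero : ∀ {p n} → p ×ₙ 1# ≈ 0# → p ∣ n → ∀ x → n ×ₙ x ≈ 0#
  multiple-zero {p} p≈0 (divides k ≡.refl) x = begin
    (k ℕ.* p) ×ₙ x               ≈⟨ ×-congʳ (k ℕ.* p) (*-identityˡ x) ⟨
    (k ℕ.* p) ×ₙ (1# * x)        ≈⟨ ×-assoc-* (k ℕ.* p) 1# x ⟨
    (k ℕ.* p) ×ₙ 1# * x          ≈⟨ *-congʳ (×1-homo-* k p) ⟩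
    k ×ₙ 1# * (p ×ₙ 1#) * x      ≈⟨ *-congʳ (trans (*-congˡ p≈0) (zeroʳ _)) ⟩
    0# * x                       ≈⟨ zeroˡ x ⟩
    0#                           ∎
    where open Mult semiring using (×-congʳ)

  frobenius-+ : ∀ {p} → Prime p → p ×ₙ 1# ≈ 0# → ∀ x y → (x + y) ^ p ≈ x ^ p + y ^ p
  frobenius-+ {suc p} pr p≈0 x y = begin
    (x + y) ^ suc p                                 ≈⟨ theorem (suc p) x y ⟩
    t zero + sum (t ∘ suc)                          ≈⟨ +-cong first (sum-init-last (t ∘ suc)) ⟩
    y ^ suc p + (sum (t ∘ suc ∘ inject₁) + t (suc (fromℕ p)))  ≈⟨ +-congˡ (+-cong middle last) ⟩
    y ^ suc p + (0# + x ^ suc p)                    ≈⟨ +-congˡ (+-identityˡ _) ⟩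
    y ^ suc p + x ^ suc p                           ≈⟨ +-comm _ _ ⟩
    x ^ suc p + y ^ suc p                           ∎
    where
    t = binomialTerm x y (suc p)

    first : t zero ≈ y ^ suc p
    first = trans (×-homo-1 _) (*-identityˡ _)

    term-zero : ∀ (i : Fin p) → t (suc (inject₁ i)) ≈ 0#
    term-zero i = multiple-zero p≈0
      (prime∣binomial pr (≡.subst (ℕ._< p) (≡.sym (Fin.toℕ-inject₁ i)) (Fin.toℕ<n i))) _

    middle : sum (t ∘ suc ∘ inject₁) ≈ 0#
    middle = trans (sum-cong-≋ term-zero) (sum-replicate-zero p)

    last : t (suc (fromℕ p)) ≈ x ^ suc p
    last rewrite Fin.toℕ-fromℕ p | nCn≡1 (suc p) | ℕ.n∸n≡0 p =
      trans (×-homo-1 _) (*-identityʳ _)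

  frobenius^-+ : ∀ {p} → Prime p → p ×ₙ 1# ≈ 0# → ∀ j x y →
                 (x + y) ^ (p ℕ.^ j) ≈ x ^ (p ℕ.^ j) + y ^ (p ℕ.^ j)
  frobenius^-+ pr p≈0 zero    x y = trans (*-identityʳ _) (sym (+-cong (*-identityʳ x) (*-identityʳ y)))
  frobenius^-+ {p} pr p≈0 (suc j) x y = begin
    (x + y) ^ (p ℕ.* p ℕ.^ j)                    ≈⟨ ^-assocʳ (x + y) p (p ℕ.^ j) ⟨
    ((x + y) ^ p) ^ (p ℕ.^ j)                    ≈⟨ ^-congˡ (p ℕ.^ j) (frobenius-+ pr p≈0 x y) ⟩
    (x ^ p + y ^ p) ^ (p ℕ.^ j)                  ≈⟨ frobenius^-+ pr p≈0 j (x ^ p) (y ^ p) ⟩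
    (x ^ p) ^ (p ℕ.^ j) + (y ^ p) ^ (p ℕ.^ j)    ≈⟨ +-cong (^-assocʳ x p _) (^-assocʳ y p _) ⟩
    x ^ (p ℕ.* p ℕ.^ j) + y ^ (p ℕ.* p ℕ.^ j)    ∎

  -- The binomial coefficients of Xⁱ matter for i ≤ 2 and for the top term only.
  linear^-expansion : ∀ a b k → ∃ λ f → IsPoly k f × ∀ x →
    (a + b * x) ^ (3 ℕ.+ k) ≈
      a ^ (3 ℕ.+ k) + (3 ℕ.+ k) ×ₙ 1# * (a ^ (2 ℕ.+ k) * b) * x
      + ((3 ℕ.+ k) C 2) ×ₙ 1# * (a ^ (1 ℕ.+ k) * (b * b)) * (x * x)
      + x * (x * (x * f x)) + b ^ (3 ℕ.+ k) * x ^ (3 ℕ.+ k)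
  linear^-expansion a b zero = (λ _ → 0#) , poly-0 , λ x →
    solve 3 (λ a b x → let ν = con (+ 1) :+ (con (+ 1) :+ (con (+ 1) :+ con (+ 0))) in
      (a :+ b :* x) :^ 3 :=
      a :^ 3 :+ ν :* (a :^ 2 :* b) :* x
      :+ ν :* (a :^ 1 :* (b :* b)) :* (x :* x)
      :+ x :* (x :* (x :* con (+ 0))) :+ b :^ 3 :* x :^ 3) refl a b x
    where
    open IntegerSolver R
  linear^-expansion a b (suc k) with linear^-expansion a b k
  ... | f , poly , eq = g , poly-g , λ x → begin
    (a + b * x) * (a + b * x) ^ (3 ℕ.+ k)
      ≈⟨ *-congˡ (eq x) ⟩
    (a + b * x) * (a * (a * P) + ν * (a * P * b) * x + τ * (P * (b * b)) * (x * x)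
      + x * (x * (x * f x)) + Q * (x * (x * (x * x ^ k))))
      ≈⟨ solve 9 (λ a b x P Q z u ν τ →
          (a :+ b :* x) :* (a :* (a :* P) :+ ν :* (a :* P :* b) :* x :+ τ :* (P :* (b :* b)) :* (x :* x)
            :+ x :* (x :* (x :* u)) :+ Q :* (x :* (x :* (x :* z)))) :=
          a :* (a :* (a :* P)) :+ (con (+ 1) :+ ν) :* (a :* (a :* P) :* b) :* x
            :+ (ν :+ τ) :* (a :* P :* (b :* b)) :* (x :* x)
            :+ x :* (x :* (x :* (τ :* (P :* (b :* b)) :* b :+ (a :+ b :* x) :* u :+ a :* Q :* z)))
            :+ b :* Q :* (x :* (x :* (x :* (x :* z)))))
          refl a b x P Q (x ^ k) (f x) ν τ ⟩
    a * (a * (a * P)) + (1# + ν) * (a * (a * P) * b) * x + (ν + τ) * (a * P * (b * b)) * (x * x)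
      + x * (x * (x * g x)) + b * Q * (x * (x * (x * (x * x ^ k))))
      ≈⟨ +-congʳ (+-congʳ (+-congˡ (*-congʳ (*-congʳ pascal)))) ⟩
    _  ∎
    where
    open IntegerSolver R
    open Mult semiring using (×-homo-+)
    P = a ^ (1 ℕ.+ k)
    Q = b ^ (3 ℕ.+ k)
    ν = (3 ℕ.+ k) ×ₙ 1#
    τ = ((3 ℕ.+ k) C 2) ×ₙ 1#
    g = λ x → τ * (P * (b * b)) * b + (a + b * x) * f x + a * Q * x ^ k

    poly-g : IsPoly (suc k) g
    poly-g = poly-+ (poly-+ (poly-const _) (poly-linear* a b poly)) (poly-scale (a * Q) (poly-^ k))

    pascal : ν + τ ≈ ((4 ℕ.+ k) C 2) ×ₙ 1#
    pascal = begin
      ν + τ                                      ≈⟨ ×-homo-+ 1# (3 ℕ.+ k) ((3 ℕ.+ k) C 2) ⟨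
      (3 ℕ.+ k ℕ.+ ((3 ℕ.+ k) C 2)) ×ₙ 1#        ≡⟨ ≡.cong (λ n → (n ℕ.+ ((3 ℕ.+ k) C 2)) ×ₙ 1#) (nC1≡n (3 ℕ.+ k)) ⟨
      ((3 ℕ.+ k) C 1 ℕ.+ (3 ℕ.+ k) C 2) ×ₙ 1#    ≡⟨ ≡.cong (_×ₙ 1#) (nCk+nC[k+1]≡[n+1]C[k+1] (3 ℕ.+ k) 1) ⟩
      ((4 ℕ.+ k) C 2) ×ₙ 1#                      ∎

-- Finite fields: cancellation, sums over all elements, Fermat, characteristic.

module FieldFacts (F : FiniteField c ℓ q) where
  open FiniteField F public
  open CommutativeRing commutativeRing public renaming (zero to *-zero)
  open IsField isField public
  open Exp commutativeSemiring public
  open Polynomials commutativeRing public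
  open IntegerSolver commutativeRing public
  open Mult semiring public using (×-homo-+; ×1-homo-*; ×-congʳ; ×-homo-1) renaming (_×_ to _×ₙ_)
  open Frobenius commutativeRing public
  open Inverse enumeration public
    using (to; from; to-cong; strictlyInverseˡ; strictlyInverseʳ)
  open SetoidReasoning setoid

  infix 4 _≟_

  _≟_ = _≈?_ F

  1≉0 : 1# ≉ 0#
  1≉0 e = 0≉1 (sym e)

  -1≉0 : - 1# ≉ 0#
  -1≉0 e = 1≉0 (trans (solve 0 (con (+ 1) := :- (:- con (+ 1))) refl)
    (trans (-‿cong e) (solve 0 (:- con (+ 0) := con (+ 0)) refl)))

  inv : ∀ x → x ≉ 0# → ∃ λ y → y * x ≈ 1#
  inv x x≉0 with y , e , _ ← inverses x x≉0 = y , e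

  regular : ∀ {x} → x ≉ 0# → Regular x
  regular {x} x≉0 y xy≈0 with z , zx≈1 ← inv x x≉0 = begin
    y            ≈⟨ *-identityˡ y ⟨
    1# * y       ≈⟨ *-congʳ zx≈1 ⟨
    z * x * y    ≈⟨ *-assoc z x y ⟩
    z * (x * y)  ≈⟨ *-congˡ xy≈0 ⟩
    z * 0#       ≈⟨ zeroʳ z ⟩
    0#           ∎

  domain : ∀ x y → x * y ≈ 0# → x ≈ 0# ⊎ y ≈ 0#
  domain x y xy≈0 with x ≟ 0#
  ... | yes x≈0 = inj₁ x≈0
  ... | no  x≉0 = inj₂ (regular x≉0 y xy≈0)

  *-≉0 : ∀ {x y} → x ≉ 0# → y ≉ 0# → x * y ≉ 0#
  *-≉0 {x} {y} x≉0 y≉0 = y≉0 ∘ regular x≉0 y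

  ^-≉0 : ∀ {x} n → x ≉ 0# → x ^ n ≉ 0#
  ^-≉0 zero    x≉0 = 1≉0
  ^-≉0 (suc n) x≉0 = *-≉0 x≉0 (^-≉0 n x≉0)

  ^-≈0 : ∀ {x} n → x ^ n ≈ 0# → x ≈ 0#
  ^-≈0 {x} n e with x ≟ 0#
  ... | yes x≈0 = x≈0
  ... | no  x≉0 = contradiction e (^-≉0 n x≉0)

  *-cancelˡ : ∀ {x} y z → x ≉ 0# → x * y ≈ x * z → y ≈ z
  *-cancelˡ {x} y z x≉0 e = -≈0⇒≈ (regular x≉0 (y - z)
    (trans (solve 3 (λ x y z → x :* (y :- z) := x :* y :- x :* z) refl x y z) (≈⇒-≈0 e)))

  1^ : ∀ n → 1# ^ n ≈ 1#
  1^ zero    = refl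
  1^ (suc n) = trans (*-identityˡ _) (1^ n)

  from-regular : ∀ i j → i ≢ j → Regular (from i - from j)
  from-regular i j i≢j = regular λ e → i≢j (≡.trans (≡.sym (strictlyInverseˡ i))
    (≡.trans (to-cong (-≈0⇒≈ e)) (strictlyInverseˡ j)))

  ≈from : ∀ x → x ≈ from (to x)
  ≈from x = sym (strictlyInverseʳ x)

  module FieldSum {a b : Level} (M : CommutativeMonoid a b) where
    private module M = CommutativeMonoid M
    open Sum M public
    open MonoidMult M.monoid using () renaming (_×_ to _×ₘ_)

    -- Sums over the field run over `Fin q` through `from`, so a permutation of field elements has
    -- to be carried over to the indices.
    reindex : (f : Carrier → M.Carrier) → (∀ {x y} → x ≈ y → f x M.≈ f y) →
              (π π⁻¹ : Carrier → Carrier) →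
              (∀ {x y} → x ≈ y → π x ≈ π y) → (∀ {x y} → x ≈ y → π⁻¹ x ≈ π⁻¹ y) →
              (∀ x → π (π⁻¹ x) ≈ x) → (∀ x → π⁻¹ (π x) ≈ x) →
              sum (f ∘ from) M.≈ sum (f ∘ π ∘ from)
    reindex f f-cong π π⁻¹ π-cong π⁻¹-cong ππ⁻¹ π⁻¹π =
      M.trans (∑-permute (f ∘ from) (Perm.permutation (to ∘ π ∘ from) (to ∘ π⁻¹ ∘ from)
          (λ i → ≡.trans (to-cong (trans (π-cong (strictlyInverseʳ _)) (ππ⁻¹ _))) (strictlyInverseˡ i))
          (λ i → ≡.trans (to-cong (trans (π⁻¹-cong (strictlyInverseʳ _)) (π⁻¹π _))) (strictlyInverseˡ i))))
        (sum-cong-≋ {q} (λ i → f-cong (strictlyInverseʳ (π (from i)))))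

    -- In multiplicative notation the extra y stands in for the factor missing at i, so that yⁿ
    -- appears instead of yⁿ⁻¹.
    sum-update : ∀ {n} (i : Fin n) (h : Fin n → M.Carrier) y → h i M.≈ M.ε →
                 (∀ j → j ≢ i → h j M.≈ y) → y M.∙ sum h M.≈ n ×ₘ y
    sum-update {suc n} i h y hi hj = M.∙-congˡ (M.trans (sum-remove {i = i} h)
      (M.trans (M.∙-congʳ hi) (M.trans (M.identityˡ _)
        (M.trans (sum-cong-≋ (λ j → hj (punchIn i j) (Fin.punchInᵢ≢i i j))) (sum-replicate n)))))

    sum-single : ∀ {n} (i : Fin n) (h : Fin n → M.Carrier) →
                 (∀ j → j ≢ i → h j M.≈ M.ε) → sum h M.≈ h i
    sum-single {suc n} i h hj = M.trans (sum-remove {i = i} h)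
      (M.trans (M.∙-congˡ (M.trans (sum-cong-≋ (λ j → hj (punchIn i j) (Fin.punchInᵢ≢i i j)))
                                   (sum-replicate-zero n)))
        (M.identityʳ _))

  private
    module Σ = FieldSum +-commutativeMonoid
    module Π = FieldSum *-commutativeMonoid

  -- Translation by 1 permutes the field, so the sum of all x equals the sum of all x + 1.
  card×1≈0 : q ×ₙ 1# ≈ 0#
  card×1≈0 = begin
    q ×ₙ 1#                      ≈⟨ Σ.sum-replicate q ⟨
    ones                         ≈⟨ solve 2 (λ s t → t := (s :+ t) :- s) refl S ones ⟩
    (S + ones) - S               ≈⟨ +-congʳ (Σ.∑-distrib-+ from (λ _ → 1#)) ⟨
    Σ.sum (λ i → from i + 1#) - S  ≈⟨ +-congʳ (Σ.reindex id id (_+ 1#) (_- 1#) +-congʳ +-congʳ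
                                      (λ x → solve 1 (λ x → x :- con (+ 1) :+ con (+ 1) := x) refl x)
                                      (λ x → solve 1 (λ x → x :+ con (+ 1) :- con (+ 1) := x) refl x)) ⟨
    S - S                        ≈⟨ -‿inverseʳ S ⟩
    0#                           ∎
    where
    S = Σ.sum from
    ones = Σ.sum {q} (λ _ → 1#)

  private
    -- Putting 1 at zero lets products over the nonzero elements run over the whole enumeration.
    replace0 : (Carrier → Carrier) → Carrier → Carrier
    replace0 f x with x ≟ 0#
    ... | yes _ = 1#
    ... | no  _ = f x

    replace0-zero : ∀ f {x} → x ≈ 0# → replace0 f x ≈ 1#
    replace0-zero f {x} x≈0 with x ≟ 0#
    ... | yes _   = refl
    ... | no  x≉0 = contradiction x≈0 x≉0

    replace0-nonzero : ∀ f {x} → x ≉ 0# → replace0 f x ≈ f x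
    replace0-nonzero f {x} x≉0 with x ≟ 0#
    ... | yes x≈0 = contradiction x≈0 x≉0
    ... | no  _   = refl

    replace0-cong : ∀ f → (∀ {x y} → x ≈ y → f x ≈ f y) →
                    ∀ {x y} → x ≈ y → replace0 f x ≈ replace0 f y
    replace0-cong f f-cong {x} {y} x≈y with y ≟ 0#
    ... | yes y≈0 = replace0-zero f (trans x≈y y≈0)
    ... | no  y≉0 = trans (replace0-nonzero f (λ x≈0 → y≉0 (trans (sym x≈y) x≈0))) (f-cong x≈y)

    product-≉0 : ∀ {n} (h : Fin n → Carrier) → (∀ i → h i ≉ 0#) → Π.sum h ≉ 0#
    product-≉0 {zero}  h h≉0 = 1≉0
    product-≉0 {suc n} h h≉0 = *-≉0 (h≉0 zero) (product-≉0 (h ∘ suc) (h≉0 ∘ suc))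

  -- Multiplication by y permutes the nonzero elements, so it preserves their product.
  fermat : ∀ x → x ^ q ≈ x
  fermat y with y ≟ 0#
  ... | yes y≈0 = trans (^-congˡ q y≈0) (trans (0^ q (to 0#)) (sym y≈0))
    where
    0^ : ∀ n → Fin n → 0# ^ n ≈ 0#
    0^ (suc n) _ = zeroˡ _
  ... | no  y≉0 with y⁻¹ , y⁻¹y≈1 ← inv y y≉0 = begin
    y ^ q                  ≈⟨ Π.sum-update (to 0#) (h ∘ from) y
                                (replace0-zero (λ _ → y) (strictlyInverseʳ 0#))
                                (λ j j≢ → replace0-nonzero (λ _ → y)
                                  λ e → j≢ (≡.trans (≡.sym (strictlyInverseˡ j)) (to-cong e))) ⟨
    y * Π.sum (h ∘ from)   ≈⟨ *-congˡ Πh≈1 ⟩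
    y * 1#                 ≈⟨ *-identityʳ y ⟩
    y                      ∎
    where
    g = replace0 id
    h = replace0 (λ _ → y)

    G = Π.sum (g ∘ from)

    g≉0 : ∀ x → g x ≉ 0#
    g≉0 x with x ≟ 0#
    ... | yes _   = 1≉0
    ... | no  x≉0 = x≉0

    g-y* : ∀ x → g (y * x) ≈ h x * g x
    g-y* x with x ≟ 0#
    ... | yes x≈0 = trans (replace0-zero id (trans (*-congˡ x≈0) (zeroʳ y))) (sym (*-identityˡ 1#))
    ... | no  x≉0 = replace0-nonzero id (*-≉0 y≉0 x≉0)

    Πh≈1 : Π.sum (h ∘ from) ≈ 1#
    Πh≈1 = *-cancelˡ {G} _ _ (product-≉0 (g ∘ from) (g≉0 ∘ from)) (begin
      G * Π.sum (h ∘ from)                 ≈⟨ *-comm _ _ ⟩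
      Π.sum (h ∘ from) * G                 ≈⟨ Π.∑-distrib-+ (h ∘ from) (g ∘ from) ⟨
      Π.sum (λ i → h (from i) * g (from i))  ≈⟨ Π.sum-cong-≋ (g-y* ∘ from) ⟨
      Π.sum (g ∘ (y *_) ∘ from)            ≈⟨ Π.reindex g (replace0-cong id id) (y *_) (y⁻¹ *_) *-congˡ *-congˡ
          (λ x → trans (solve 3 (λ y z x → y :* (z :* x) := z :* y :* x) refl y y⁻¹ x)
                 (trans (*-congʳ y⁻¹y≈1) (*-identityˡ x)))
          (λ x → trans (sym (*-assoc y⁻¹ y x)) (trans (*-congʳ y⁻¹y≈1) (*-identityˡ x))) ⟨
      G                                    ≈⟨ *-identityʳ G ⟨
      G * 1#                               ∎)

  private
    multiple-of : ∀ k {n} → n ×ₙ 1# ≈ 0# → (k ℕ.* n) ×ₙ 1# ≈ 0#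
    multiple-of k e = multiple-zero e (divides k ≡.refl) 1#

  coprime-multiples⇒1≈0 : ∀ {m n} → Coprime m n → m ×ₙ 1# ≈ 0# → n ×ₙ 1# ≈ 0# → 1# ≈ 0#
  coprime-multiples⇒1≈0 {m} {n} coprime m≈0 n≈0 with coprime-Bézout coprime
  ... | Bézout.+- x y eq = trans (sym (+-identityʳ 1#)) (trans (+-congˡ (sym (multiple-of y n≈0)))
    (trans (reflexive (≡.cong (_×ₙ 1#) eq)) (multiple-of x m≈0)))
  ... | Bézout.-+ x y eq = trans (sym (+-identityʳ 1#)) (trans (+-congˡ (sym (multiple-of x m≈0)))
    (trans (reflexive (≡.cong (_×ₙ 1#) eq)) (multiple-of y n≈0)))

  module Characteristic {p r} (pr : Prime p) (q≡p^r : q ≡ p ℕ.^ r) where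

    -- The r-th power of `p ×ₙ 1#` is `q ×ₙ 1#`, which is zero, and a field has no nilpotent
    -- elements.
    p×1≈0 : p ×ₙ 1# ≈ 0#
    p×1≈0 = ^-≈0 r (trans (sym (×1-homo-^ r)) (trans (reflexive (≡.cong (_×ₙ 1#) (≡.sym q≡p^r))) card×1≈0))
      where
      ×1-homo-^ : ∀ r → (p ℕ.^ r) ×ₙ 1# ≈ (p ×ₙ 1#) ^ r
      ×1-homo-^ zero    = +-identityʳ 1#
      ×1-homo-^ (suc r) = trans (×1-homo-* p (p ℕ.^ r)) (*-congˡ (×1-homo-^ r))

    -- Otherwise p and n are coprime, and by Bézout two vanishing coprime multiples of 1 give 1 = 0.
    n×1≈0⇒p∣n : ∀ {n} → n ×ₙ 1# ≈ 0# → p ∣ n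
    n×1≈0⇒p∣n {n} n≈0 with p ∣? n
    ... | yes p∣n = p∣n
    ... | no  p∤n = contradiction (coprime-multiples⇒1≈0 (coprime p∤n) p×1≈0 n≈0) 1≉0
      where
      coprime : ¬ p ∣ n → Coprime p n
      coprime p∤n (d∣p , d∣n) with prime⇒irreducible pr d∣p
      ... | inj₁ d≡1    = d≡1
      ... | inj₂ ≡.refl = contradiction d∣n p∤n

-- Odd fields: additive powers and field endomorphisms.

module OddField (F : FiniteField c ℓ q) {p r n : ℕ} (pr : Prime p)
                (q≡p^r : q ≡ p ℕ.^ suc r) (q-odd : q ≡ suc (n ℕ.+ n)) where
  open FieldFacts F public
  open Characteristic {p} {suc r} pr q≡p^r public
  open SetoidReasoning setoid
  private
    module Σ = FieldSum +-commutativeMonoid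
  open SemiringSum semiring using (*-distribˡ-sum)

  N = n ℕ.+ n

  N≢0 : N ≢ 0
  N≢0 N≡0 = 1≉0 (trans (sym (+-identityʳ 1#))
    (trans (reflexive (≡.cong (λ k → suc k ×ₙ 1#) (≡.sym N≡0)))
      (trans (reflexive (≡.cong (_×ₙ 1#) (≡.sym q-odd))) card×1≈0)))

  0^ : ∀ {k} → k ≢ 0 → 0# ^ k ≈ 0#
  0^ {zero}  k≢0 = contradiction ≡.refl k≢0
  0^ {suc k} k≢0 = zeroˡ _

  2≉0 : 1# + 1# ≉ 0#
  2≉0 2≈0 = 1≉0 (begin
    1#               ≈⟨ +-identityʳ 1# ⟨
    1# + 0#          ≈⟨ +-congˡ N×1≈0 ⟨
    suc N ×ₙ 1#      ≡⟨ ≡.cong (_×ₙ 1#) q-odd ⟨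
    q ×ₙ 1#          ≈⟨ card×1≈0 ⟩
    0#               ∎)
    where
    N×1≈0 : N ×ₙ 1# ≈ 0#
    N×1≈0 = multiple-zero (trans (+-congˡ (+-identityʳ 1#)) 2≈0)
      (divides n (≡.trans (≡.cong (n ℕ.+_) (≡.sym (ℕ.+-identityʳ n))) (ℕ.*-comm 2 n))) 1#

  all-roots⇒zero : ∀ {k} → k ℕ.≤ q → (as : Vec Carrier k) → (∀ x → eval as x ≈ 0#) → All (_≈ 0#) as
  all-roots⇒zero k≤q as root = roots⇒zero k≤q as from from-regular (root ∘ from)

  fermat′ : ∀ {x} → x ≉ 0# → x ^ N ≈ 1#
  fermat′ {x} x≉0 = *-cancelˡ _ _ x≉0 (begin
    x ^ suc N  ≡⟨ ≡.cong (x ^_) q-odd ⟨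
    x ^ q      ≈⟨ fermat x ⟩
    x          ≈⟨ *-identityʳ x ⟨
    x * 1#     ∎)

  frob : ℕ → Carrier → Carrier
  frob j x = x ^ (p ℕ.^ j)

  frob-+ : ∀ j x y → frob j (x + y) ≈ frob j x + frob j y
  frob-+ = frobenius^-+ pr p×1≈0

  -- As `q = p ^ (r + 1)`, the exponents `p ^ j` and `p ^ (r * j)` multiply to `q ^ j`, and the q-th
  -- power is the identity by Fermat.
  frob-inverse : ∀ j → ∃ λ i → ∀ x → frob i (frob j x) ≈ x × frob j (frob i x) ≈ x
  frob-inverse j = r ℕ.* j , λ x →
      trans (^-assocʳ x (p ℕ.^ j) (p ℕ.^ (r ℕ.* j))) (trans (^-congʳ x exponent) (iterate j x))
    , trans (^-assocʳ x (p ℕ.^ (r ℕ.* j)) (p ℕ.^ j))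
        (trans (^-congʳ x (≡.trans (ℕ.*-comm (p ℕ.^ (r ℕ.* j)) (p ℕ.^ j)) exponent)) (iterate j x))
    where
    iterate : ∀ j x → x ^ (q ℕ.^ j) ≈ x
    iterate zero    x = *-identityʳ x
    iterate (suc j) x = trans (sym (^-assocʳ x q _)) (trans (iterate j (x ^ q)) (fermat x))

    exponent : p ℕ.^ j ℕ.* p ℕ.^ (r ℕ.* j) ≡ q ℕ.^ j
    exponent = ≡.trans (≡.sym (ℕ.^-distribˡ-+-* p j (r ℕ.* j)))
      (≡.trans (≡.sym (ℕ.^-*-assoc p (suc r) j)) (≡.cong (ℕ._^ j) (≡.sym q≡p^r)))

  frob-injective : ∀ j {x y} → frob j x ≈ frob j y → x ≈ y
  frob-injective j {x} {y} e with i , inverse ← frob-inverse j =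
    trans (sym (proj₁ (inverse x))) (trans (^-congˡ (p ℕ.^ i) e) (proj₁ (inverse y)))

  private
    1+x-expansion : ∀ k → ∃ λ f → IsPoly k f ×
      ∀ x → (1# + x) ^ suc k ≈ 1# + suc k ×ₙ 1# * x + x * (x * f x)
    1+x-expansion zero = (λ _ → 0#) , poly-0 , λ x →
      solve 1 (λ x → (con (+ 1) :+ x) :^ 1 := con (+ 1) :+ (con (+ 1) :+ con (+ 0)) :* x :+ x :* (x :* con (+ 0))) refl x
    1+x-expansion (suc k) with f , poly-f , eq ← 1+x-expansion k =
      (λ x → suc k ×ₙ 1# + (1# + 1# * x) * f x) ,
      poly-+ (poly-const _) (poly-linear* 1# 1# poly-f) ,
      λ x → trans (*-congˡ (eq x))
        (solve 3 (λ x ν u → (con (+ 1) :+ x) :* (con (+ 1) :+ ν :* x :+ x :* (x :* u)) :=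
            con (+ 1) :+ (con (+ 1) :+ ν) :* x :+ x :* (x :* (ν :+ (con (+ 1) :+ con (+ 1) :* x) :* u)))
          refl x (suc k ×ₙ 1#) (f x))

  AdditivePower : ℕ → Set _
  AdditivePower m = ∀ x y → (x + y) ^ m ≈ x ^ m + y ^ m

  -- The polynomial (1 + X)ᵐ - 1 - Xᵐ has degree at most m < q and vanishes everywhere, so all its
  -- coefficients are zero. Since m ≥ 2, the one at X is m, untouched by the subtraction of Xᵐ.
  additivePower⇒p∣m : ∀ {k} → suc (suc k) ℕ.< q → AdditivePower (suc (suc k)) → p ∣ suc (suc k)
  additivePower⇒p∣m {k} m<q additive = n×1≈0⇒p∣n (second (all-roots⇒zero m<q (0# ∷ ν ∷ bs) root))
    where
    m = suc (suc k)
    ν = m ×ₙ 1#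
    expansion = 1+x-expansion (suc k)
    f = proj₁ expansion
    eq = proj₂ (proj₂ expansion)

    poly : IsPoly (suc k) (λ x → f x + - 1# * x ^ k)
    poly = poly-+ (proj₁ (proj₂ expansion)) (poly-scale (- 1#) (poly-^ k))

    bs = proj₁ poly

    second : ∀ {a b} {as : Vec Carrier (suc k)} → All (_≈ 0#) (a ∷ b ∷ as) → b ≈ 0#
    second (_ ∷ b≈0 ∷ _) = b≈0

    root : ∀ x → eval (0# ∷ ν ∷ bs) x ≈ 0#
    root x = begin
      0# + x * (ν + x * eval bs x)
        ≈⟨ +-congˡ (*-congˡ (+-congˡ (*-congˡ (proj₂ poly x)))) ⟨
      0# + x * (ν + x * (f x + - 1# * x ^ k))
        ≈⟨ solve 4 (λ x ν u z → con (+ 0) :+ x :* (ν :+ x :* (u :+ :- con (+ 1) :* z)) :=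
             (con (+ 1) :+ ν :* x :+ x :* (x :* u)) :- (con (+ 1) :+ x :* (x :* z))) refl x ν (f x) (x ^ k) ⟩
      (1# + ν * x + x * (x * f x)) - (1# + x ^ m)
        ≈⟨ +-cong (eq x) (-‿cong (+-congʳ (1^ m))) ⟨
      (1# + x) ^ m - (1# ^ m + x ^ m)
        ≈⟨ ≈⇒-≈0 (additive 1# x) ⟩
      0#  ∎

  -- Divide m by p, cancelling the Frobenius, until p no longer divides m.
  additivePower : ∀ fuel m → m ℕ.≤ fuel → 0 ℕ.< m → m ℕ.< q → AdditivePower m → ∃ λ j → m ≡ p ℕ.^ j
  additivePower _          (suc zero) _         _   _   _        = 0 , ≡.refl
  additivePower (suc fuel) m@(suc (suc _)) m≤fuel 0<m m<q additive =
    divide (additivePower⇒p∣m m<q additive)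
    where
    divide : p ∣ m → ∃ λ j → m ≡ p ℕ.^ j
    divide (divides (suc k) m≡k*p) =
      suc (proj₁ rec) , ≡.trans m≡k*p (≡.trans (≡.cong (ℕ._* p) (proj₂ rec)) (ℕ.*-comm _ p))
      where
      k<m : suc k ℕ.< m
      k<m = ≡.subst (suc k ℕ.<_) (≡.sym m≡k*p) (ℕ.m<m*n (suc k) p (ℕ.nonTrivial⇒n>1 p {{prime⇒nonTrivial pr}}))

      p-th-power : ∀ x → frob 1 (x ^ suc k) ≈ x ^ m
      p-th-power x = trans (^-assocʳ x (suc k) (p ℕ.^ 1))
        (^-congʳ x (≡.trans (≡.cong (suc k ℕ.*_) (ℕ.*-identityʳ p)) (≡.sym m≡k*p)))

      rec : ∃ λ j → suc k ≡ p ℕ.^ j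
      rec = additivePower fuel (suc k) (ℕ.≤-pred (ℕ.<-≤-trans k<m m≤fuel)) (s≤s z≤n) (ℕ.<-trans k<m m<q)
        λ x y → frob-injective 1 (begin
          frob 1 ((x + y) ^ suc k)                    ≈⟨ p-th-power (x + y) ⟩
          (x + y) ^ m                                 ≈⟨ additive x y ⟩
          x ^ m + y ^ m                               ≈⟨ +-cong (p-th-power x) (p-th-power y) ⟨
          frob 1 (x ^ suc k) + frob 1 (y ^ suc k)     ≈⟨ frob-+ 1 _ _ ⟨
          frob 1 (x ^ suc k + y ^ suc k)              ∎)

  module FieldEndomorphism
    (σ : Carrier → Carrier)
    (σ-cong : ∀ {x y} → x ≈ y → σ x ≈ σ y)
    (σ-+ : ∀ x y → σ (x + y) ≈ σ x + σ y)
    (σ-* : ∀ x y → σ (x * y) ≈ σ x * σ y)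
    (σ-1 : σ 1# ≈ 1#)
    where

    σ-0 : σ 0# ≈ 0#
    σ-0 = begin
      σ 0#                      ≈⟨ solve 1 (λ x → x := (x :+ x) :- x) refl (σ 0#) ⟩
      (σ 0# + σ 0#) - σ 0#      ≈⟨ +-congʳ (σ-+ 0# 0#) ⟨
      σ (0# + 0#) - σ 0#        ≈⟨ ≈⇒-≈0 (σ-cong (+-identityˡ 0#)) ⟩
      0#                        ∎

    moment : ℕ → Carrier
    moment k = Σ.sum (λ i → σ (from i) * from i ^ k)

    private
      -- The weight w is arbitrary so that a Horner step can absorb its factor x into it; the
      -- moments then shift by one.
      moments-zero : ∀ {k} (w : Carrier → Carrier) (as : Vec Carrier k) →
        (∀ i → i ℕ.< k → Σ.sum (λ j → w (from j) * from j ^ i) ≈ 0#) →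
        Σ.sum (λ j → w (from j) * eval as (from j)) ≈ 0#
      moments-zero w []       moment≈0 = trans (Σ.sum-cong-≋ {q} (λ j → zeroʳ _)) (Σ.sum-replicate-zero q)
      moments-zero w (a ∷ as) moment≈0 = begin
        Σ.sum (λ j → w (from j) * (a + from j * eval as (from j)))
          ≈⟨ Σ.sum-cong-≋ {q} (λ j → solve 4 (λ w a x u →
               w :* (a :+ x :* u) := a :* (w :* con (+ 1)) :+ w :* x :* u) refl (w (from j)) a (from j) _) ⟩
        Σ.sum (λ j → a * (w (from j) * 1#) + w (from j) * from j * eval as (from j))
          ≈⟨ Σ.∑-distrib-+ {q} _ _ ⟩
        Σ.sum (λ j → a * (w (from j) * 1#)) + Σ.sum (λ j → w (from j) * from j * eval as (from j))
          ≈⟨ +-cong (sym (*-distribˡ-sum {q} a _))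
               (moments-zero (λ x → w x * x) as λ i i<k → trans
                 (Σ.sum-cong-≋ {q} (λ j → *-assoc _ _ _)) (moment≈0 (suc i) (s≤s i<k))) ⟩
        a * Σ.sum (λ j → w (from j) * 1#) + 0#
          ≈⟨ +-identityʳ _ ⟩
        a * Σ.sum (λ j → w (from j) * 1#)
          ≈⟨ trans (*-congˡ (moment≈0 0 (s≤s z≤n))) (zeroʳ a) ⟩
        0#  ∎

    -- The polynomial 1 - (x - 1)^(q-1) is the indicator function of 1.
    some-moment : ∃ λ k → k ℕ.≤ N × moment k ≉ 0#
    some-moment with Fin.any? {n = suc N} (λ k → ¬? (moment (Fin.toℕ k) ≟ 0#))
    ... | yes (k , ≉0) = Fin.toℕ k , ℕ.≤-pred (Fin.toℕ<n k) , ≉0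
    ... | no  none     = contradiction (begin
      1#                                            ≈⟨ *-identityʳ 1# ⟨
      1# * 1#                                       ≈⟨ *-cong (trans (σ-cong (strictlyInverseʳ 1#)) σ-1)
                                                              (trans (δ-cong (strictlyInverseʳ 1#)) δ-1) ⟨
      σ (from (to 1#)) * δ (from (to 1#))           ≈⟨ Σ.sum-single (to 1#) _ (λ j j≢ →
          trans (*-congˡ (δ-≉1 λ e → j≢ (≡.trans (≡.sym (strictlyInverseˡ j)) (to-cong e)))) (zeroʳ _)) ⟨
      Σ.sum (λ j → σ (from j) * δ (from j))         ≈⟨ Σ.sum-cong-≋ {q} (λ j → *-congˡ (proj₂ poly-δ (from j))) ⟩
      Σ.sum (λ j → σ (from j) * eval (proj₁ poly-δ) (from j))  ≈⟨ moments-zero σ (proj₁ poly-δ) moment≈0 ⟩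
      0#                                            ∎) 1≉0
      where
      δ : Carrier → Carrier
      δ x = 1# + - 1# * (- 1# + 1# * x) ^ N

      δ-cong : ∀ {x y} → x ≈ y → δ x ≈ δ y
      δ-cong e = +-congˡ (*-congˡ (^-congˡ N (+-congˡ (*-congˡ e))))

      x-1 : ∀ x → - 1# + 1# * x ≈ x - 1#
      x-1 = solve 1 (λ x → :- con (+ 1) :+ con (+ 1) :* x := x :- con (+ 1)) refl

      δ-≉1 : ∀ {x} → x ≉ 1# → δ x ≈ 0#
      δ-≉1 {x} x≉1 = trans
        (+-congˡ (*-congˡ (fermat′ (λ e → x≉1 (-≈0⇒≈ (trans (sym (x-1 x)) e))))))
        (solve 0 (con (+ 1) :+ :- con (+ 1) :* con (+ 1) := con (+ 0)) refl)

      δ-1 : δ 1# ≈ 1#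
      δ-1 = trans (+-congˡ (*-congˡ (trans (^-congˡ N (trans (x-1 1#) (-‿inverseʳ 1#))) (0^ N≢0))))
                  (solve 0 (con (+ 1) :+ :- con (+ 1) :* con (+ 0) := con (+ 1)) refl)

      poly-δ : IsPoly (suc N) δ
      poly-δ = poly-+ (poly-const 1#) (poly-scale (- 1#) (poly-linear^ (- 1#) 1# N))

      moment≈0 : ∀ i → i ℕ.< suc N → moment i ≈ 0#
      moment≈0 i i<q with moment i ≟ 0#
      ... | yes e = e
      ... | no ≉0 = contradiction (Fin.fromℕ< i<q ,
        (λ e → ≉0 (≡.subst (λ k → moment k ≈ 0#) (Fin.toℕ-fromℕ< i<q) e))) none

    moment-invariant : ∀ {y} k → y ≉ 0# → σ y * y ^ k * moment k ≈ moment k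
    moment-invariant {y} k y≉0 with z , zy≈1 ← inv y y≉0 = sym (begin
      moment k
        ≈⟨ Σ.reindex w w-cong (y *_) (z *_) *-congˡ *-congˡ
             (λ x → trans (solve 3 (λ y z x → y :* (z :* x) := z :* y :* x) refl y z x) (cancel x))
             (λ x → trans (sym (*-assoc z y x)) (cancel x)) ⟩
      Σ.sum (λ i → σ (y * from i) * (y * from i) ^ k)
        ≈⟨ Σ.sum-cong-≋ {q} (λ i → trans (*-cong (σ-* y (from i)) (^-distrib-* y (from i) k))
             (solve 4 (λ a b u v → a :* b :* (u :* v) := a :* u :* (b :* v)) refl _ _ _ _)) ⟩
      Σ.sum (λ i → σ y * y ^ k * w (from i))
        ≈⟨ *-distribˡ-sum {q} (σ y * y ^ k) _ ⟨
      σ y * y ^ k * moment k  ∎)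
      where
      w = λ x → σ x * x ^ k
      w-cong : ∀ {x y} → x ≈ y → w x ≈ w y
      w-cong e = *-cong (σ-cong e) (^-congˡ k e)
      cancel : ∀ x → z * y * x ≈ x
      cancel x = trans (*-congʳ zy≈1) (*-identityˡ x)

    is-power : ∃ λ m → 0 ℕ.< m × m ℕ.< q × ∀ x → σ x ≈ x ^ m
    is-power with k , k≤N , moment≉0 ← some-moment =
      N ℕ.∸ k , ℕ.n≢0⇒n>0 m≢0 , ≡.subst (N ℕ.∸ k ℕ.<_) (≡.sym q-odd) (s≤s (ℕ.m∸n≤m N k)) , power
      where
      -- A nonzero moment cancels from its invariance and leaves σ(y) yᵏ = 1; then yᴺ = 1 turns the
      -- inverse of yᵏ into a power with natural exponent.
      power-≉0 : ∀ {y} → y ≉ 0# → σ y ≈ y ^ (N ℕ.∸ k)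
      power-≉0 {y} y≉0 = begin
        σ y                              ≈⟨ *-identityʳ _ ⟨
        σ y * 1#                         ≈⟨ *-congˡ (fermat′ y≉0) ⟨
        σ y * y ^ N                      ≡⟨ ≡.cong (λ i → σ y * y ^ i) (ℕ.m+[n∸m]≡n k≤N) ⟨
        σ y * y ^ (k ℕ.+ (N ℕ.∸ k))      ≈⟨ *-congˡ (^-homo-* y k (N ℕ.∸ k)) ⟩
        σ y * (y ^ k * y ^ (N ℕ.∸ k))    ≈⟨ *-assoc _ _ _ ⟨
        σ y * y ^ k * y ^ (N ℕ.∸ k)      ≈⟨ *-congʳ (*-cancelˡ _ _ moment≉0
          (trans (*-comm _ _) (trans (moment-invariant k y≉0) (sym (*-identityʳ _))))) ⟩
        1# * y ^ (N ℕ.∸ k)               ≈⟨ *-identityˡ _ ⟩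
        y ^ (N ℕ.∸ k)                    ∎

      -- Exponent 0 would give σ(-1) = 1 and hence 0 = σ(-1) + σ(1) = 2. A positive exponent is what
      -- makes the formula valid at x = 0.
      m≢0 : N ℕ.∸ k ≢ 0
      m≢0 m≡0 = 2≉0 (begin
        1# + 1#            ≈⟨ +-cong (trans (power-≉0 -1≉0) (^-congʳ _ m≡0)) σ-1 ⟨
        σ (- 1#) + σ 1#    ≈⟨ σ-+ (- 1#) 1# ⟨
        σ (- 1# + 1#)      ≈⟨ σ-cong (-‿inverseˡ 1#) ⟩
        σ 0#               ≈⟨ σ-0 ⟩
        0#                 ∎)

      power : ∀ x → σ x ≈ x ^ (N ℕ.∸ k)
      power x with x ≟ 0#
      ... | yes x≈0 = trans (σ-cong x≈0) (trans σ-0 (sym (trans (^-congˡ (N ℕ.∸ k) x≈0) (0^ m≢0))))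
      ... | no  x≉0 = power-≉0 x≉0

    is-frobenius : ∃ λ j → ∀ x → σ x ≈ frob j x
    is-frobenius = convert is-power
      where
      convert : (∃ λ m → 0 ℕ.< m × m ℕ.< q × ∀ x → σ x ≈ x ^ m) → ∃ λ j → ∀ x → σ x ≈ frob j x
      convert (m , 0<m , m<q , power) = proj₁ prime-power ,
        λ x → trans (power x) (^-congʳ x (proj₂ prime-power))
        where
        prime-power : ∃ λ j → m ≡ p ℕ.^ j
        prime-power = additivePower m m ℕ.≤-refl 0<m m<q
          λ x y → trans (sym (power (x + y))) (trans (σ-+ x y) (+-cong (power x) (power y)))

-- Euler's criterion and square roots of -1.

module Squares (F : FiniteField c ℓ q) {p r n : ℕ} (pr : Prime p)
               (q≡p^r : q ≡ p ℕ.^ suc r) (q-odd : q ≡ suc (n ℕ.+ n)) where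
  open OddField F {r = r} {n = n} pr q≡p^r q-odd public
  open SetoidReasoning setoid

  Square : Carrier → Set _
  Square = IsSquare commutativeRing

  square-cong : ∀ {x y} → x ≈ y → Square x → Square y
  square-cong x≈y (t , e) = t , trans (sym x≈y) e

  square-^n : ∀ {x} → x ≉ 0# → Square x → x ^ n ≈ 1#
  square-^n {x} x≉0 (t , x≈t²) = begin
    x ^ n            ≈⟨ ^-congˡ n x≈t² ⟩
    (t * t) ^ n      ≈⟨ ^-distrib-* t t n ⟩
    t ^ n * t ^ n    ≈⟨ ^-homo-* t n n ⟨
    t ^ N            ≈⟨ fermat′ (λ t≈0 → x≉0 (trans x≈t² (trans (*-congˡ t≈0) (zeroʳ t)))) ⟩
    1#               ∎

  -- For nonzero u, v Euler's criterion gives uⁿvⁿ = 1, and v²ⁿ = 1 turns this into uⁿ = vⁿ. The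
  -- factor uv makes the equation hold at zero too, so that it becomes a polynomial identity without
  -- exceptional points.
  square-product : ∀ u v → Square (u * v) → u ^ suc n * v ≈ u * v ^ suc n
  square-product u v sq with u ≟ 0# | v ≟ 0#
  ... | yes u≈0 | _       = trans (*-congʳ (trans (*-congʳ u≈0) (zeroˡ _)))
                              (trans (zeroˡ v) (sym (trans (*-congʳ u≈0) (zeroˡ _))))
  ... | no  _   | yes v≈0 = trans (trans (*-congˡ v≈0) (zeroʳ _))
                              (sym (trans (*-congˡ (trans (*-congʳ v≈0) (zeroˡ _))) (zeroʳ u)))
  ... | no  u≉0 | no v≉0  = begin
    u * u ^ n * v                      ≈⟨ solve 3 (λ u v x → u :* x :* v := u :* (v :* (x :* con (+ 1)))) refl u v (u ^ n) ⟩
    u * (v * (u ^ n * 1#))             ≈⟨ *-congˡ (*-congˡ (*-congˡ (trans (sym (^-homo-* v n n)) (fermat′ v≉0)))) ⟨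
    u * (v * (u ^ n * (v ^ n * v ^ n)))  ≈⟨ solve 4 (λ u v x y → u :* (v :* (x :* (y :* y))) := u :* (v :* (x :* y :* y))) refl u v (u ^ n) (v ^ n) ⟩
    u * (v * (u ^ n * v ^ n * v ^ n))  ≈⟨ *-congˡ (*-congˡ (*-congʳ (trans (sym (^-distrib-* u v n)) (square-^n (*-≉0 u≉0 v≉0) sq)))) ⟩
    u * (v * (1# * v ^ n))             ≈⟨ *-congˡ (*-congˡ (*-identityˡ _)) ⟩
    u * v ^ suc n                      ∎

  -- Since 2n + 1 = q vanishes in the field, n = -1/2, n + 1 = 1/2 and C(n + 1, 2) = -1/8 there.
  -- This is why the binomial coefficients used below are nonzero in every odd characteristic.
  2n×1≈-1 : n ×ₙ 1# + n ×ₙ 1# ≈ - 1#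
  2n×1≈-1 = begin
    ν + ν                  ≈⟨ solve 1 (λ ν → ν :+ ν := (con (+ 1) :+ (ν :+ ν)) :- con (+ 1)) refl ν ⟩
    (1# + (ν + ν)) - 1#    ≈⟨ +-congʳ (+-congˡ (×-homo-+ 1# n n)) ⟨
    suc N ×ₙ 1# - 1#       ≈⟨ +-congʳ (trans (reflexive (≡.cong (_×ₙ 1#) (≡.sym q-odd))) card×1≈0) ⟩
    0# - 1#                ≈⟨ +-identityˡ _ ⟩
    - 1#                   ∎
    where ν = n ×ₙ 1#

  n×1≉0 : n ×ₙ 1# ≉ 0#
  n×1≉0 e = -1≉0 (trans (sym 2n×1≈-1) (trans (+-cong e e) (+-identityˡ 0#)))

  [1+n]×1≉0 : suc n ×ₙ 1# ≉ 0#
  [1+n]×1≉0 e = 1≉0 (begin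
    1#                        ≈⟨ solve 0 (con (+ 1) := con (+ 1) :+ (con (+ 1) :+ :- con (+ 1))) refl ⟩
    1# + (1# + - 1#)          ≈⟨ +-congˡ (+-congˡ 2n×1≈-1) ⟨
    1# + (1# + (ν + ν))       ≈⟨ solve 1 (λ ν → con (+ 1) :+ (con (+ 1) :+ (ν :+ ν)) := (con (+ 1) :+ ν) :+ (con (+ 1) :+ ν)) refl ν ⟩
    (1# + ν) + (1# + ν)       ≈⟨ +-cong e e ⟩
    0# + 0#                   ≈⟨ +-identityˡ 0# ⟩
    0#                        ∎)
    where ν = n ×ₙ 1#

  [1+n]C2×1≉0 : (suc n C 2) ×ₙ 1# ≉ 0#
  [1+n]C2×1≉0 e = *-≉0 [1+n]×1≉0 n×1≉0 (begin
    suc n ×ₙ 1# * n ×ₙ 1#                ≈⟨ ×1-homo-* (suc n) n ⟨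
    (suc n ℕ.* n) ×ₙ 1#                  ≡⟨ ≡.cong (λ k → (suc n ℕ.* k) ×ₙ 1#) (nC1≡n n) ⟨
    (suc n ℕ.* (n C 1)) ×ₙ 1#            ≡⟨ ≡.cong (_×ₙ 1#) (absorption n 1) ⟨
    (2 ℕ.* (suc n C 2)) ×ₙ 1#            ≈⟨ ×1-homo-* 2 (suc n C 2) ⟩
    2 ×ₙ 1# * (suc n C 2) ×ₙ 1#          ≈⟨ trans (*-congˡ e) (zeroʳ _) ⟩
    0#                                   ∎)

  [-1]^2k : ∀ k → (- 1#) ^ (k ℕ.+ k) ≈ 1#
  [-1]^2k k = begin
    (- 1#) ^ (k ℕ.+ k)        ≈⟨ ^-homo-* (- 1#) k k ⟩
    (- 1#) ^ k * (- 1#) ^ k   ≈⟨ ^-distrib-* (- 1#) (- 1#) k ⟨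
    (- 1# * - 1#) ^ k         ≈⟨ ^-congˡ k (solve 0 (:- con (+ 1) :* :- con (+ 1) := con (+ 1)) refl) ⟩
    1# ^ k                    ≈⟨ 1^ k ⟩
    1#                        ∎

  -- Xⁿ⁺¹ - X has too small a degree to vanish everywhere, so some x has xⁿ = -1.
  √-1 : ∀ h → n ≡ h ℕ.+ h → ∃ λ j → j * j ≈ - 1#
  √-1 h n≡2h with Fin.any? (λ i → ¬? (from i ^ suc n ≟ from i))
  ... | yes (i , x^n≉x) = x ^ h , trans (sym (^-homo-* x h h)) (trans (^-congʳ x (≡.sym n≡2h)) x^n≈-1)
    where
    x = from i
    y = x ^ n

    y≉1 : y - 1# ≉ 0#
    y≉1 e = x^n≉x (trans (*-congˡ (-≈0⇒≈ e)) (*-identityʳ x))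

    y²≈1 : y * y ≈ 1#
    y²≈1 = trans (sym (^-homo-* x n n)) (fermat′ λ x≈0 →
      x^n≉x (trans (*-congʳ x≈0) (trans (zeroˡ _) (sym x≈0))))

    x^n≈-1 : y ≈ - 1#
    x^n≈-1 = -≈0⇒≈ (regular y≉1 (y - - 1#) (trans
      (solve 1 (λ y → (y :- con (+ 1)) :* (y :- :- con (+ 1)) := y :* y :- con (+ 1)) refl y)
      (≈⇒-≈0 y²≈1)))
  ... | no none = contradiction (coefficient n (λ e → N≢0 (≡.cong₂ ℕ._+_ e e)) n≤N x^n≈x) -1≉0
    where
    n≤N : suc (suc n) ℕ.≤ q
    n≤N = ≡.subst (suc (suc n) ℕ.≤_) (≡.sym q-odd)
      (s≤s (ℕ.m<m+n n (ℕ.n≢0⇒n>0 λ e → N≢0 (≡.cong₂ ℕ._+_ e e))))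

    x^n≈x : ∀ x → x ^ suc n ≈ x
    x^n≈x x with x ^ suc n ≟ x
    ... | yes e = e
    ... | no ≉x = contradiction (to x , λ e → ≉x (trans (^-congˡ (suc n) (≈from x)) (trans e (strictlyInverseʳ x)))) none

    coefficient : ∀ m → m ≢ 0 → suc (suc m) ℕ.≤ q → (∀ x → x ^ suc m ≈ x) → - 1# ≈ 0#
    coefficient zero    m≢0 _   _  = contradiction ≡.refl m≢0
    coefficient (suc m) _   m<q eq = second (all-roots⇒zero m<q (0# ∷ - 1# ∷ proj₁ poly) root)
      where
      poly : IsPoly (suc m) (_^ m)
      poly = poly-^ m

      second : ∀ {k a b} {as : Vec Carrier k} → All (_≈ 0#) (a ∷ b ∷ as) → b ≈ 0#
      second (_ ∷ b≈0 ∷ _) = b≈0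

      root : ∀ x → eval (0# ∷ - 1# ∷ proj₁ poly) x ≈ 0#
      root x = begin
        0# + x * (- 1# + x * eval (proj₁ poly) x)  ≈⟨ +-congˡ (*-congˡ (+-congˡ (*-congˡ (proj₂ poly x)))) ⟨
        0# + x * (- 1# + x * x ^ m)                ≈⟨ solve 2 (λ x z → con (+ 0) :+ x :* (:- con (+ 1) :+ x :* z) := x :* (x :* z) :- x) refl x (x ^ m) ⟩
        x ^ suc (suc m) - x                        ≈⟨ ≈⇒-≈0 (eq x) ⟩
        0#                                         ∎

  -- By Fermat the (q - 1)-st power of j is 1, but it is also (j²)ⁿ = (-1)ⁿ = -1 for odd n.
  -1-nonsquare : ∀ h → n ≡ suc (h ℕ.+ h) → ∀ j → j * j ≉ - 1#
  -1-nonsquare h n-odd j j²≈-1 = 2≉0 (begin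
    1# + 1#             ≈⟨ +-congʳ (fermat′ j≉0) ⟨
    j ^ N + 1#          ≈⟨ +-congʳ (trans (^-homo-* j n n) (sym (^-distrib-* j j n))) ⟩
    (j * j) ^ n + 1#    ≈⟨ +-congʳ (^-cong j²≈-1 n-odd) ⟩
    - 1# * (- 1#) ^ (h ℕ.+ h) + 1#  ≈⟨ +-congʳ (*-congˡ ([-1]^2k h)) ⟩
    - 1# * 1# + 1#      ≈⟨ solve 0 (:- con (+ 1) :* con (+ 1) :+ con (+ 1) := con (+ 0)) refl ⟩
    0#                  ∎)
    where
    j≉0 : j ≉ 0#
    j≉0 j≈0 = -1≉0 (trans (sym j²≈-1) (trans (*-congʳ j≈0) (zeroˡ j)))

-- The case where -1 is a square.

module Split (F : FiniteField c ℓ q) {p r k : ℕ} (pr : Prime p)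
             (q≡p^r : q ≡ p ℕ.^ suc r) (q-odd : q ≡ suc ((2 ℕ.+ k) ℕ.+ (2 ℕ.+ k))) where
  private
    n = 2 ℕ.+ k

  open Squares F {r = r} {n = n} pr q≡p^r q-odd public
  open SetoidReasoning setoid

  m : ℕ
  m = suc n

  private
    ν = m ×ₙ 1#
    τ = (m C 2) ×ₙ 1#

  -- The terms in Xᵐ and Xᵐ⁺¹ that come from bᵐXᵐ are set apart because they will be lowered: at a
  -- square they equal X and X². The anonymous rest `t` still reaches degree m after its factor X³.
  product-expansion : ∀ a b c d → ∃ λ t → IsPoly (suc k) t × ∀ x →
    (a + b * x) ^ m * (c + d * x) ≈
      (a ^ m * c
        + x * ((ν * (a ^ (2 ℕ.+ k) * b) * c + a ^ m * d)
        + x * ((τ * (a ^ (1 ℕ.+ k) * (b * b)) * c + ν * (a ^ (2 ℕ.+ k) * b) * d)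
        + x * t x)))
      + b ^ m * c * x ^ m + b ^ m * d * (x * x ^ m)
  product-expansion a b c d =
    (λ x → A2 * d + (c + d * x) * f x) ,
    poly-+ (poly-const (A2 * d)) (poly-linear* c d (proj₁ (proj₂ (linear^-expansion a b k)))) ,
    λ x → trans (*-congʳ (proj₂ (proj₂ (linear^-expansion a b k)) x)) (expand (a ^ m) A1 A2 (b ^ m) (f x) (x ^ m) x c d)
    where
    f = proj₁ (linear^-expansion a b k)
    A1 = ν * (a ^ (2 ℕ.+ k) * b)
    A2 = τ * (a ^ (1 ℕ.+ k) * (b * b))
    expand : ∀ A0 A1 A2 B u Z x c d →
      (A0 + A1 * x + A2 * (x * x) + x * (x * (x * u)) + B * Z) * (c + d * x) ≈
      (A0 * c + x * ((A1 * c + A0 * d) + x * ((A2 * c + A1 * d) + x * (A2 * d + (c + d * x) * u))))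
      + B * c * Z + B * d * (x * Z)
    expand = solve 9 (λ A0 A1 A2 B u Z x c d →
      (A0 :+ A1 :* x :+ A2 :* (x :* x) :+ x :* (x :* (x :* u)) :+ B :* Z) :* (c :+ d :* x) :=
      (A0 :* c :+ x :* ((A1 :* c :+ A0 :* d) :+ x :* ((A2 :* c :+ A1 :* d) :+ x :* (A2 :* d :+ (c :+ d :* x) :* u))))
      :+ B :* c :* Z :+ B :* d :* (x :* Z)) refl

  -- The matrix acts on pairs (u , v), for which "norm" means u * v.
  Preserving : (a b c d : Carrier) → Set _
  Preserving a b c d = ∀ u v → Square (u * v) → Square ((a * u + b * v) * (c * u + d * v))

  module Coefficients {a b c d} (preserving : Preserving a b c d) where

    -- The hypothesis at `(0 , 1)`, a vector of norm 0. It equates the coefficients of Xᵐ⁺¹ on the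
    -- two sides of `at-square`, so nothing gets lowered onto X².
    top : b ^ m * d ≈ d ^ m * b
    top = trans (square-product b d (square-cong
      (solve 4 (λ a b c d → (a :* con (+ 0) :+ b :* con (+ 1)) :* (c :* con (+ 0) :+ d :* con (+ 1)) := b :* d) refl a b c d)
      (preserving 0# 1# (0# , refl′)))) (*-comm b (d ^ m))
      where
      refl′ : 0# * 1# ≈ 0# * 0#
      refl′ = trans (zeroˡ 1#) (sym (zeroˡ 0#))

    at-square : ∀ w → (a + b * (w * w)) ^ m * (c + d * (w * w)) ≈ (c + d * (w * w)) ^ m * (a + b * (w * w))
    at-square w = trans (square-product _ _ (square-cong
      (solve 5 (λ a b c d x → (a :* con (+ 1) :+ b :* x) :* (c :* con (+ 1) :+ d :* x) := (a :+ b :* x) :* (c :+ d :* x)) refl a b c d (w * w))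
      (preserving 1# (w * w) (w , *-identityˡ _)))) (*-comm _ _)

    -- Fermat, since 2m = q + 1.
    fold-top : ∀ w → (w * w) ^ m ≈ w * w
    fold-top w = begin
      w * w * (w * w) ^ n           ≈⟨ *-congˡ (trans (^-distrib-* w w n) (sym (^-homo-* w n n))) ⟩
      w * w * w ^ (n ℕ.+ n)         ≈⟨ *-assoc w w _ ⟩
      w * w ^ suc (n ℕ.+ n)         ≈⟨ *-congˡ (trans (^-congʳ w (≡.sym q-odd)) (fermat w)) ⟩
      w * w                         ∎

    private
      P = product-expansion a b c d
      Q = product-expansion c d a b

      tail : Carrier → Carrier
      tail x = proj₁ P x + - 1# * proj₁ Q x

      -- Multiplied by X³ the top term of the tail is s Xᵐ, one degree too many; at squares it
      -- equals s X and is moved there.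
      split-tail : ∃ λ s → ∃ λ g → IsPoly k g × ∀ x → tail x ≈ g x + s * x ^ k
      split-tail = poly-split-top (poly-+ (proj₁ (proj₂ P)) (poly-scale (- 1#) (proj₁ (proj₂ Q))))

      p₀ = a ^ m * c
      p₁ = ν * (a ^ (2 ℕ.+ k) * b) * c + a ^ m * d
      p₂ = τ * (a ^ (1 ℕ.+ k) * (b * b)) * c + ν * (a ^ (2 ℕ.+ k) * b) * d
      q₀ = c ^ m * a
      q₁ = ν * (c ^ (2 ℕ.+ k) * d) * a + c ^ m * b
      q₂ = τ * (c ^ (1 ℕ.+ k) * (d * d)) * a + ν * (c ^ (2 ℕ.+ k) * d) * b

      s = proj₁ split-tail
      ts = proj₁ (proj₁ (proj₂ (proj₂ split-tail)))
      h = b ^ m * c - d ^ m * a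

      tail-top : ∀ x → tail x ≈ eval ts x + s * x ^ k
      tail-top x = trans (proj₂ (proj₂ (proj₂ split-tail)) x)
        (+-congʳ (proj₂ (proj₁ (proj₂ (proj₂ split-tail))) x))

      ring₁ : ∀ x r₀ r₁ r₂ h s T z → r₀ + x * ((r₁ + h + s) + x * (r₂ + x * T)) ≈
        (r₀ + x * (r₁ + x * (r₂ + x * (T + s * z)))) + h * x + s * (x - x * (x * (x * z)))
      ring₁ = solve 8 (λ x r₀ r₁ r₂ h s T z →
        r₀ :+ x :* ((r₁ :+ h :+ s) :+ x :* (r₂ :+ x :* T)) :=
        (r₀ :+ x :* (r₁ :+ x :* (r₂ :+ x :* (T :+ s :* z)))) :+ h :* x :+ s :* (x :- x :* (x :* (x :* z)))) refl

      diff : ∀ {u v} x p q → u ≈ p → v ≈ q → ∀ y z → (y - z) + x * (u - v) ≈ (y + x * p) - (z + x * q)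
      diff x p q u≈p v≈q y z = trans (+-congˡ (*-congˡ (+-cong u≈p (-‿cong v≈q))))
        (solve 5 (λ x p q y z → (y :- z) :+ x :* (p :- q) := (y :+ x :* p) :- (z :+ x :* q)) refl x p q y z)

      nested : ∀ x t u →
        (p₀ - q₀) + x * ((p₁ - q₁) + x * ((p₂ - q₂) + x * (t + - 1# * u))) ≈
        (p₀ + x * (p₁ + x * (p₂ + x * t))) - (q₀ + x * (q₁ + x * (q₂ + x * u)))
      nested x t u = trans (+-congˡ (*-congˡ (trans (+-congˡ (*-congˡ (trans
        (+-congˡ (*-congˡ (+-congˡ (solve 1 (λ u → :- con (+ 1) :* u := :- u) refl u))))
        (diff x t u refl refl p₂ q₂))))
        (diff x _ _ refl refl p₁ q₁))))
        (diff x _ _ refl refl p₀ q₀)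

      ring₂ : ∀ y z α β γ δ Z X → (y - z) + (α - γ) * Z + 0# ≈
        (y + α * Z + β * (X * Z)) - (z + γ * Z + δ * (X * Z)) - (β - δ) * (X * Z)
      ring₂ = solve 8 (λ y z α β γ δ Z X → (y :- z) :+ (α :- γ) :* Z :+ con (+ 0) :=
        (y :+ α :* Z :+ β :* (X :* Z)) :- (z :+ γ :* Z :+ δ :* (X :* Z)) :- (β :- δ) :* (X :* Z)) refl

      -- `h` and `s` are what Xᵐ contributes to X after lowering, while the Xᵐ⁺¹ terms cancel by
      -- `top`. So the first and third entries are still plain differences of coefficients, and
      -- these are the two extracted afterwards.
      root : ∀ w → eval ((p₀ - q₀) ∷ ((p₁ - q₁) + h + s) ∷ (p₂ - q₂) ∷ ts) (w * w) ≈ 0#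
      root w = begin
        (p₀ - q₀) + x * (((p₁ - q₁) + h + s) + x * ((p₂ - q₂) + x * T))
          ≈⟨ ring₁ x (p₀ - q₀) (p₁ - q₁) (p₂ - q₂) h s T (x ^ k) ⟩
        ((p₀ - q₀) + x * ((p₁ - q₁) + x * ((p₂ - q₂) + x * (T + s * x ^ k)))) + h * x + s * (x - Z)
          ≈⟨ +-cong (+-cong (trans (+-congˡ (*-congˡ (+-congˡ (*-congˡ (+-congˡ (*-congˡ (sym (tail-top x))))))))
                                   (nested x (proj₁ P x) (proj₁ Q x)))
                            (*-congˡ (sym (fold-top w))))
                    (trans (*-congˡ (≈⇒-≈0 (sym (fold-top w)))) (zeroʳ s)) ⟩
        (Px - Qx) + h * Z + 0#
          ≈⟨ ring₂ Px Qx (b ^ m * c) (b ^ m * d) (d ^ m * a) (d ^ m * b) Z x ⟩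
        (Px + b ^ m * c * Z + b ^ m * d * (x * Z)) - (Qx + d ^ m * a * Z + d ^ m * b * (x * Z))
          - (b ^ m * d - d ^ m * b) * (x * Z)
          ≈⟨ +-cong (+-cong (proj₂ (proj₂ P) x) (-‿cong (proj₂ (proj₂ Q) x)))
                    (-‿cong (sym (trans (*-congʳ (≈⇒-≈0 top)) (zeroˡ _)))) ⟨
        (a + b * x) ^ m * (c + d * x) - (c + d * x) ^ m * (a + b * x) - 0#
          ≈⟨ +-congʳ (≈⇒-≈0 (at-square w)) ⟩
        0# - 0#
          ≈⟨ -‿inverseʳ 0# ⟩
        0#  ∎
        where
        x = w * w
        T = eval ts x
        Z = x ^ m
        Px = p₀ + x * (p₁ + x * (p₂ + x * proj₁ P x))
        Qx = q₀ + x * (q₁ + x * (q₂ + x * proj₁ Q x))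

      zeros : All (_≈ 0#) ((p₀ - q₀) ∷ ((p₁ - q₁) + h + s) ∷ (p₂ - q₂) ∷ ts)
      zeros = square-roots⇒zero (ℕ.≤-reflexive (≡.sym q-odd)) _ from from-regular (root ∘ from)

      first : ∀ {u v w} {as : Vec Carrier k} → All (_≈ 0#) (u ∷ v ∷ w ∷ as) → u ≈ 0# × w ≈ 0#
      first (u≈0 ∷ _ ∷ w≈0 ∷ _) = u≈0 , w≈0

    coefficient₀ : a ^ m * c ≈ c ^ m * a
    coefficient₀ = -≈0⇒≈ (proj₁ (first zeros))

    coefficient₂ : τ * (a ^ (1 ℕ.+ k) * (b * b)) * c + ν * (a ^ (2 ℕ.+ k) * b) * d
                 ≈ τ * (c ^ (1 ℕ.+ k) * (d * d)) * a + ν * (c ^ (2 ℕ.+ k) * d) * b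
    coefficient₂ = -≈0⇒≈ (proj₂ (first zeros))

  Monomial : (a b c d : Carrier) → Set _
  Monomial a b c d = (b ≈ 0# × c ≈ 0#) ⊎ (a ≈ 0# × d ≈ 0#)

  module _ {a b c d} (det≉0 : a * d - b * c ≉ 0#) (preserving : Preserving a b c d) where
    open Coefficients preserving

    private
      -- With a = 0 the left side of `coefficient₂` vanishes and the right side is ν cⁿ d b, where b
      -- and c are nonzero by the determinant.
      a≈0⇒ : a ≈ 0# → d ≈ 0#
      a≈0⇒ a≈0 = regular (*-≉0 (*-≉0 [1+n]×1≉0 (^-≉0 (2 ℕ.+ k) c≉0)) b≉0) d (begin
        ν * c ^ (2 ℕ.+ k) * b * d
          ≈⟨ solve 4 (λ ν C b d → ν :* C :* b :* d := ν :* (C :* d) :* b) refl ν (c ^ (2 ℕ.+ k)) b d ⟩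
        ν * (c ^ (2 ℕ.+ k) * d) * b
          ≈⟨ trans (+-congʳ (trans (*-congˡ a≈0) (zeroʳ _))) (+-identityˡ _) ⟨
        τ * (c ^ (1 ℕ.+ k) * (d * d)) * a + ν * (c ^ (2 ℕ.+ k) * d) * b
          ≈⟨ coefficient₂ ⟨
        τ * (a ^ (1 ℕ.+ k) * (b * b)) * c + ν * (a ^ (2 ℕ.+ k) * b) * d
          ≈⟨ +-cong (*-congʳ (*-congˡ (*-congʳ a^≈0))) (*-congʳ (*-congˡ (*-congʳ (trans (*-congʳ a≈0) (zeroˡ _))))) ⟩
        τ * (0# * (b * b)) * c + ν * (0# * b) * d
          ≈⟨ solve 5 (λ τ ν b c d → τ :* (con (+ 0) :* (b :* b)) :* c :+ ν :* (con (+ 0) :* b) :* d := con (+ 0)) refl τ ν b c d ⟩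
        0#  ∎)
        where
        a^≈0 : a ^ (1 ℕ.+ k) ≈ 0#
        a^≈0 = trans (*-congʳ a≈0) (zeroˡ _)
        det′ : b * c ≉ 0#
        det′ bc≈0 = det≉0 (trans (+-cong (trans (*-congʳ a≈0) (zeroˡ d)) (-‿cong bc≈0)) (-‿inverseʳ 0#))
        b≉0 : b ≉ 0#
        b≉0 b≈0 = det′ (trans (*-congʳ b≈0) (zeroˡ c))
        c≉0 : c ≉ 0#
        c≉0 c≈0 = det′ (trans (*-congˡ c≈0) (zeroʳ b))

      c≈0⇒ : c ≈ 0# → b ≈ 0#
      c≈0⇒ c≈0 = regular (*-≉0 (*-≉0 [1+n]×1≉0 (^-≉0 (2 ℕ.+ k) a≉0)) d≉0) b (begin
        ν * a ^ (2 ℕ.+ k) * d * b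
          ≈⟨ solve 4 (λ ν C d b → ν :* C :* d :* b := ν :* (C :* b) :* d) refl ν (a ^ (2 ℕ.+ k)) d b ⟩
        ν * (a ^ (2 ℕ.+ k) * b) * d
          ≈⟨ trans (+-congʳ (trans (*-congˡ c≈0) (zeroʳ _))) (+-identityˡ _) ⟨
        τ * (a ^ (1 ℕ.+ k) * (b * b)) * c + ν * (a ^ (2 ℕ.+ k) * b) * d
          ≈⟨ coefficient₂ ⟩
        τ * (c ^ (1 ℕ.+ k) * (d * d)) * a + ν * (c ^ (2 ℕ.+ k) * d) * b
          ≈⟨ +-cong (*-congʳ (*-congˡ (*-congʳ (trans (*-congʳ c≈0) (zeroˡ _))))) (*-congʳ (*-congˡ (*-congʳ (trans (*-congʳ c≈0) (zeroˡ _))))) ⟩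
        τ * (0# * (d * d)) * a + ν * (0# * d) * b
          ≈⟨ solve 5 (λ τ ν d a b → τ :* (con (+ 0) :* (d :* d)) :* a :+ ν :* (con (+ 0) :* d) :* b := con (+ 0)) refl τ ν d a b ⟩
        0#  ∎)
        where
        det′ : a * d ≉ 0#
        det′ ad≈0 = det≉0 (trans (+-cong ad≈0 (-‿cong (trans (*-congˡ c≈0) (zeroʳ b)))) (-‿inverseʳ 0#))
        a≉0 : a ≉ 0#
        a≉0 a≈0 = det′ (trans (*-congʳ a≈0) (zeroˡ d))
        d≉0 : d ≉ 0#
        d≉0 d≈0 = det′ (trans (*-congˡ d≈0) (zeroʳ a))

      -- `coefficient₀` gives aⁿ = cⁿ, after which the ν terms of `coefficient₂` cancel. What
      -- remains makes a nonzero multiple of (ad)² - (bc)² vanish, and its factor ad - bc is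
      -- nonzero.
      ac≉0⇒ : a ≉ 0# → c ≉ 0# → a * d + b * c ≈ 0#
      ac≉0⇒ a≉0 c≉0 = regular (*-≉0 (*-≉0 [1+n]C2×1≉0 (*-≉0 (^-≉0 (1 ℕ.+ k) a≉0) a≉0)) det≉0) (a * d + b * c) (begin
        τ * (P * a) * (a * d - b * c) * (a * d + b * c)
          ≈⟨ solve 6 (λ τ P a b c d → τ :* (P :* a) :* (a :* d :- b :* c) :* (a :* d :+ b :* c) :=
               a :* (τ :* (a :* P :* (d :* d)) :* a) :- c :* (τ :* (P :* (b :* b)) :* c) :* a) refl τ P a b c d ⟩
        a * (τ * (a * P * (d * d)) * a) - c * (τ * (P * (b * b)) * c) * a
          ≈⟨ +-cong (*-congˡ (*-congʳ (*-congˡ (*-congʳ e)))) (-‿cong refl) ⟩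
        a * (τ * (c * Q * (d * d)) * a) - c * (τ * (P * (b * b)) * c) * a
          ≈⟨ solve 7 (λ τ P Q a b c d →
               a :* (τ :* (c :* Q :* (d :* d)) :* a) :- c :* (τ :* (P :* (b :* b)) :* c) :* a :=
               a :* c :* (τ :* (Q :* (d :* d)) :* a :- τ :* (P :* (b :* b)) :* c)) refl τ P Q a b c d ⟩
        a * c * (τ * (Q * (d * d)) * a - τ * (P * (b * b)) * c)
          ≈⟨ trans (*-congˡ (≈⇒-≈0 (sym reduced))) (zeroʳ _) ⟩
        0#  ∎)
        where
        P = a ^ (1 ℕ.+ k)
        Q = c ^ (1 ℕ.+ k)

        e : a * P ≈ c * Q
        e = *-cancelˡ (a * P) (c * Q) (*-≉0 a≉0 c≉0) (trans
          (solve 3 (λ a c P → a :* c :* (a :* P) := a :* (a :* P) :* c) refl a c P)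
          (trans coefficient₀ (solve 3 (λ a c Q → c :* (c :* Q) :* a := a :* c :* (c :* Q)) refl a c Q)))

        reduced : τ * (P * (b * b)) * c ≈ τ * (Q * (d * d)) * a
        reduced = begin
          τ * (P * (b * b)) * c
            ≈⟨ solve 2 (λ x y → x := (x :+ y) :- y) refl _ (ν * (a * P * b) * d) ⟩
          (τ * (P * (b * b)) * c + ν * (a * P * b) * d) - ν * (a * P * b) * d
            ≈⟨ +-cong coefficient₂ (-‿cong (trans (*-congʳ (*-congˡ (*-congʳ e)))
                 (solve 4 (λ ν C b d → ν :* (C :* b) :* d := ν :* (C :* d) :* b) refl ν (c * Q) b d))) ⟩
          (τ * (Q * (d * d)) * a + ν * (c * Q * d) * b) - ν * (c * Q * d) * b
            ≈⟨ solve 2 (λ x y → x := (x :+ y) :- y) refl _ (ν * (c * Q * d) * b) ⟨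
          τ * (Q * (d * d)) * a  ∎

    trichotomy : Monomial a b c d ⊎ a * d + b * c ≈ 0#
    trichotomy with a ≟ 0# | c ≟ 0#
    ... | yes a≈0 | _       = inj₁ (inj₂ (a≈0 , a≈0⇒ a≈0))
    ... | no _    | yes c≈0 = inj₁ (inj₁ (c≈0⇒ c≈0 , c≈0))
    ... | no a≉0  | no c≉0  = inj₂ (ac≉0⇒ a≉0 c≉0)

  compose-preserving : ∀ {a b c d a′ b′ c′ d′} → Preserving a b c d → Preserving a′ b′ c′ d′ →
    Preserving (a * a′ + b * c′) (a * b′ + b * d′) (c * a′ + d * c′) (c * b′ + d * d′)
  compose-preserving {a} {b} {c} {d} {a′} {b′} {c′} {d′} M M′ u v sq =
    square-cong (*-cong (entry a b) (entry c d)) (M (a′ * u + b′ * v) (c′ * u + d′ * v) (M′ u v sq))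
    where
    entry : ∀ a b → a * (a′ * u + b′ * v) + b * (c′ * u + d′ * v) ≈ (a * a′ + b * c′) * u + (a * b′ + b * d′) * v
    entry a b = solve 8 (λ a b a′ b′ c′ d′ u v →
      a :* (a′ :* u :+ b′ :* v) :+ b :* (c′ :* u :+ d′ :* v) := (a :* a′ :+ b :* c′) :* u :+ (a :* b′ :+ b :* d′) :* v)
      refl a b a′ b′ c′ d′ u v

  scale-preserving : ∀ {a b c d} w → Preserving a b c d → Preserving (a * (w * w)) b (c * (w * w)) d
  scale-preserving {a} {b} {c} {d} w M u v (t , uv≈t²) = square-cong
    (*-cong (entry a b) (entry c d))
    (M (w * w * u) v (w * t , trans (solve 3 (λ w u v → w :* w :* u :* v := w :* w :* (u :* v)) refl w u v)
      (trans (*-congˡ uv≈t²) (solve 2 (λ w t → w :* w :* (t :* t) := w :* t :* (w :* t)) refl w t))))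
    where
    entry : ∀ a b → a * (w * w * u) + b * v ≈ a * (w * w) * u + b * v
    entry a b = +-congʳ (sym (*-assoc a (w * w) u))

  module Exceptional {a b c d} (10≤q : 10 ℕ.≤ q) (det≉0 : a * d - b * c ≉ 0#)
    (preserving : Preserving a b c d) (ad+bc≈0 : a * d + b * c ≈ 0#) where

    bc≈-ad : b * c ≈ - (a * d)
    bc≈-ad = trans (solve 2 (λ x y → y := (x :+ y) :+ :- x) refl (a * d) (b * c))
                   (trans (+-congʳ ad+bc≈0) (+-identityˡ _))

    ad≉0 : a * d ≉ 0#
    ad≉0 ad≈0 = det≉0 (trans (+-cong ad≈0 (-‿cong (trans bc≈-ad (-‿cong ad≈0))))
      (solve 0 (con (+ 0) :- :- con (+ 0) := con (+ 0)) refl))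

    a≉0 : a ≉ 0#
    a≉0 a≈0 = ad≉0 (trans (*-congʳ a≈0) (zeroˡ d))

    d≉0 : d ≉ 0#
    d≉0 d≈0 = ad≉0 (trans (*-congˡ d≈0) (zeroʳ a))

    b≉0 : b ≉ 0#
    b≉0 b≈0 = ad≉0 (trans (solve 1 (λ x → x := :- :- x) refl _)
      (trans (-‿cong (trans (sym bc≈-ad) (trans (*-congʳ b≈0) (zeroˡ c))))
             (solve 0 (:- con (+ 0) := con (+ 0)) refl)))

    -- M · diag(g , 1) · M again preserves squares for g = w².
    module _ {w} (w≉0 : w ≉ 0#) where
      private
        g = w * w
        g≉0 = *-≉0 w≉0 w≉0

        a′ = a * g * a + b * c
        b′ = a * g * b + b * d
        c′ = c * g * a + d * c
        d′ = c * g * b + d * d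

        det′≉0 : a′ * d′ - b′ * c′ ≉ 0#
        det′≉0 e = *-≉0 (*-≉0 det≉0 det≉0) g≉0 (trans
          (solve 5 (λ a b c d g → (a :* d :- b :* c) :* (a :* d :- b :* c) :* g :=
            (a :* g :* a :+ b :* c) :* (c :* g :* b :+ d :* d) :- (a :* g :* b :+ b :* d) :* (c :* g :* a :+ d :* c))
            refl a b c d g) e)

      -- The product is a⁴g⁴ - d⁴, and each alternative for the new matrix kills one factor: b′ =
      -- b(ag + d), a′ = a(ag - d) and a′d′ + b′c′ = -2ad(a²g² + d²), the last two by bc = -ad.
      factor : (a * g + d) * ((a * g - d) * (a * a * (g * g) + d * d)) ≈ 0#
      factor = cases (trichotomy det′≉0 (compose-preserving (scale-preserving w preserving) preserving))
        where
        cases : Monomial a′ b′ c′ d′ ⊎ a′ * d′ + b′ * c′ ≈ 0# → _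
        cases (inj₁ (inj₁ (b′≈0 , _))) = trans (*-congʳ (regular b≉0 (a * g + d) (trans
          (solve 4 (λ a b d g → b :* (a :* g :+ d) := a :* g :* b :+ b :* d) refl a b d g) b′≈0))) (zeroˡ _)
        cases (inj₁ (inj₂ (a′≈0 , _))) = trans (*-congˡ (trans (*-congʳ (regular a≉0 (a * g - d) (trans
          (solve 3 (λ a d g → a :* (a :* g :- d) := a :* g :* a :+ :- (a :* d)) refl a d g)
          (trans (+-congˡ (sym bc≈-ad)) a′≈0)))) (zeroˡ _))) (zeroʳ _)
        cases (inj₂ a′d′+b′c′≈0) = trans (*-congˡ (trans (*-congˡ
          (regular (*-≉0 2≉0 (*-≉0 a≉0 d≉0)) (a * a * (g * g) + d * d) (begin
            (1# + 1#) * (a * d) * (a * a * (g * g) + d * d)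
              ≈⟨ solve 3 (λ a d g → (con (+ 1) :+ con (+ 1)) :* (a :* d) :* (a :* a :* (g :* g) :+ d :* d) :=
                   :- ((a :* g :* a :+ :- (a :* d)) :* (g :* :- (a :* d) :+ d :* d)
                     :+ (a :* g :+ d) :* (a :* g :+ d) :* :- (a :* d))) refl a d g ⟩
            - ((a * g * a + - (a * d)) * (g * - (a * d) + d * d) + (a * g + d) * (a * g + d) * - (a * d))
              ≈⟨ -‿cong (+-cong (*-cong (+-congˡ bc≈-ad) (+-congʳ (*-congˡ bc≈-ad))) (*-congˡ bc≈-ad)) ⟨
            - ((a * g * a + b * c) * (g * (b * c) + d * d) + (a * g + d) * (a * g + d) * (b * c))
              ≈⟨ solve 5 (λ a b c d g →
                   :- ((a :* g :* a :+ b :* c) :* (g :* (b :* c) :+ d :* d) :+ (a :* g :+ d) :* (a :* g :+ d) :* (b :* c)) :=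
                   :- ((a :* g :* a :+ b :* c) :* (c :* g :* b :+ d :* d) :+ (a :* g :* b :+ b :* d) :* (c :* g :* a :+ d :* c)))
                   refl a b c d g ⟩
            - (a′ * d′ + b′ * c′)
              ≈⟨ trans (-‿cong a′d′+b′c′≈0) (solve 0 (:- con (+ 0) := con (+ 0)) refl) ⟩
            0#  ∎)))
          (zeroʳ _))) (zeroʳ _)

    private
      a⁴ = a * a * (a * a)
      d⁴ = d * d * (d * d)

      -- The polynomial w(a⁴w⁸ - d⁴), where the factor w makes 0 a root as well. Its ten
      -- coefficients are the reason for `10 ≤ q`.
      octic : Vec Carrier 10
      octic = 0# ∷ - d⁴ ∷ 0# ∷ 0# ∷ 0# ∷ 0# ∷ 0# ∷ 0# ∷ 0# ∷ a⁴ ∷ []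

      root : ∀ w → eval octic w ≈ 0#
      root w = trans
        (solve 3 (λ a d w → let o = con (+ 0) ; x = λ c p → c :+ w :* p in
            x o (x (:- (d :* d :* (d :* d))) (x o (x o (x o (x o (x o (x o (x o (x (a :* a :* (a :* a)) o))))))))) :=
            w :* ((a :* (w :* w) :+ d) :* ((a :* (w :* w) :- d) :* (a :* a :* (w :* w :* (w :* w)) :+ d :* d))))
          refl a d w)
        (vanish (w ≟ 0#))
        where
        vanish : _ → w * ((a * (w * w) + d) * ((a * (w * w) - d) * (a * a * (w * w * (w * w)) + d * d))) ≈ 0#
        vanish (yes w≈0) = trans (*-congʳ w≈0) (zeroˡ _)
        vanish (no w≉0)  = trans (*-congˡ (factor w≉0)) (zeroʳ w)

    impossible : ⊥
    impossible = -d⁴≉0 (second (all-roots⇒zero 10≤q octic root))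
      where
      second : ∀ {n u v} {as : Vec Carrier n} → All (_≈ 0#) (u ∷ v ∷ as) → v ≈ 0#
      second (_ ∷ v≈0 ∷ _) = v≈0

      -d⁴≉0 : - d⁴ ≉ 0#
      -d⁴≉0 e = *-≉0 (*-≉0 d≉0 d≉0) (*-≉0 d≉0 d≉0)
        (trans (solve 1 (λ x → x := :- :- x) refl d⁴) (trans (-‿cong e) (solve 0 (:- con (+ 0) := con (+ 0)) refl)))

  preserving⇒monomial : ∀ {a b c d} → 10 ℕ.≤ q → a * d - b * c ≉ 0# → Preserving a b c d → Monomial a b c d
  preserving⇒monomial 10≤q det≉0 preserving =
    [ id , (λ e → ⊥-elim (Exceptional.impossible 10≤q det≉0 preserving e)) ]′ (trichotomy det≉0 preserving)

  module _ {j} (j²≈-1 : j * j ≈ - 1#) (10≤q : 10 ℕ.≤ q) {a b c d} (det≉0 : a * d - b * c ≉ 0#)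
    (preserving : ∀ x y → Square (x * x + y * y) →
      Square ((x * a + y * c) * (x * a + y * c) + (x * b + y * d) * (x * b + y * d)))
    where

    private
      u₁ = a + j * b
      u₂ = c + j * d
      v₁ = a - j * b
      v₂ = c - j * d

      -jj : ∀ x → - (j * j * x) ≈ x
      -jj x = trans (-‿cong (*-congʳ j²≈-1)) (solve 1 (λ x → :- (:- con (+ 1) :* x) := x) refl x)

      det′≉0 : (u₁ - j * u₂) * (v₁ + j * v₂) - (u₁ + j * u₂) * (v₁ - j * v₂) ≉ 0#
      det′≉0 e = *-≉0 (*-≉0 2≉0 2≉0) det≉0 (trans (sym (-jj _)) (trans
        (solve 5 (λ a b c d j → let u₁ = a :+ j :* b ; u₂ = c :+ j :* d ; v₁ = a :- j :* b ; v₂ = c :- j :* d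
                                    2# = con (+ 1) :+ con (+ 1) in
          :- (j :* j :* (2# :* 2# :* (a :* d :- b :* c))) :=
          (u₁ :- j :* u₂) :* (v₁ :+ j :* v₂) :- (u₁ :+ j :* u₂) :* (v₁ :- j :* v₂)) refl a b c d j) e))

      -- With x = u + v and y = -j(u - v) one has x + jy = 2u and x - jy = 2v, hence x² + y² = 4uv.
      -- So the change of coordinates needs no division, and the factor 4 is a square.
      preserving′ : Preserving (u₁ - j * u₂) (u₁ + j * u₂) (v₁ - j * v₂) (v₁ + j * v₂)
      preserving′ u v (t , uv≈t²) = square-cong (begin
        X * X + Y * Y
          ≈⟨ +-congˡ (-jj (Y * Y)) ⟨
        X * X + - (j * j * (Y * Y))
          ≈⟨ solve 3 (λ X Y j → X :* X :+ :- (j :* j :* (Y :* Y)) := (X :+ j :* Y) :* (X :- j :* Y)) refl X Y j ⟩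
        (X + j * Y) * (X - j * Y)
          ≈⟨ *-cong
            (solve 7 (λ a b c d j u v → let x = u :+ v ; y = :- j :* (u :- v) in
              (x :* a :+ y :* c) :+ j :* (x :* b :+ y :* d) :=
              ((a :+ j :* b) :- j :* (c :+ j :* d)) :* u :+ ((a :+ j :* b) :+ j :* (c :+ j :* d)) :* v) refl a b c d j u v)
            (solve 7 (λ a b c d j u v → let x = u :+ v ; y = :- j :* (u :- v) in
              (x :* a :+ y :* c) :- j :* (x :* b :+ y :* d) :=
              ((a :- j :* b) :- j :* (c :- j :* d)) :* u :+ ((a :- j :* b) :+ j :* (c :- j :* d)) :* v) refl a b c d j u v) ⟩
        _  ∎)
        (preserving x y ((1# + 1#) * t , (begin
          x * x + y * y
            ≈⟨ solve 3 (λ u v j → (u :+ v) :* (u :+ v) :+ (:- j :* (u :- v)) :* (:- j :* (u :- v)) :=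
                 (u :+ v) :* (u :+ v) :- :- (j :* j :* ((u :- v) :* (u :- v)))) refl u v j ⟩
          (u + v) * (u + v) - - (j * j * ((u - v) * (u - v)))
            ≈⟨ +-congˡ (-‿cong (-jj _)) ⟩
          (u + v) * (u + v) - (u - v) * (u - v)
            ≈⟨ solve 2 (λ u v → let 2# = con (+ 1) :+ con (+ 1) in
                 (u :+ v) :* (u :+ v) :- (u :- v) :* (u :- v) := 2# :* 2# :* (u :* v)) refl u v ⟩
          (1# + 1#) * (1# + 1#) * (u * v)
            ≈⟨ *-congˡ uv≈t² ⟩
          (1# + 1#) * (1# + 1#) * (t * t)
            ≈⟨ solve 2 (λ w t → w :* w :* (t :* t) := w :* t :* (w :* t)) refl (1# + 1#) t ⟩
          (1# + 1#) * t * ((1# + 1#) * t)  ∎)))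
        where
        x = u + v
        y = - j * (u - v)
        X = x * a + y * c
        Y = x * b + y * d

      norm : ∀ x y → (x + j * y) * (x - j * y) ≈ x * x + y * y
      norm x y = trans (solve 3 (λ x y j → (x :+ j :* y) :* (x :- j :* y) := x :* x :+ :- (j :* j :* (y :* y))) refl x y j)
                       (+-congˡ (-jj (y * y)))

      polar : u₁ * v₂ + u₂ * v₁ ≈ (1# + 1#) * (a * c + b * d)
      polar = trans
        (solve 5 (λ a b c d j → (a :+ j :* b) :* (c :- j :* d) :+ (c :+ j :* d) :* (a :- j :* b) :=
          (con (+ 1) :+ con (+ 1)) :* (a :* c) :+ :- (j :* j :* ((con (+ 1) :+ con (+ 1)) :* (b :* d)))) refl a b c d j)
        (trans (+-congˡ (-jj _)) (sym (distribˡ (1# + 1#) (a * c) (b * d))))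

      -- The norm is the product of the split coordinates. As κ² = -1, passing from (u₂, v₂) to
      -- (κu₂, -κv₂) keeps this product and makes the two terms of `polar` cancel. A diagonal matrix
      -- gives κ = -j, an antidiagonal one κ = j.
      conclude : ∀ κ → - (κ * κ) ≈ 1# → u₁ ≈ κ * u₂ → v₁ ≈ - κ * v₂ →
                 a * a + b * b ≈ c * c + d * d × a * c + b * d ≈ 0#
      conclude κ κ²≈-1 u₁≈ v₁≈ =
        trans (sym (norm a b)) (trans (*-cong u₁≈ v₁≈) (trans
          (solve 3 (λ κ u v → κ :* u :* (:- κ :* v) := :- (κ :* κ) :* (u :* v)) refl κ u₂ v₂)
          (trans (*-congʳ κ²≈-1) (trans (*-identityˡ _) (norm c d))))) ,
        regular 2≉0 _ (trans (sym polar) (trans (+-cong (*-congʳ u₁≈) (*-congˡ v₁≈))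
          (solve 3 (λ κ u v → κ :* u :* v :+ u :* (:- κ :* v) := con (+ 0)) refl κ u₂ v₂)))

      cases : Monomial (u₁ - j * u₂) (u₁ + j * u₂) (v₁ - j * v₂) (v₁ + j * v₂) →
              a * a + b * b ≈ c * c + d * d × a * c + b * d ≈ 0#
      cases (inj₁ (B≈0 , C≈0)) = conclude (- j)
        (trans (solve 1 (λ j → :- (:- j :* :- j) := :- (j :* j :* con (+ 1))) refl j) (-jj 1#))
        (-≈0⇒≈ (trans (solve 3 (λ j u v → u :- :- j :* v := u :+ j :* v) refl j u₁ u₂) B≈0))
        (-≈0⇒≈ (trans (solve 3 (λ j u v → u :- :- (:- j) :* v := u :- j :* v) refl j v₁ v₂) C≈0))
      cases (inj₂ (A≈0 , D≈0)) = conclude j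
        (trans (solve 1 (λ j → :- (j :* j) := :- (j :* j :* con (+ 1))) refl j) (-jj 1#))
        (-≈0⇒≈ A≈0)
        (-≈0⇒≈ (trans (solve 3 (λ j u v → u :- :- j :* v := u :+ j :* v) refl j v₁ v₂) D≈0))

    -- Equal norms and orthogonality of the images of 1 and i: the form in which all cases state
    -- that the linear part is a similarity.
    split-similarity : a * a + b * b ≈ c * c + d * d × a * c + b * d ≈ 0#
    split-similarity = cases (preserving⇒monomial 10≤q det′≉0 preserving′)

-- Equal powers of two linear polynomials at squares of roots of unity.

module LinearPowers (R : CommutativeRing c ℓ) where
  open CommutativeRing R renaming (zero to *-zero)
  open IntegerSolver R
  open Exp commutativeSemiring
  open Mult semiring using () renaming (_×_ to _×ₙ_)
  open Polynomials R
  open Frobenius R using (linear^-expansion)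
  open SetoidReasoning setoid

  module _ {N k : ℕ} (bound : suc ((2 ℕ.+ k) ℕ.+ (2 ℕ.+ k)) ℕ.≤ N) (t : Fin N → Carrier)
           (t-regular : ∀ i j → i ≢ j → Regular (t i - t j))
           (t^2m≈1 : ∀ i → (t i * t i) ^ (3 ℕ.+ k) ≈ 1#)
           {a b c d : Carrier} (equal : ∀ i → (a + b * (t i * t i)) ^ (3 ℕ.+ k) ≈ (c + d * (t i * t i)) ^ (3 ℕ.+ k))
           (m-regular : Regular ((3 ℕ.+ k) ×ₙ 1#)) (mC2-regular : Regular (((3 ℕ.+ k) C 2) ×ₙ 1#)) where

    private
      m = 3 ℕ.+ k
      ν = m ×ₙ 1#
      τ = (m C 2) ×ₙ 1#
      P = a ^ (1 ℕ.+ k)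
      Q = c ^ (1 ℕ.+ k)

      E₁ = linear^-expansion a b k
      E₂ = linear^-expansion c d k

      p₀ = a ^ m
      p₁ = ν * (a * P * b)
      p₂ = τ * (P * (b * b))
      q₀ = c ^ m
      q₁ = ν * (c * Q * d)
      q₂ = τ * (Q * (d * d))
      h = b ^ m - d ^ m

      poly : IsPoly k (λ x → proj₁ E₁ x + - 1# * proj₁ E₂ x)
      poly = poly-+ (proj₁ (proj₂ E₁)) (poly-scale (- 1#) (proj₁ (proj₂ E₂)))

      -- At the nodes Xᵐ = 1, so the top terms join the constant term as `h`; the entries for X and
      -- X² stay clean.
      coefficients : Vec Carrier m
      coefficients = (p₀ - q₀ + h) ∷ (p₁ - q₁) ∷ (p₂ - q₂) ∷ proj₁ poly

      expand : ∀ x p₀ p₁ p₂ u B q₀ q₁ q₂ v D →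
        (p₀ - q₀ + (B - D)) + x * ((p₁ - q₁) + x * ((p₂ - q₂) + x * (u + - 1# * v))) ≈
        (p₀ + p₁ * x + p₂ * (x * x) + x * (x * (x * u)) + B * 1#)
        - (q₀ + q₁ * x + q₂ * (x * x) + x * (x * (x * v)) + D * 1#)
      expand = solve 11 (λ x p₀ p₁ p₂ u B q₀ q₁ q₂ v D →
        (p₀ :- q₀ :+ (B :- D)) :+ x :* ((p₁ :- q₁) :+ x :* ((p₂ :- q₂) :+ x :* (u :+ :- con (+ 1) :* v))) :=
        (p₀ :+ p₁ :* x :+ p₂ :* (x :* x) :+ x :* (x :* (x :* u)) :+ B :* con (+ 1))
        :- (q₀ :+ q₁ :* x :+ q₂ :* (x :* x) :+ x :* (x :* (x :* v)) :+ D :* con (+ 1))) refl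

      root : ∀ i → eval coefficients (t i * t i) ≈ 0#
      root i = begin
        (p₀ - q₀ + h) + x * ((p₁ - q₁) + x * ((p₂ - q₂) + x * eval (proj₁ poly) x))
          ≈⟨ +-congˡ (*-congˡ (+-congˡ (*-congˡ (+-congˡ (*-congˡ (proj₂ poly x)))))) ⟨
        (p₀ - q₀ + h) + x * ((p₁ - q₁) + x * ((p₂ - q₂) + x * (u + - 1# * v)))
          ≈⟨ expand x p₀ p₁ p₂ u (b ^ m) q₀ q₁ q₂ v (d ^ m) ⟩
        (p₀ + p₁ * x + p₂ * (x * x) + x * (x * (x * u)) + b ^ m * 1#)
          - (q₀ + q₁ * x + q₂ * (x * x) + x * (x * (x * v)) + d ^ m * 1#)
          ≈⟨ +-cong (+-congˡ (*-congˡ (t^2m≈1 i))) (-‿cong (+-congˡ (*-congˡ (t^2m≈1 i)))) ⟨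
        (p₀ + p₁ * x + p₂ * (x * x) + x * (x * (x * u)) + b ^ m * x ^ m)
          - (q₀ + q₁ * x + q₂ * (x * x) + x * (x * (x * v)) + d ^ m * x ^ m)
          ≈⟨ +-cong (proj₂ (proj₂ E₁) x) (-‿cong (proj₂ (proj₂ E₂) x)) ⟨
        (a + b * x) ^ m - (c + d * x) ^ m
          ≈⟨ ≈⇒-≈0 (equal i) ⟩
        0#  ∎
        where
        x = t i * t i
        u = proj₁ E₁ x
        v = proj₁ E₂ x

      second-third : ∀ {u v w} {as : Vec Carrier k} → All (_≈ 0#) (u ∷ v ∷ w ∷ as) → v ≈ 0# × w ≈ 0#
      second-third (_ ∷ v≈0 ∷ w≈0 ∷ _) = v≈0 , w≈0

      zeros : p₁ - q₁ ≈ 0# × p₂ - q₂ ≈ 0#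
      zeros = second-third (square-roots⇒zero bound coefficients t t-regular root)

      cancel : ∀ {ν} x y → Regular ν → ν * x - ν * y ≈ 0# → x ≈ y
      cancel {ν} x y ν-regular e = -≈0⇒≈ (ν-regular (x - y) (trans
        (solve 3 (λ ν x y → ν :* (x :- y) := ν :* x :- ν :* y) refl ν x y) e))

    -- After cancelling binomial coefficients, X and X² give aPb = cQd and Pb² = Qd². Then cPb² =
    -- cQd² = aPbd.
    equal-powers : a ^ (1 ℕ.+ k) * b * (c * b - a * d) ≈ 0#
    equal-powers = begin
      P * b * (c * b - a * d)
        ≈⟨ solve 5 (λ P a b c d → P :* b :* (c :* b :- a :* d) := c :* (P :* (b :* b)) :- a :* P :* b :* d) refl P a b c d ⟩
      c * (P * (b * b)) - a * P * b * d
        ≈⟨ +-cong (*-congˡ (cancel _ _ mC2-regular (proj₂ zeros)))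
                  (-‿cong (*-congʳ (cancel _ _ m-regular (proj₁ zeros)))) ⟩
      c * (Q * (d * d)) - c * Q * d * d
        ≈⟨ solve 3 (λ Q c d → c :* (Q :* (d :* d)) :- c :* Q :* d :* d := con (+ 0)) refl Q c d ⟩
      0#  ∎

-- Norm and conjugation in R[x]/(x² + 1).

module Conjugation (R : CommutativeRing c ℓ) where
  open CommutativeRing R renaming (zero to *-zero)
  open Adjoin-i R public
  open IntegerSolver R
  open Exp commutativeSemiring
  open Mult semiring using () renaming (_×_ to _×ₙ_)

  module R′ = CommutativeRing ring′
  open Exp R′.commutativeSemiring public using ()
    renaming (_^_ to _^′_; ^-congˡ to ^′-congˡ; ^-homo-* to ^′-homo-*; ^-assocʳ to ^′-assocʳ; ^-distrib-* to ^′-distrib-*)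
  open Mult R′.semiring public using () renaming (_×_ to _×′_)

  norm : Carrier′ → Carrier
  norm (a , b) = a * a + b * b

  norm-cong : ∀ {z w} → z ≈′ w → norm z ≈ norm w
  norm-cong (e , f) = +-cong (*-cong e e) (*-cong f f)

  norm-*′ : ∀ z w → norm (z *′ w) ≈ norm z * norm w
  norm-*′ (a , b) (c , d) = solve 4 (λ a b c d →
    (a :* c :- b :* d) :* (a :* c :- b :* d) :+ (a :* d :+ b :* c) :* (a :* d :+ b :* c) :=
    (a :* a :+ b :* b) :* (c :* c :+ d :* d)) refl a b c d

  conj-cong : ∀ {z w} → z ≈′ w → conj z ≈′ conj w
  conj-cong (e , f) = e , -‿cong f

  conj-*′ : ∀ z w → conj (z *′ w) ≈′ conj z *′ conj w
  conj-*′ (a , b) (c , d) =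
      solve 4 (λ a b c d → a :* c :- b :* d := a :* c :- (:- b) :* (:- d)) refl a b c d
    , solve 4 (λ a b c d → :- (a :* d :+ b :* c) := a :* (:- d) :+ (:- b) :* c) refl a b c d

  conj-+′ : ∀ z w → conj (z +′ w) ≈′ conj z +′ conj w
  conj-+′ (a , b) (c , d) = refl , solve 2 (λ b d → :- (b :+ d) := :- b :+ :- d) refl b d

  conj-conj : ∀ z → conj (conj z) ≈′ z
  conj-conj (a , b) = refl , solve 1 (λ b → :- (:- b) := b) refl b

  conj-^′ : ∀ z k → conj (z ^′ k) ≈′ conj z ^′ k
  conj-^′ z zero    = refl , solve 0 (:- con (+ 0) := con (+ 0)) refl
  conj-^′ z (suc k) = R′.trans (conj-*′ z (z ^′ k)) (R′.*-congˡ {conj z} (conj-^′ z k))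

  *′-conj : ∀ z → z *′ conj z ≈′ ι (norm z)
  *′-conj (a , b) =
      solve 2 (λ a b → a :* a :- b :* (:- b) := a :* a :+ b :* b) refl a b
    , solve 2 (λ a b → a :* (:- b) :+ b :* a := con (+ 0)) refl a b

  ι-cong : ∀ {a b} → a ≈ b → ι a ≈′ ι b
  ι-cong e = e , refl

  ι-*′ : ∀ a z → ι a *′ z ≈′ (a * proj₁ z , a * proj₂ z)
  ι-*′ a (x , y) =
      solve 3 (λ a x y → a :* x :- con (+ 0) :* y := a :* x) refl a x y
    , solve 3 (λ a x y → a :* y :+ con (+ 0) :* x := a :* y) refl a x y

  ι-* : ∀ a b → ι a *′ ι b ≈′ ι (a * b)
  ι-* a b = R′.trans (ι-*′ a (ι b)) (refl , zeroʳ a)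

  ι-^ : ∀ a k → ι a ^′ k ≈′ ι (a ^ k)
  ι-^ a zero    = R′.refl
  ι-^ a (suc k) = R′.trans (R′.*-congˡ {ι a} (ι-^ a k)) (ι-* a (a ^ k))

  ι-× : ∀ k → k ×′ 1′ ≈′ ι (k ×ₙ 1#)
  ι-× zero    = R′.refl
  ι-× (suc k) = R′.trans (R′.+-congˡ {1′} (ι-× k)) (refl , +-identityˡ 0#)

-- The field with q² elements when -1 is not a square.

module Nonsplit (F : FiniteField c ℓ q) {p r n h : ℕ} (pr : Prime p)
                (q≡p^r : q ≡ p ℕ.^ suc r) (q-odd : q ≡ suc (n ℕ.+ n)) (n-odd : n ≡ suc (h ℕ.+ h)) where
  open Squares F {r = r} {n = n} pr q≡p^r q-odd public
  open Conjugation commutativeRing public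
  module P′ = Polynomials ring′

  private
    Q = p ℕ.^ suc r

    module ≈-Reasoning = SetoidReasoning setoid
    module ≈′-Reasoning = SetoidReasoning R′.setoid

  -- If y ≠ 0, then x/y would be a square root of -1; and y = 0 leaves x² = 0.
  norm≈0⇒ : ∀ z → norm z ≈ 0# → z ≈′ R′.0#
  norm≈0⇒ (x , y) x²+y²≈0 = x≈0 , y≈0
    where
    y≈0 : y ≈ 0#
    y≈0 with y ≟ 0#
    ... | yes e = e
    ... | no y≉0 = ⊥-elim (-1-nonsquare h n-odd (x * z) (begin
      x * z * (x * z)
        ≈⟨ solve 3 (λ x y z → x :* z :* (x :* z) := (x :* x :+ y :* y) :* (z :* z) :- z :* y :* (z :* y)) refl x y z ⟩
      (x * x + y * y) * (z * z) - z * y * (z * y)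
        ≈⟨ +-cong (trans (*-congʳ x²+y²≈0) (zeroˡ _)) (-‿cong (*-cong zy≈1 zy≈1)) ⟩
      0# - 1# * 1#
        ≈⟨ solve 0 (con (+ 0) :- con (+ 1) :* con (+ 1) := :- con (+ 1)) refl ⟩
      - 1#  ∎))
      where
      open ≈-Reasoning
      z = proj₁ (inv y y≉0)
      zy≈1 = proj₂ (inv y y≉0)

    x≈0 : x ≈ 0#
    x≈0 = ^-≈0 2 (begin
      x * (x * 1#)          ≈⟨ solve 2 (λ x y → x :* (x :* con (+ 1)) := (x :* x :+ y :* y) :- y :* y) refl x y ⟩
      x * x + y * y - y * y ≈⟨ +-cong x²+y²≈0 (-‿cong (trans (*-congʳ y≈0) (zeroˡ y))) ⟩
      0# - 0#               ≈⟨ -‿inverseʳ 0# ⟩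
      0#                    ∎)
      where open ≈-Reasoning

  -- Multiplying zw = 0 by z̄ leaves the norm of z times w, and the norm vanishes only at 0.
  regular′ : ∀ {z} → ¬ (z ≈′ R′.0#) → P′.Regular z
  regular′ {z} z≉0 w zw≈0 = regular norm≉0 _ (proj₁ scaled) , regular norm≉0 _ (proj₂ scaled)
    where
    norm≉0 : norm z ≉ 0#
    norm≉0 e = z≉0 (norm≈0⇒ z e)

    scaled : (norm z * proj₁ w , norm z * proj₂ w) ≈′ R′.0#
    scaled = begin
      (norm z * proj₁ w , norm z * proj₂ w)  ≈⟨ ι-*′ (norm z) w ⟨
      ι (norm z) *′ w                        ≈⟨ R′.*-congʳ {w} (*′-conj z) ⟨
      z *′ conj z *′ w                       ≈⟨ R′.*-congʳ {w} (R′.*-comm z (conj z)) ⟩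
      conj z *′ z *′ w                       ≈⟨ R′.*-assoc (conj z) z w ⟩
      conj z *′ (z *′ w)                     ≈⟨ R′.*-congˡ {conj z} zw≈0 ⟩
      conj z *′ R′.0#                        ≈⟨ R′.zeroʳ (conj z) ⟩
      R′.0#                                  ∎
      where open ≈′-Reasoning

  i′ : Carrier′
  i′ = 0# , 1#

  i′²≈-1 : i′ *′ i′ ≈′ ι (- 1#)
  i′²≈-1 = solve 0 (con (+ 0) :* con (+ 0) :- con (+ 1) :* con (+ 1) := :- con (+ 1)) refl
         , solve 0 (con (+ 0) :* con (+ 1) :+ con (+ 1) :* con (+ 0) := con (+ 0)) refl

  i′^q : i′ ^′ q ≈′ conj i′
  i′^q = begin
    i′ ^′ q                       ≡⟨ ≡.cong (i′ ^′_) q-odd ⟩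
    i′ *′ i′ ^′ (n ℕ.+ n)         ≈⟨ R′.*-congˡ {i′} (^′-homo-* i′ n n) ⟩
    i′ *′ (i′ ^′ n *′ i′ ^′ n)    ≈⟨ R′.*-congˡ {i′} (^′-distrib-* i′ i′ n) ⟨
    i′ *′ (i′ *′ i′) ^′ n         ≈⟨ R′.*-congˡ {i′} (^′-congˡ n i′²≈-1) ⟩
    i′ *′ ι (- 1#) ^′ n           ≈⟨ R′.*-congˡ {i′} (ι-^ (- 1#) n) ⟩
    i′ *′ ι ((- 1#) ^ n)          ≈⟨ R′.*-congˡ {i′} (ι-cong -1^n) ⟩
    i′ *′ ι (- 1#)                ≈⟨ R′.*-comm i′ (ι (- 1#)) ⟩
    ι (- 1#) *′ i′                ≈⟨ ι-*′ (- 1#) i′ ⟩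
    (- 1# * 0# , - 1# * 1#)       ≈⟨ zeroʳ _ , *-identityʳ _ ⟩
    conj i′                       ∎
    where
    open ≈′-Reasoning
    -1^n : (- 1#) ^ n ≈ - 1#
    -1^n = trans (^-congʳ (- 1#) n-odd) (trans (*-congˡ ([-1]^2k h)) (*-identityʳ _))

  -- Since q is a power of p, the power map is additive. It fixes 𝔽_q by Fermat and sends i to
  -- i(-1)ⁿ = -i, as n is odd.
  ^q-conj : ∀ z → z ^′ q ≈′ conj z
  ^q-conj z@(x , y) = begin
    z ^′ q                               ≡⟨ ≡.cong (z ^′_) q≡p^r ⟩
    z ^′ Q                               ≈⟨ ^′-congˡ Q decompose ⟩
    (ι x +′ i′ *′ ι y) ^′ Q              ≈⟨ Frobenius.frobenius^-+ ring′ pr p×1′≈0 (suc r) (ι x) (i′ *′ ι y) ⟩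
    ι x ^′ Q +′ (i′ *′ ι y) ^′ Q         ≈⟨ R′.+-congˡ {ι x ^′ Q} (^′-distrib-* i′ (ι y) Q) ⟩
    ι x ^′ Q +′ i′ ^′ Q *′ ι y ^′ Q      ≡⟨ ≡.cong (λ k → ι x ^′ k +′ i′ ^′ k *′ ι y ^′ k) q≡p^r ⟨
    ι x ^′ q +′ i′ ^′ q *′ ι y ^′ q      ≈⟨ R′.+-cong (ι^q x) (R′.*-cong i′^q (ι^q y)) ⟩
    ι x +′ conj i′ *′ ι y                ≈⟨ recompose ⟩
    conj z                               ∎
    where
    open ≈′-Reasoning
    ι^q : ∀ x → ι x ^′ q ≈′ ι x
    ι^q x = R′.trans (ι-^ x q) (ι-cong (fermat x))

    p×1′≈0 : p ×′ 1′ ≈′ R′.0#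
    p×1′≈0 = R′.trans (ι-× p) (ι-cong p×1≈0)

    decompose : z ≈′ ι x +′ i′ *′ ι y
    decompose = solve 2 (λ x y → x := x :+ (con (+ 0) :* y :- con (+ 1) :* con (+ 0))) refl x y
              , solve 1 (λ y → y := con (+ 0) :+ (con (+ 0) :* con (+ 0) :+ con (+ 1) :* y)) refl y

    recompose : ι x +′ conj i′ *′ ι y ≈′ conj z
    recompose = solve 2 (λ x y → x :+ (con (+ 0) :* y :- :- con (+ 1) :* con (+ 0)) := x) refl x y
              , solve 1 (λ y → con (+ 0) :+ (con (+ 0) :* con (+ 0) :+ :- con (+ 1) :* y) := :- y) refl y

-- Similarities when -1 is not a square.

module NonsplitSimilarity (F : FiniteField c ℓ q) {p r k h : ℕ} (pr : Prime p)
  (q≡p^r : q ≡ p ℕ.^ suc r) (q-odd : q ≡ suc ((2 ℕ.+ k) ℕ.+ (2 ℕ.+ k)))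
  (n-odd : 2 ℕ.+ k ≡ suc (h ℕ.+ h)) where
  private
    n = 2 ℕ.+ k

  open Nonsplit F {r = r} {n = n} {h = h} pr q≡p^r q-odd n-odd

  private
    m : ℕ
    m = suc n
    module ≈-Reasoning = SetoidReasoning setoid
    module ≈′-Reasoning = SetoidReasoning R′.setoid

    cancel′ : ∀ {z w w′} → ¬ (z ≈′ R′.0#) → z *′ w ≈′ z *′ w′ → w ≈′ w′
    cancel′ {z} {w} {w′} z≉0 e = -≈0⇒≈ (proj₁ d) , -≈0⇒≈ (proj₂ d)
      where
      open IntegerSolver ring′ using () renaming (solve to solve′; _:=_ to _:=′_; _:*_ to _:*′_; _:-_ to _:-′_)
      d : w R′.- w′ ≈′ R′.0#
      d = regular′ z≉0 (w R′.- w′) (R′.trans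
        (solve′ 3 (λ z w w′ → z :*′ (w :-′ w′) :=′ z :*′ w :-′ z :*′ w′) R′.refl z w w′)
        (R′.trans (R′.+-congʳ {R′.- (z *′ w′)} e) (R′.-‿inverseʳ (z *′ w′))))

  -- As s varies, Z = 1 + s i runs through all directions but one.
  module Direction (s : Carrier) where
    Z Y : Carrier′
    Z = 1# , s
    Y = Z *′ Z

    Z≉0 : ¬ (Z ≈′ R′.0#)
    Z≉0 (1≈0 , _) = 1≉0 1≈0

    norm-Z≉0 : norm Z ≉ 0#
    norm-Z≉0 e = Z≉0 (norm≈0⇒ Z e)

    ρ : Carrier
    ρ = proj₁ (inv (norm Z) norm-Z≉0)

    -- This is Z̄/Z, with the inversion done through the norm. It has norm 1, and its square is X =
    -- Ȳ/Y; so it serves as the node for counting roots in t² = X.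
    t : Carrier′
    t = ι ρ *′ (conj Z *′ conj Z)

    t*Z : t *′ Z ≈′ conj Z
    t*Z = begin
      ι ρ *′ (conj Z *′ conj Z) *′ Z      ≈⟨ R′.*-assoc (ι ρ) (conj Z *′ conj Z) Z ⟩
      ι ρ *′ (conj Z *′ conj Z *′ Z)      ≈⟨ R′.*-congˡ {ι ρ} (R′.*-assoc (conj Z) (conj Z) Z) ⟩
      ι ρ *′ (conj Z *′ (conj Z *′ Z))    ≈⟨ R′.*-congˡ {ι ρ} (R′.*-congˡ {conj Z} (R′.trans (R′.*-comm (conj Z) Z) (*′-conj Z))) ⟩
      ι ρ *′ (conj Z *′ ι (norm Z))       ≈⟨ R′.*-congˡ {ι ρ} (R′.*-comm (conj Z) (ι (norm Z))) ⟩
      ι ρ *′ (ι (norm Z) *′ conj Z)       ≈⟨ R′.*-assoc (ι ρ) (ι (norm Z)) (conj Z) ⟨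
      ι ρ *′ ι (norm Z) *′ conj Z         ≈⟨ R′.*-congʳ {conj Z} (R′.trans (ι-* ρ (norm Z)) (ι-cong (proj₂ (inv (norm Z) norm-Z≉0)))) ⟩
      1′ *′ conj Z                        ≈⟨ R′.*-identityˡ (conj Z) ⟩
      conj Z                              ∎
      where open ≈′-Reasoning

    t*conj-t : t *′ conj t ≈′ 1′
    t*conj-t = cancel′ Z≉0 (begin
      Z *′ (t *′ conj t)      ≈⟨ R′.*-assoc Z t (conj t) ⟨
      Z *′ t *′ conj t        ≈⟨ R′.*-congʳ {conj t} (R′.trans (R′.*-comm Z t) t*Z) ⟩
      conj Z *′ conj t        ≈⟨ conj-*′ Z t ⟨
      conj (Z *′ t)           ≈⟨ conj-cong (R′.trans (R′.*-comm Z t) t*Z) ⟩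
      conj (conj Z)           ≈⟨ conj-conj Z ⟩
      Z                       ≈⟨ R′.*-identityʳ Z ⟨
      Z *′ 1′                 ∎)
      where open ≈′-Reasoning

    -- Since 2m = q + 1, the left side is z times its q-th power.
    z^2m : ∀ z → z ^′ m *′ z ^′ m ≈′ z *′ conj z
    z^2m z = begin
      z ^′ m *′ z ^′ m        ≈⟨ ^′-homo-* z m m ⟨
      z ^′ (m ℕ.+ m)          ≡⟨ ≡.cong (z ^′_) (≡.cong suc (≡.trans (ℕ.+-suc n n) (≡.sym q-odd))) ⟩
      z *′ z ^′ q             ≈⟨ R′.*-congˡ {z} (^q-conj z) ⟩
      z *′ conj z             ∎
      where open ≈′-Reasoning

    t²^m : (t *′ t) ^′ m ≈′ 1′
    t²^m = R′.trans (^′-distrib-* t t m) (R′.trans (z^2m t) t*conj-t)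

    conj-Y : conj Y ≈′ t *′ t *′ Y
    conj-Y = begin
      conj (Z *′ Z)           ≈⟨ conj-*′ Z Z ⟩
      conj Z *′ conj Z        ≈⟨ R′.*-cong t*Z t*Z ⟨
      t *′ Z *′ (t *′ Z)      ≈⟨ interchange t Z ⟩
      t *′ t *′ (Z *′ Z)      ∎
      where
      open ≈′-Reasoning
      open IntegerSolver ring′ using () renaming (solve to solve′; _:=_ to _:=′_; _:*_ to _:*′_)
      interchange : ∀ t Z → t *′ Z *′ (t *′ Z) ≈′ t *′ t *′ (Z *′ Z)
      interchange = solve′ 2 (λ t Z → t :*′ Z :*′ (t :*′ Z) :=′ t :*′ t :*′ (Z :*′ Z)) R′.refl

    Y^m≉0 : ¬ (Y ^′ m ≈′ R′.0#)
    Y^m≉0 Y^m≈0 = ^-≉0 m (λ e → norm-Z≉0 (^-≈0 2 (trans (*-congˡ (*-identityʳ _)) (trans (sym (norm-*′ Z Z)) e))))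
      (trans (sym (norm-^ Y m)) (trans (norm-cong Y^m≈0) (trans (+-cong (zeroˡ 0#) (zeroˡ 0#)) (+-identityˡ 0#))))
      where
      norm-^ : ∀ z j → norm (z ^′ j) ≈ norm z ^ j
      norm-^ z zero    = trans (+-cong (*-identityˡ 1#) (zeroˡ 0#)) (+-identityʳ 1#)
      norm-^ z (suc j) = trans (norm-*′ z (z ^′ j)) (*-congˡ (norm-^ z j))

  t : Carrier → Carrier′
  t s = Direction.t s

  -- Clearing denominators in Z̄/Z = Z̄′/Z′ and comparing the i-components leaves 2(s - s′) = 0. So
  -- the q values of s give q nodes.
  t-injective : ∀ {s s′} → t s R′.- t s′ ≈′ R′.0# → s ≈ s′
  t-injective {s} {s′} (e₁ , e₂) = -≈0⇒≈ (regular 2≉0 (s - s′) (trans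
    (solve 2 (λ s s′ → (con (+ 1) :+ con (+ 1)) :* (s :- s′) :=
      (con (+ 1) :* s :+ :- s′ :* con (+ 1)) :- (con (+ 1) :* s′ :+ :- s :* con (+ 1))) refl s s′)
    (≈⇒-≈0 (proj₂ cross))))
    where
    open ≈′-Reasoning
    module D = Direction s
    module D′ = Direction s′

    t≈t′ : t s ≈′ t s′
    t≈t′ = -≈0⇒≈ e₁ , -≈0⇒≈ e₂

    cross : conj D′.Z *′ D.Z ≈′ conj D.Z *′ D′.Z
    cross = begin
      conj D′.Z *′ D.Z           ≈⟨ R′.*-congʳ {D.Z} D′.t*Z ⟨
      t s′ *′ D′.Z *′ D.Z        ≈⟨ R′.*-assoc (t s′) D′.Z D.Z ⟩
      t s′ *′ (D′.Z *′ D.Z)      ≈⟨ R′.*-cong (R′.sym t≈t′) (R′.*-comm D′.Z D.Z) ⟩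
      t s *′ (D.Z *′ D′.Z)       ≈⟨ R′.*-assoc (t s) D.Z D′.Z ⟨
      t s *′ D.Z *′ D′.Z         ≈⟨ R′.*-congʳ {D′.Z} D.t*Z ⟩
      conj D.Z *′ D′.Z           ∎

  -- (wᵐ)² = w w̄ = r² forces wᵐ = ± r, so conjugation fixes wᵐ.
  square-norm : ∀ w → Square (norm w) → w ^′ m ≈′ conj w ^′ m
  square-norm w (r , norm≈r²) = R′.trans (R′.sym fixed) (conj-^′ w m)
    where
    u = w ^′ m

    u²≈r² : u *′ u ≈′ ι r *′ ι r
    u²≈r² = R′.trans (Direction.z^2m 0# w) (R′.trans (*′-conj w) (R′.trans (ι-cong norm≈r²) (R′.sym (ι-* r r))))

    product : (u R′.- ι r) *′ (u +′ ι r) ≈′ R′.0#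
    product = R′.trans (difference-of-squares u (ι r))
      (R′.trans (R′.+-congʳ {R′.- (ι r *′ ι r)} u²≈r²) (R′.-‿inverseʳ (ι r *′ ι r)))
      where
      open IntegerSolver ring′ using ()
        renaming (solve to solve′; _:=_ to _:=′_; _:*_ to _:*′_; _:+_ to _:+′_; _:-_ to _:-′_)
      difference-of-squares : ∀ u v → (u R′.- v) *′ (u +′ v) ≈′ u *′ u R′.- v *′ v
      difference-of-squares = solve′ 2 (λ u v → (u :-′ v) :*′ (u :+′ v) :=′ u :*′ u :-′ v :*′ v) R′.refl

    real : proj₂ u ≈ 0# → conj u ≈′ u
    real e = refl , trans (-‿cong e) (trans (solve 0 (:- con (+ 0) := con (+ 0)) refl) (sym e))

    fixed : conj u ≈′ u
    fixed with norm (u R′.- ι r) ≟ 0#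
    ... | yes e = real (trans (solve 1 (λ y → y := y :+ :- con (+ 0)) refl (proj₂ u)) (proj₂ (norm≈0⇒ (u R′.- ι r) e)))
    ... | no ≉0 = real (trans (sym (+-identityʳ _))
      (proj₂ (regular′ (λ z≈0 → ≉0 (trans (norm-cong z≈0) (trans (+-cong (zeroˡ 0#) (zeroˡ 0#)) (+-identityˡ 0#)))) (u +′ ι r) product)))

  module _ {a b c d} (det≉0 : a * d - b * c ≉ 0#)
    (preserving : ∀ x y → Square (x * x + y * y) →
      Square ((x * a + y * c) * (x * a + y * c) + (x * b + y * d) * (x * b + y * d)))
    where

    -- Twice the map (x , y) ↦ x (a , b) + y (c , d) is Y ↦ α Y + β Ȳ.
    α β : Carrier′
    α = a + d , b - c
    β = a - d , b + c

    private
      2# = 1# + 1#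

      norm-image : ∀ x y → norm (α *′ (x , y) +′ β *′ conj (x , y)) ≈
        2# * 2# * ((x * a + y * c) * (x * a + y * c) + (x * b + y * d) * (x * b + y * d))
      norm-image x y = trans (norm-cong
        ( solve 6 (λ a b c d x y → ((a :+ d) :* x :- (b :- c) :* y) :+ ((a :- d) :* x :- (b :+ c) :* (:- y)) :=
            (con (+ 1) :+ con (+ 1)) :* (x :* a :+ y :* c)) refl a b c d x y
        , solve 6 (λ a b c d x y → ((a :+ d) :* y :+ (b :- c) :* x) :+ ((a :- d) :* (:- y) :+ (b :+ c) :* x) :=
            (con (+ 1) :+ con (+ 1)) :* (x :* b :+ y :* d)) refl a b c d x y))
        (solve 3 (λ t X Y → t :* X :* (t :* X) :+ t :* Y :* (t :* Y) := t :* t :* (X :* X :+ Y :* Y)) refl 2# _ _)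

      module _ (s : Carrier) where
        open Direction s using (Z; Y; conj-Y; Y^m≉0) renaming (t to t′)
        W : Carrier′
        W = α *′ Y +′ β *′ conj Y

        -- The hypothesis applies because Y = Z² has the square of `norm Z` as its norm; the factor
        -- 4 that comes from doubling the map is itself a square.
        square-W : Square (norm W)
        square-W = double (preserving (proj₁ Y) (proj₂ Y) (norm Z , norm-*′ Z Z))
          where
          double : Square _ → Square (norm W)
          double (r , e) = 2# * r , trans (norm-image (proj₁ Y) (proj₂ Y)) (trans (*-congˡ e)
            (solve 2 (λ t r → t :* t :* (r :* r) := t :* r :* (t :* r)) refl 2# r))

        X = t′ *′ t′

        open IntegerSolver ring′ using () renaming (solve to solve′; _:=_ to _:=′_; _:*_ to _:*′_; _:+_ to _:+′_)

        factor : ∀ α β X Y → α *′ Y +′ β *′ (X *′ Y) ≈′ Y *′ (α +′ β *′ X)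
        factor = solve′ 4 (λ α β X Y → α :*′ Y :+′ β :*′ (X :*′ Y) :=′ Y :*′ (α :+′ β :*′ X)) R′.refl

        W-factor : W ≈′ Y *′ (α +′ β *′ X)
        W-factor = R′.trans (R′.+-congˡ {α *′ Y} (R′.*-congˡ {β} conj-Y)) (factor α β X Y)

        conj-W-factor : conj W ≈′ Y *′ (conj β +′ conj α *′ X)
        conj-W-factor = R′.trans (R′.trans (conj-+′ (α *′ Y) (β *′ conj Y))
          (R′.trans (R′.+-cong (R′.trans (conj-*′ α Y) (R′.*-congˡ {conj α} conj-Y))
                               (R′.trans (conj-*′ β (conj Y)) (R′.*-congˡ {conj β} (conj-conj Y))))
                    (R′.+-comm (conj α *′ (X *′ Y)) (conj β *′ Y))))
          (factor (conj β) (conj α) X Y)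

        equal : (α +′ β *′ X) ^′ m ≈′ (conj β +′ conj α *′ X) ^′ m
        equal = cancel′ Y^m≉0 (begin
          Y ^′ m *′ (α +′ β *′ X) ^′ m              ≈⟨ ^′-distrib-* Y (α +′ β *′ X) m ⟨
          (Y *′ (α +′ β *′ X)) ^′ m                 ≈⟨ ^′-congˡ m W-factor ⟨
          W ^′ m                                    ≈⟨ square-norm W square-W ⟩
          conj W ^′ m                               ≈⟨ ^′-congˡ m conj-W-factor ⟩
          (Y *′ (conj β +′ conj α *′ X)) ^′ m       ≈⟨ ^′-distrib-* Y (conj β +′ conj α *′ X) m ⟩
          Y ^′ m *′ (conj β +′ conj α *′ X) ^′ m    ∎)
          where open ≈′-Reasoning

      ×-regular : ∀ {j} → j ×ₙ 1# ≉ 0# → P′.Regular (j ×′ 1′)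
      ×-regular {j} j≉0 = regular′ λ e → j≉0 (proj₁ (R′.trans (R′.sym (ι-× j)) e))

      key : α ^′ (1 ℕ.+ k) *′ β *′ (conj β *′ β R′.- α *′ conj α) ≈′ R′.0#
      key = LinearPowers.equal-powers ring′ (ℕ.≤-reflexive (≡.sym q-odd)) (t ∘ from)
        (λ i j i≢j → regular′ λ e → i≢j (≡.trans (≡.sym (strictlyInverseˡ i))
          (≡.trans (to-cong (t-injective e)) (strictlyInverseˡ j))))
        (λ i → Direction.t²^m (from i)) {α} {β} {conj β} {conj α} (equal ∘ from)
        (×-regular {suc n} [1+n]×1≉0) (×-regular {suc n C 2} [1+n]C2×1≉0)

      -- The expression is, up to sign, 4(ad - bc). So `key` leaves only α or β to vanish.
      norms-differ : ¬ (conj β *′ β R′.- α *′ conj α ≈′ R′.0#)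
      norms-differ (e , _) = *-≉0 (*-≉0 2≉0 2≉0) det≉0 (trans
        (solve 4 (λ a b c d → let 2# = con (+ 1) :+ con (+ 1) in
          2# :* 2# :* (a :* d :- b :* c) :=
          :- (((a :- d) :* (a :- d) :- :- (b :+ c) :* (b :+ c)) :- ((a :+ d) :* (a :+ d) :- (b :- c) :* (:- (b :- c)))))
          refl a b c d)
        (trans (-‿cong e) (solve 0 (:- con (+ 0) := con (+ 0)) refl)))

      power≈0 : ∀ {z} j → z ^′ j ≈′ R′.0# → z ≈′ R′.0#
      power≈0 {z} zero    (1≈0 , _) = ⊥-elim (1≉0 1≈0)
      power≈0 {z} (suc j) e with norm z ≟ 0#
      ... | yes norm≈0 = norm≈0⇒ z norm≈0
      ... | no norm≉0  = power≈0 j (regular′ (λ z≈0 → norm≉0 (trans (norm-cong z≈0)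
        (trans (+-cong (zeroˡ 0#) (zeroˡ 0#)) (+-identityˡ 0#)))) (z ^′ j) e)

      α≈0⊎β≈0 : α ≈′ R′.0# ⊎ β ≈′ R′.0#
      α≈0⊎β≈0 = cases (norm β ≟ 0#)
        where
        cases : Dec (norm β ≈ 0#) → α ≈′ R′.0# ⊎ β ≈′ R′.0#
        cases (yes e) = inj₂ (norm≈0⇒ β e)
        cases (no ≉0) = inj₁ (power≈0 (1 ℕ.+ k) (regular′ β≉0 (α ^′ (1 ℕ.+ k))
          (R′.trans (R′.*-comm β (α ^′ (1 ℕ.+ k))) (regular′ norms-differ (α ^′ (1 ℕ.+ k) *′ β)
            (R′.trans (R′.*-comm (conj β *′ β R′.- α *′ conj α) (α ^′ (1 ℕ.+ k) *′ β)) key)))))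
          where
          β≉0 : ¬ (β ≈′ R′.0#)
          β≉0 z≈0 = ≉0 (trans (norm-cong z≈0) (trans (+-cong (zeroˡ 0#) (zeroˡ 0#)) (+-identityˡ 0#)))

    nonsplit-similarity : a * a + b * b ≈ c * c + d * d × a * c + b * d ≈ 0#
    nonsplit-similarity = cases α≈0⊎β≈0
      where
      conclude : ∀ κ → κ * κ ≈ 1# → a ≈ κ * d → c ≈ - κ * b → a * a + b * b ≈ c * c + d * d × a * c + b * d ≈ 0#
      conclude κ κ²≈1 a≈ c≈ =
          trans (+-cong (trans (*-cong a≈ a≈) (pull d)) (trans (sym (trans (*-cong c≈ c≈) (trans
            (solve 2 (λ κ x → :- κ :* x :* (:- κ :* x) := κ :* x :* (κ :* x)) refl κ b) (pull b)))) refl)) (+-comm _ _)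
        , trans (+-congʳ (*-cong a≈ c≈)) (trans
            (solve 3 (λ κ b d → κ :* d :* (:- κ :* b) :+ b :* d := b :* d :- κ :* κ :* (b :* d)) refl κ b d)
            (≈⇒-≈0 (sym (trans (*-congʳ κ²≈1) (*-identityˡ _)))))
        where
        pull : ∀ x → κ * x * (κ * x) ≈ x * x
        pull x = trans (solve 2 (λ κ x → κ :* x :* (κ :* x) := κ :* κ :* (x :* x)) refl κ x)
                       (trans (*-congʳ κ²≈1) (*-identityˡ _))

      cases : α ≈′ R′.0# ⊎ β ≈′ R′.0# → a * a + b * b ≈ c * c + d * d × a * c + b * d ≈ 0#
      cases (inj₁ (a+d≈0 , b-c≈0)) = conclude (- 1#)
        (solve 0 (:- con (+ 1) :* :- con (+ 1) := con (+ 1)) refl)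
        (-≈0⇒≈ (trans (solve 2 (λ a d → a :- :- con (+ 1) :* d := a :+ d) refl a d) a+d≈0))
        (trans (sym (-≈0⇒≈ b-c≈0)) (solve 1 (λ b → b := :- :- con (+ 1) :* b) refl b))
      cases (inj₂ (a-d≈0 , b+c≈0)) = conclude 1#
        (*-identityˡ 1#)
        (trans (-≈0⇒≈ a-d≈0) (sym (*-identityˡ d)))
        (-≈0⇒≈ (trans (solve 2 (λ b c → c :- :- con (+ 1) :* b := b :+ c) refl b c) b+c≈0))

-- The field with three elements.

module OrderThree (F : FiniteField c ℓ q) {p r : ℕ} (pr : Prime p)
  (q≡p^r : q ≡ p ℕ.^ suc r) (q≡3 : q ≡ 3) where
  open Squares F {r = r} {n = 1} pr q≡p^r q≡3

  private
    ≉0⇒²≈1 : ∀ {x} → x ≉ 0# → x * x ≈ 1#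
    ≉0⇒²≈1 x≉0 = trans (*-congˡ (sym (*-identityʳ _))) (fermat′ x≉0)

    2≈-1 : 1# + 1# ≈ - 1#
    2≈-1 = -≈0⇒≈ (trans
      (solve 0 ((con (+ 1) :+ con (+ 1)) :- :- con (+ 1) := con (+ 1) :+ (con (+ 1) :+ (con (+ 1) :+ con (+ 0)))) refl)
      (trans (reflexive (≡.cong (_×ₙ 1#) (≡.sym q≡3))) card×1≈0))

    -- Every nonzero square is 1, so two nonzero coordinates have norm 2 = -1, which is not a
    -- square. Hence the images of 1 and i lie on the axes.
    square⇒axis : ∀ a b → Square (a * a + b * b) → a ≈ 0# ⊎ b ≈ 0#
    square⇒axis a b (t , e) with a ≟ 0# | b ≟ 0#
    ... | yes a≈0 | _       = inj₁ a≈0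
    ... | no _    | yes b≈0 = inj₂ b≈0
    ... | no a≉0  | no b≉0  = ⊥-elim (-1-nonsquare 0 ≡.refl t
      (trans (sym e) (trans (+-cong (≉0⇒²≈1 a≉0) (≉0⇒²≈1 b≉0)) 2≈-1)))

  module _ {a b c d} (det≉0 : a * d - b * c ≉ 0#)
    (preserving : ∀ x y → Square (x * x + y * y) →
      Square ((x * a + y * c) * (x * a + y * c) + (x * b + y * d) * (x * b + y * d)))
    where

    private
      first-axis : a ≈ 0# ⊎ b ≈ 0#
      first-axis = square⇒axis a b (square-cong
        (solve 4 (λ a b c d → (con (+ 1) :* a :+ con (+ 0) :* c) :* (con (+ 1) :* a :+ con (+ 0) :* c)
          :+ (con (+ 1) :* b :+ con (+ 0) :* d) :* (con (+ 1) :* b :+ con (+ 0) :* d) := a :* a :+ b :* b) refl a b c d)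
        (preserving 1# 0# (1# , solve 0 (con (+ 1) :* con (+ 1) :+ con (+ 0) :* con (+ 0) := con (+ 1) :* con (+ 1)) refl)))

      second-axis : c ≈ 0# ⊎ d ≈ 0#
      second-axis = square⇒axis c d (square-cong
        (solve 4 (λ a b c d → (con (+ 0) :* a :+ con (+ 1) :* c) :* (con (+ 0) :* a :+ con (+ 1) :* c)
          :+ (con (+ 0) :* b :+ con (+ 1) :* d) :* (con (+ 0) :* b :+ con (+ 1) :* d) := c :* c :+ d :* d) refl a b c d)
        (preserving 0# 1# (1# , solve 0 (con (+ 0) :* con (+ 0) :+ con (+ 1) :* con (+ 1) := con (+ 1) :* con (+ 1)) refl)))

      degenerate : a * d ≈ 0# → b * c ≈ 0# → ⊥
      degenerate ad≈0 bc≈0 = det≉0 (trans (+-cong ad≈0 (-‿cong bc≈0)) (-‿inverseʳ 0#))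

      zeroes : ∀ x y → x ≈ 0# ⊎ y ≈ 0# → x * y ≈ 0#
      zeroes x y (inj₁ x≈0) = trans (*-congʳ x≈0) (zeroˡ y)
      zeroes x y (inj₂ y≈0) = trans (*-congˡ y≈0) (zeroʳ x)

    order-three-similarity : a * a + b * b ≈ c * c + d * d × a * c + b * d ≈ 0#
    order-three-similarity = cases first-axis second-axis
      where
      cases : a ≈ 0# ⊎ b ≈ 0# → c ≈ 0# ⊎ d ≈ 0# → a * a + b * b ≈ c * c + d * d × a * c + b * d ≈ 0#
      cases (inj₁ a≈0) (inj₁ c≈0) = ⊥-elim (degenerate (zeroes a d (inj₁ a≈0)) (zeroes b c (inj₂ c≈0)))
      cases (inj₂ b≈0) (inj₂ d≈0) = ⊥-elim (degenerate (zeroes a d (inj₂ d≈0)) (zeroes b c (inj₁ b≈0)))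
      cases (inj₁ a≈0) (inj₂ d≈0) =
        trans (trans (+-cong (zeroes a a (inj₁ a≈0)) (≉0⇒²≈1 λ b≈0 → degenerate ad≈0 (zeroes b c (inj₁ b≈0)))) (+-comm 0# 1#))
              (sym (+-cong (≉0⇒²≈1 λ c≈0 → degenerate ad≈0 (zeroes b c (inj₂ c≈0))) (zeroes d d (inj₁ d≈0)))) ,
        trans (+-cong (zeroes a c (inj₁ a≈0)) (zeroes b d (inj₂ d≈0))) (+-identityˡ 0#)
        where ad≈0 = zeroes a d (inj₁ a≈0)
      cases (inj₂ b≈0) (inj₁ c≈0) =
        trans (trans (+-cong (≉0⇒²≈1 λ a≈0 → degenerate (zeroes a d (inj₁ a≈0)) bc≈0) (zeroes b b (inj₁ b≈0))) (+-comm 1# 0#))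
              (sym (+-cong (zeroes c c (inj₁ c≈0)) (≉0⇒²≈1 λ d≈0 → degenerate (zeroes a d (inj₂ d≈0)) bc≈0))) ,
        trans (+-cong (zeroes a c (inj₂ c≈0)) (zeroes b d (inj₁ b≈0))) (+-identityˡ 0#)
        where bc≈0 = zeroes b c (inj₁ b≈0)

-- The linear part is a similarity: the cases combined.

module Similarity (F : FiniteField c ℓ q) {p r n : ℕ} (pr : Prime p)
  (q≡p^r : q ≡ p ℕ.^ suc r) (q-odd : q ≡ suc (n ℕ.+ n)) (q≢5 : q ≢ 5) (q≢9 : q ≢ 9) where
  open OddField F {r = r} {n = n} pr q≡p^r q-odd

  similarity : ∀ {a b c d} → a * d - b * c ≉ 0# →
    (∀ x y → IsSquare commutativeRing (x * x + y * y) →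
      IsSquare commutativeRing ((x * a + y * c) * (x * a + y * c) + (x * b + y * d) * (x * b + y * d))) →
    a * a + b * b ≈ c * c + d * d × a * c + b * d ≈ 0#
  similarity {a} {b} {c} {d} det≉0 preserving = cases n q-odd (parity n)
    where
    cases : ∀ n → q ≡ suc (n ℕ.+ n) → (∃ λ h → n ≡ h ℕ.+ h) ⊎ (∃ λ h → n ≡ suc (h ℕ.+ h)) →
            a * a + b * b ≈ c * c + d * d × a * c + b * d ≈ 0#
    -- For n = 2h, -1 is a square. Here h = 0 would mean q = 1, h = 1 and h = 2 are the excluded 5
    -- and 9, and h ≥ 3 gives q ≥ 13.
    cases _ q≡1 (inj₁ (0 , ≡.refl)) = ⊥-elim (N≢0 (ℕ.suc-injective (≡.trans (≡.sym q-odd) q≡1)))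
    cases _ q≡5 (inj₁ (1 , ≡.refl)) = ⊥-elim (q≢5 q≡5)
    cases _ q≡9 (inj₁ (2 , ≡.refl)) = ⊥-elim (q≢9 q≡9)
    cases _ e   (inj₁ (suc (suc (suc h)) , ≡.refl)) =
      Split.split-similarity F {p} {r} {suc (h ℕ.+ (3 ℕ.+ h))} pr q≡p^r e
        (proj₂ √-1) 10≤q det≉0 preserving
      where
      √-1 = Squares.√-1 F {p} {r} {3 ℕ.+ h ℕ.+ (3 ℕ.+ h)} pr q≡p^r e (3 ℕ.+ h) ≡.refl
      10≤q : 10 ℕ.≤ q
      10≤q = ≡.subst (10 ℕ.≤_) (≡.sym e) (ℕ.≤-trans (ℕ.m≤m+n 10 3) (s≤s (ℕ.+-mono-≤ 6≤n 6≤n)))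
        where
        6≤n : 6 ℕ.≤ 3 ℕ.+ h ℕ.+ (3 ℕ.+ h)
        6≤n = ℕ.+-mono-≤ (ℕ.m≤m+n 3 h) (ℕ.m≤m+n 3 h)
    cases _ q≡3 (inj₂ (0 , ≡.refl)) = OrderThree.order-three-similarity F {p} {r} pr q≡p^r q≡3 det≉0 preserving
    cases _ e   (inj₂ (suc h , ≡.refl)) =
      NonsplitSimilarity.nonsplit-similarity F {p} {r} {h ℕ.+ suc h} {suc h} pr q≡p^r e ≡.refl det≉0 preserving

-- Collineations of the plane are semilinear.

module Collineation (F : FiniteField c ℓ q) where
  open FieldFacts F
  open Conjugation commutativeRing public
  private
    module ≈-Reasoning = SetoidReasoning setoid

  cross : Carrier′ → Carrier′ → Carrier
  cross (a , b) (c , d) = a * d - b * c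

  line : Carrier′ → Carrier′ → Carrier → Carrier′
  line (u₁ , u₂) (v₁ , v₂) t = u₁ + t * v₁ , u₂ + t * v₂

  line-≈ : ∀ u v t → u +′ ι t *′ v ≈′ line u v t
  line-≈ u v t = R′.+-congˡ {u} (ι-*′ t v)

  line-cong : ∀ u v {s t} → s ≈ t → line u v s ≈′ line u v t
  line-cong u v e = +-congˡ (*-congʳ e) , +-congˡ (*-congʳ e)

  line-0 : ∀ u v → line u v 0# ≈′ u
  line-0 (u₁ , u₂) (v₁ , v₂) = zero-step u₁ v₁ , zero-step u₂ v₂
    where
    zero-step : ∀ u v → u + 0# * v ≈ u
    zero-step u v = trans (+-congˡ (zeroˡ v)) (+-identityʳ u)

  -- A base point and a direction are chosen for every image line. Directions may be zero, so
  -- nonzero image directions are obtained from injectivity where they matter.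
  record Collineation (φ : Carrier′ → Carrier′) : Set (c ⊔ ℓ) where
    field
      cong      : ∀ {u v} → u ≈′ v → φ u ≈′ φ v
      injective : ∀ {u v} → φ u ≈′ φ v → u ≈′ v
      image     : Carrier′ → Carrier′ → Carrier′ × Carrier′
      into      : ∀ u v t → ∃ λ s → φ (line u v t) ≈′ line (proj₁ (image u v)) (proj₂ (image u v)) s
      onto      : ∀ u v s → ∃ λ t → line (proj₁ (image u v)) (proj₂ (image u v)) s ≈′ φ (line u v t)

  module _ {φ} (collineation : Collineation φ) where
    open Collineation collineation

    private
      cross-cong : ∀ {u u′ v v′} → u ≈′ u′ → v ≈′ v′ → cross u v ≈ cross u′ v′
      cross-cong (e₁ , e₂) (f₁ , f₂) = +-cong (*-cong e₁ f₂) (-‿cong (*-cong e₂ f₁))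

      -‿cong′ : ∀ {u u′ v v′} → u ≈′ u′ → v ≈′ v′ → u R′.- v ≈′ u′ R′.- v′
      -‿cong′ e f = R′.+-cong e (R′.-‿cong f)

      cross-lines : ∀ U V U′ V′ s₁ s₀ s₁′ s₀′ → cross V V′ ≈ 0# →
        cross (line U V s₁ R′.- line U V s₀) (line U′ V′ s₁′ R′.- line U′ V′ s₀′) ≈ 0#
      cross-lines (u₁ , u₂) (v₁ , v₂) (u₁′ , u₂′) (v₁′ , v₂′) s₁ s₀ s₁′ s₀′ e = trans
        (+-cong (*-cong (difference u₁ v₁ s₁ s₀) (difference u₂′ v₂′ s₁′ s₀′))
                (-‿cong (*-cong (difference u₂ v₂ s₁ s₀) (difference u₁′ v₁′ s₁′ s₀′))))
        (trans (solve 6 (λ v₁ v₂ w₁ w₂ s s′ → s :* v₁ :* (s′ :* w₂) :- s :* v₂ :* (s′ :* w₁) :=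
                 s :* s′ :* (v₁ :* w₂ :- v₂ :* w₁)) refl v₁ v₂ v₁′ v₂′ (s₁ - s₀) (s₁′ - s₀′))
               (trans (*-congˡ e) (zeroʳ _)))
        where
        difference : ∀ u v s₁ s₀ → (u + s₁ * v) - (u + s₀ * v) ≈ (s₁ - s₀) * v
        difference = solve 4 (λ u v s₁ s₀ → (u :+ s₁ :* v) :- (u :+ s₀ :* v) := (s₁ :- s₀) :* v) refl

      cross-self : ∀ v → cross v v ≈ 0#
      cross-self (a , b) = solve 2 (λ a b → a :* b :- b :* a := con (+ 0)) refl a b

      -- Cramer's rule. Each coordinate identity holds up to a multiple of `δ * cross V V′ - 1#`,
      -- which vanishes.
      intersect : ∀ U V U′ V′ → cross V V′ ≉ 0# → ∃₂ λ s s′ → line U V s ≈′ line U′ V′ s′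
      intersect (u₁ , u₂) (v₁ , v₂) (u₁′ , u₂′) (v₁′ , v₂′) D≉0 =
        δ * s , δ * s′ ,
        ( trans (solve 9 (λ u₁ u₂ v₁ v₂ u₁′ u₂′ v₁′ v₂′ δ →
            let w₁ = u₁′ :- u₁ ; w₂ = u₂′ :- u₂ in
            u₁ :+ δ :* (w₁ :* v₂′ :- w₂ :* v₁′) :* v₁ :=
            (u₁′ :+ δ :* (w₁ :* v₂ :- w₂ :* v₁) :* v₁′) :+ (δ :* (v₁ :* v₂′ :- v₂ :* v₁′) :- con (+ 1)) :* w₁)
            refl u₁ u₂ v₁ v₂ u₁′ u₂′ v₁′ v₂′ δ) (vanish _ _)
        , trans (solve 9 (λ u₁ u₂ v₁ v₂ u₁′ u₂′ v₁′ v₂′ δ →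
            let w₁ = u₁′ :- u₁ ; w₂ = u₂′ :- u₂ in
            u₂ :+ δ :* (w₁ :* v₂′ :- w₂ :* v₁′) :* v₂ :=
            (u₂′ :+ δ :* (w₁ :* v₂ :- w₂ :* v₁) :* v₂′) :+ (δ :* (v₁ :* v₂′ :- v₂ :* v₁′) :- con (+ 1)) :* w₂)
            refl u₁ u₂ v₁ v₂ u₁′ u₂′ v₁′ v₂′ δ) (vanish _ _))
        where
        δ = proj₁ (inv _ D≉0)
        s = (u₁′ - u₁) * v₂′ - (u₂′ - u₂) * v₁′
        s′ = (u₁′ - u₁) * v₂ - (u₂′ - u₂) * v₁
        vanish : ∀ x w → x + (δ * (v₁ * v₂′ - v₂ * v₁′) - 1#) * w ≈ x
        vanish x w = trans (+-congˡ (trans (*-congʳ (≈⇒-≈0 (proj₂ (inv _ D≉0)))) (zeroˡ w))) (+-identityʳ x)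

    -- Parallel lines are equal or disjoint, hence so are their images.
    parallel : ∀ u u′ v t t′ → cross (φ (line u v t) R′.- φ u) (φ (line u′ v t′) R′.- φ u′) ≈ 0#
    parallel u u′ v t t′ = cases (cross V V′ ≟ 0#)
      where
      U = proj₁ (image u v)
      V = proj₂ (image u v)
      U′ = proj₁ (image u′ v)
      V′ = proj₂ (image u′ v)

      base : ∀ u → φ u ≈′ line (proj₁ (image u v)) (proj₂ (image u v)) (proj₁ (into u v 0#))
      base u = R′.trans (cong (R′.sym (line-0 u v))) (proj₂ (into u v 0#))

      first : φ (line u v t) R′.- φ u ≈′ line U V (proj₁ (into u v t)) R′.- line U V (proj₁ (into u v 0#))
      first = -‿cong′ (proj₂ (into u v t)) (base u)

      cases : Dec (cross V V′ ≈ 0#) → _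
      cases (yes e) = trans
        (cross-cong first (-‿cong′ (proj₂ (into u′ v t′)) (base u′)))
        (cross-lines U V U′ V′ _ _ _ _ e)
      cases (no D≉0) = trans
        (cross-cong first (-‿cong′ (on-line t′) (R′.trans (cong (R′.sym (line-0 u′ v))) (on-line 0#))))
        (cross-lines U V U V _ _ _ _ (cross-self V))
        where
        meet = intersect U V U′ V′ D≉0
        t₁ = proj₁ (onto u v (proj₁ meet))
        t₂ = proj₁ (onto u′ v (proj₁ (proj₂ meet)))

        common : line u v t₁ ≈′ line u′ v t₂
        common = injective (R′.trans (R′.sym (proj₂ (onto u v (proj₁ meet))))
          (R′.trans (proj₂ (proj₂ meet)) (proj₂ (onto u′ v (proj₁ (proj₂ meet))))))

        shift : ∀ s → line u′ v s ≈′ line u v (t₁ + (s - t₂))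
        shift s = step (proj₁ common) , step (proj₂ common)
          where
          step : ∀ {u u′ v} → u + t₁ * v ≈ u′ + t₂ * v → u′ + s * v ≈ u + (t₁ + (s - t₂)) * v
          step {u} {u′} {v} e = begin
            u′ + s * v                         ≈⟨ solve 4 (λ u′ v s t₂ → u′ :+ s :* v := (u′ :+ t₂ :* v) :+ (s :- t₂) :* v) refl u′ v s t₂ ⟩
            (u′ + t₂ * v) + (s - t₂) * v       ≈⟨ +-congʳ e ⟨
            (u + t₁ * v) + (s - t₂) * v        ≈⟨ solve 5 (λ u v t₁ s t₂ → (u :+ t₁ :* v) :+ (s :- t₂) :* v := u :+ (t₁ :+ (s :- t₂)) :* v) refl u v t₁ s t₂ ⟩
            u + (t₁ + (s - t₂)) * v            ∎
            where open ≈-Reasoning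

        on-line : ∀ s → φ (line u′ v s) ≈′ line U V (proj₁ (into u v (t₁ + (s - t₂))))
        on-line s = R′.trans (cong (shift s)) (proj₂ (into u v (t₁ + (s - t₂))))

    O e₁ e₂ : Carrier′
    O  = φ (0# , 0#)
    e₁ = φ (1# , 0#) R′.- O
    e₂ = φ (0# , 1#) R′.- O

    -- Dependence would put φ(i) on the line that is the image of the first axis. As every point of
    -- that line is an image of an axis point, injectivity would put i on the axis.
    frame-independent : cross e₁ e₂ ≉ 0#
    frame-independent cross≈0 = 1≉0 (proj₂ (injective (R′.trans on-axis (proj₂ (onto x-axis-base x-axis s)))) ⟨≈⟩ vanishes)
      where
      _⟨≈⟩_ = trans
      x-axis-base x-axis U V : Carrier′
      x-axis-base = 0# , 0#
      x-axis = 1# , 0#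
      U = proj₁ (image x-axis-base x-axis)
      V = proj₂ (image x-axis-base x-axis)
      v₁ = proj₁ V
      v₂ = proj₂ V
      s₀ = proj₁ (into x-axis-base x-axis 0#)
      s₁ = proj₁ (into x-axis-base x-axis 1#)

      vanishes : ∀ {t} → 0# + t * 0# ≈ 0#
      vanishes {t} = trans (+-congˡ (zeroʳ t)) (+-identityˡ 0#)

      O≈ : O ≈′ line U V s₀
      O≈ = R′.trans (cong (R′.sym (line-0 x-axis-base x-axis))) (proj₂ (into x-axis-base x-axis 0#))

      φ10≈ : φ (1# , 0#) ≈′ line U V s₁
      φ10≈ = R′.trans (cong (solve 0 (con (+ 1) := con (+ 0) :+ con (+ 1) :* con (+ 1)) refl , sym vanishes))
                      (proj₂ (into x-axis-base x-axis 1#))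

      s₁-s₀≉0 : s₁ - s₀ ≉ 0#
      s₁-s₀≉0 e = 1≉0 (proj₁ (injective (R′.trans φ10≈ (R′.trans (line-cong U V (-≈0⇒≈ e)) (R′.sym O≈)))))

      e₁≈ : e₁ ≈′ ((s₁ - s₀) * v₁ , (s₁ - s₀) * v₂)
      e₁≈ = R′.trans (-‿cong′ φ10≈ O≈) (difference (proj₁ U) v₁ , difference (proj₂ U) v₂)
        where
        difference : ∀ u v → (u + s₁ * v) - (u + s₀ * v) ≈ (s₁ - s₀) * v
        difference u v = solve 4 (λ u v s₁ s₀ → (u :+ s₁ :* v) :- (u :+ s₀ :* v) := (s₁ :- s₀) :* v) refl u v s₁ s₀

      cross-V : cross V e₂ ≈ 0#
      cross-V = regular s₁-s₀≉0 _ (trans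
        (solve 5 (λ s v₁ v₂ x y → s :* (v₁ :* y :- v₂ :* x) := s :* v₁ :* y :- s :* v₂ :* x) refl (s₁ - s₀) v₁ v₂ (proj₁ e₂) (proj₂ e₂))
        (trans (sym (cross-cong e₁≈ (R′.refl {e₂}))) cross≈0))

      -- V is nonzero because φ separates 0 and 1, so `cross-V` makes e₂ a multiple of V, found by
      -- dividing by whichever coordinate of V is nonzero.
      multiplier : Dec (v₁ ≈ 0#) → Dec (v₂ ≈ 0#) → ∃ λ k → proj₁ e₂ ≈ k * v₁ × proj₂ e₂ ≈ k * v₂
      multiplier (yes v₁≈0) (yes v₂≈0) = ⊥-elim (1≉0 (proj₁ (injective (R′.trans φ10≈
        (R′.trans (degenerate (proj₁ U) v₁≈0 , degenerate (proj₂ U) v₂≈0) (R′.sym O≈))))))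
        where
        degenerate : ∀ u {v} → v ≈ 0# → u + s₁ * v ≈ u + s₀ * v
        degenerate u v≈0 = +-congˡ (trans (trans (*-congˡ v≈0) (zeroʳ s₁)) (sym (trans (*-congˡ v≈0) (zeroʳ s₀))))
      multiplier (no v₁≉0) _ = k * proj₁ e₂ ,
        trans (sym (trans (*-congʳ kv₁≈1) (*-identityˡ _))) (solve 3 (λ k v x → k :* v :* x := k :* x :* v) refl k v₁ (proj₁ e₂)) ,
        trans (sym (trans (*-congʳ kv₁≈1) (*-identityˡ _))) (trans (*-assoc k v₁ (proj₂ e₂)) (trans (*-congˡ (-≈0⇒≈ cross-V))
          (solve 3 (λ k v x → k :* (v :* x) := k :* x :* v) refl k v₂ (proj₁ e₂))))
        where
        k = proj₁ (inv v₁ v₁≉0)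
        kv₁≈1 = proj₂ (inv v₁ v₁≉0)
      multiplier _ (no v₂≉0) = k * proj₂ e₂ ,
        trans (sym (trans (*-congʳ kv₂≈1) (*-identityˡ _))) (trans (*-assoc k v₂ (proj₁ e₂)) (trans (*-congˡ (sym (-≈0⇒≈ cross-V)))
          (solve 3 (λ k v x → k :* (v :* x) := k :* x :* v) refl k v₁ (proj₂ e₂)))) ,
        trans (sym (trans (*-congʳ kv₂≈1) (*-identityˡ _))) (solve 3 (λ k v x → k :* v :* x := k :* x :* v) refl k v₂ (proj₂ e₂))
        where
        k = proj₁ (inv v₂ v₂≉0)
        kv₂≈1 = proj₂ (inv v₂ v₂≉0)

      k : ∃ λ k → proj₁ e₂ ≈ k * v₁ × proj₂ e₂ ≈ k * v₂
      k = multiplier (v₁ ≟ 0#) (v₂ ≟ 0#)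

      s = s₀ + proj₁ k

      on-axis : φ (0# , 1#) ≈′ line U V s
      on-axis = step (proj₁ O≈) (proj₁ (proj₂ k)) , step (proj₂ O≈) (proj₂ (proj₂ k))
        where
        step : ∀ {x o u v} → o ≈ u + s₀ * v → x - o ≈ proj₁ k * v → x ≈ u + s * v
        step {x} {o} {u} {v} e f = trans (solve 2 (λ x o → x := o :+ (x :- o)) refl x o)
          (trans (+-cong e f) (solve 4 (λ u v s k → (u :+ s :* v) :+ k :* v := u :+ (s :+ k) :* v) refl u v s₀ (proj₁ k)))

    private
      a b c′ d δ : Carrier
      a = proj₁ e₁
      b = proj₂ e₁
      c′ = proj₁ e₂
      d = proj₂ e₂
      δ = proj₁ (inv (cross e₁ e₂) frame-independent)

      δ-det : δ * (a * d - b * c′) ≈ 1#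
      δ-det = proj₂ (inv (cross e₁ e₂) frame-independent)

      -- Coordinates in the frame e₁, e₂ by Cramer's rule.
      x-coordinate y-coordinate : Carrier′ → Carrier
      x-coordinate w = δ * cross w e₂
      y-coordinate w = δ * cross e₁ w

      x-cong : ∀ {u v} → u ≈′ v → x-coordinate u ≈ x-coordinate v
      x-cong e = *-congˡ (cross-cong e (R′.refl {e₂}))

      y-cong : ∀ {u v} → u ≈′ v → y-coordinate u ≈ y-coordinate v
      y-cong e = *-congˡ (cross-cong (R′.refl {e₁}) e)

      expand : ∀ w → w ≈′ (x-coordinate w * a + y-coordinate w * c′ , x-coordinate w * b + y-coordinate w * d)
      expand (x , y) =
          trans (sym (trans (*-congʳ δ-det) (*-identityˡ x))) (solve 7 (λ a b c d δ x y → δ :* (a :* d :- b :* c) :* x :=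
            δ :* (x :* d :- y :* c) :* a :+ δ :* (a :* y :- b :* x) :* c) refl a b c′ d δ x y)
        , trans (sym (trans (*-congʳ δ-det) (*-identityˡ y))) (solve 7 (λ a b c d δ x y → δ :* (a :* d :- b :* c) :* y :=
            δ :* (x :* d :- y :* c) :* b :+ δ :* (a :* y :- b :* x) :* d) refl a b c′ d δ x y)

    σ τ : Carrier → Carrier
    σ x = x-coordinate (φ (x , 0#) R′.- O)
    τ y = y-coordinate (φ (0# , y) R′.- O)

    σ-cong : ∀ {x y} → x ≈ y → σ x ≈ σ y
    σ-cong e = x-cong (-‿cong′ (cong (e , refl)) (R′.refl {O}))

    τ-cong : ∀ {x y} → x ≈ y → τ x ≈ τ y
    τ-cong e = y-cong (-‿cong′ (cong (refl , e)) (R′.refl {O}))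

    private
      0+t*0 : ∀ u t → u + t * 0# ≈ u
      0+t*0 u t = trans (+-congˡ (zeroʳ t)) (+-identityʳ u)

      0+t*1 : ∀ t → 0# + t * 1# ≈ t
      0+t*1 t = trans (+-identityˡ _) (*-identityʳ t)

      -- The segment is parallel to the one from 0 to i, whose image is e₂. Since `x-coordinate`
      -- ignores multiples of e₂, the first coordinate of the image depends on x alone.
      vertical : ∀ x y → cross (φ (x , y) R′.- φ (x , 0#)) e₂ ≈ 0#
      vertical x y = trans
        (cross-cong (-‿cong′ (cong (sym (0+t*0 x y) , sym (0+t*1 y))) (R′.refl {φ (x , 0#)}))
                    (-‿cong′ (cong (sym (0+t*0 0# 1#) , sym (0+t*1 1#))) (R′.refl {O})))
        (parallel (x , 0#) (0# , 0#) (0# , 1#) y 1#)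

      horizontal : ∀ x y → cross (φ (x , y) R′.- φ (0# , y)) e₁ ≈ 0#
      horizontal x y = trans
        (cross-cong (-‿cong′ (cong (sym (0+t*1 x) , sym (0+t*0 y x))) (R′.refl {φ (0# , y)}))
                    (-‿cong′ (cong (sym (0+t*1 1#) , sym (0+t*0 0# 1#))) (R′.refl {O})))
        (parallel (0# , y) (0# , 0#) (1# , 0#) x 1#)

      φ-x : ∀ x y → x-coordinate (φ (x , y) R′.- O) ≈ σ x
      φ-x x y = *-congˡ (-≈0⇒≈ (trans (difference (φ (x , y)) (φ (x , 0#)) O e₂) (vertical x y)))
        where
        difference : ∀ u v o w → cross (u R′.- o) w - cross (v R′.- o) w ≈ cross (u R′.- v) w
        difference (u₁ , u₂) (v₁ , v₂) (o₁ , o₂) (w₁ , w₂) = solve 8 (λ u₁ u₂ v₁ v₂ o₁ o₂ w₁ w₂ →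
          ((u₁ :- o₁) :* w₂ :- (u₂ :- o₂) :* w₁) :- ((v₁ :- o₁) :* w₂ :- (v₂ :- o₂) :* w₁) :=
          (u₁ :- v₁) :* w₂ :- (u₂ :- v₂) :* w₁) refl u₁ u₂ v₁ v₂ o₁ o₂ w₁ w₂

      φ-y : ∀ x y → y-coordinate (φ (x , y) R′.- O) ≈ τ y
      φ-y x y = *-congˡ (-≈0⇒≈ (trans (difference (φ (x , y)) (φ (0# , y)) O e₁)
        (trans (-‿cong (horizontal x y)) (solve 0 (:- con (+ 0) := con (+ 0)) refl))))
        where
        difference : ∀ u v o w → cross w (u R′.- o) - cross w (v R′.- o) ≈ - cross (u R′.- v) w
        difference (u₁ , u₂) (v₁ , v₂) (o₁ , o₂) (w₁ , w₂) = solve 8 (λ u₁ u₂ v₁ v₂ o₁ o₂ w₁ w₂ →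
          (w₁ :* (u₂ :- o₂) :- w₂ :* (u₁ :- o₁)) :- (w₁ :* (v₂ :- o₂) :- w₂ :* (v₁ :- o₁)) :=
          :- ((u₁ :- v₁) :* w₂ :- (u₂ :- v₂) :* w₁)) refl u₁ u₂ v₁ v₂ o₁ o₂ w₁ w₂

      φ-O : ∀ x y → φ (x , y) R′.- O ≈′ (σ x * a + τ y * c′ , σ x * b + τ y * d)
      φ-O x y = R′.trans (expand (φ (x , y) R′.- O))
        (+-cong (*-congʳ (φ-x x y)) (*-congʳ (φ-y x y)) , +-cong (*-congʳ (φ-x x y)) (*-congʳ (φ-y x y)))

      φ-difference : ∀ x y x′ y′ → φ (x , y) R′.- φ (x′ , y′) ≈′
        ((σ x - σ x′) * a + (τ y - τ y′) * c′ , (σ x - σ x′) * b + (τ y - τ y′) * d)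
      φ-difference x y x′ y′ =
          trans (sym (telescope _ _ _)) (trans (+-cong (proj₁ (φ-O x y)) (-‿cong (proj₁ (φ-O x′ y′)))) (collect _ _ _ _ a c′))
        , trans (sym (telescope _ _ _)) (trans (+-cong (proj₂ (φ-O x y)) (-‿cong (proj₂ (φ-O x′ y′)))) (collect _ _ _ _ b d))
        where
        telescope : ∀ u v o → (u - o) - (v - o) ≈ u - v
        telescope = solve 3 (λ u v o → (u :- o) :- (v :- o) := u :- v) refl
        collect : ∀ s t s′ t′ a c → (s * a + t * c) - (s′ * a + t′ * c) ≈ (s - s′) * a + (t - t′) * c
        collect = solve 6 (λ s t s′ t′ a c → (s :* a :+ t :* c) :- (s′ :* a :+ t′ :* c) := (s :- s′) :* a :+ (t :- t′) :* c) refl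

      -- This is `parallel` written in the frame: for two segments of the same direction the
      -- increments of σ and τ are proportional. Suitable segments give both multiplicativity and
      -- additivity.
      slopes : ∀ u₁ u₂ w₁ w₂ v₁ v₂ t t′ →
        (σ (u₁ + t * v₁) - σ u₁) * (τ (w₂ + t′ * v₂) - τ w₂) ≈ (τ (u₂ + t * v₂) - τ u₂) * (σ (w₁ + t′ * v₁) - σ w₁)
      slopes u₁ u₂ w₁ w₂ v₁ v₂ t t′ = -≈0⇒≈ (regular frame-independent _ (trans
        (solve 8 (λ a b c d s t s′ t′ → (a :* d :- b :* c) :* (s :* t′ :- t :* s′) :=
          (s :* a :+ t :* c) :* (s′ :* b :+ t′ :* d) :- (s :* b :+ t :* d) :* (s′ :* a :+ t′ :* c))
          refl a b c′ d (σ (u₁ + t * v₁) - σ u₁) (τ (u₂ + t * v₂) - τ u₂) (σ (w₁ + t′ * v₁) - σ w₁) (τ (w₂ + t′ * v₂) - τ w₂))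
        (trans (sym (cross-cong (φ-difference _ _ _ _) (φ-difference _ _ _ _)))
               (parallel (u₁ , u₂) (w₁ , w₂) (v₁ , v₂) t t′))))

    σ-0 : σ 0# ≈ 0#
    σ-0 = trans (*-congˡ (solve 4 (λ x y z w → (x :- x) :* z :- (y :- y) :* w := con (+ 0)) refl (proj₁ O) (proj₂ O) d c′)) (zeroʳ δ)

    private
      τ-0 : τ 0# ≈ 0#
      τ-0 = trans (*-congˡ (solve 4 (λ x y z w → z :* (y :- y) :- w :* (x :- x) := con (+ 0)) refl (proj₁ O) (proj₂ O) a b)) (zeroʳ δ)

    σ-1 : σ 1# ≈ 1#
    σ-1 = δ-det

    private
      τ-1 : τ 1# ≈ 1#
      τ-1 = δ-det

      x-0≈x : ∀ {x y} → y ≈ 0# → x - y ≈ x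
      x-0≈x {x} e = trans (+-congˡ (-‿cong e)) (solve 1 (λ x → x :- con (+ 0) := x) refl x)

      -- The points (x, xv) and (1, v) lie on one line through 0. Taking v = 1 identifies σ with τ,
      -- and the equation becomes multiplicativity.
      slope-1 : ∀ x v → σ x * τ v ≈ τ (x * v)
      slope-1 x v = begin
        σ x * τ v
          ≈⟨ *-cong (trans (x-0≈x σ-0) (σ-cong (0+t*1 x))) (trans (x-0≈x τ-0) (τ-cong (trans (+-identityˡ _) (*-identityˡ v)))) ⟨
        (σ (0# + x * 1#) - σ 0#) * (τ (0# + 1# * v) - τ 0#)
          ≈⟨ slopes 0# 0# 0# 0# 1# v x 1# ⟩
        (τ (0# + x * v) - τ 0#) * (σ (0# + 1# * 1#) - σ 0#)
          ≈⟨ *-cong (trans (x-0≈x τ-0) (τ-cong (+-identityˡ _))) (trans (x-0≈x σ-0) (trans (σ-cong (0+t*1 1#)) σ-1)) ⟩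
        τ (x * v) * 1#
          ≈⟨ *-identityʳ _ ⟩
        τ (x * v)  ∎
        where open ≈-Reasoning

      σ≈τ : ∀ x → σ x ≈ τ x
      σ≈τ x = trans (sym (trans (*-congˡ τ-1) (*-identityʳ _))) (trans (slope-1 x 1#) (τ-cong (*-identityʳ x)))

    σ-* : ∀ x y → σ (x * y) ≈ σ x * σ y
    σ-* x y = trans (σ≈τ (x * y)) (trans (sym (slope-1 x y)) (*-congˡ (sym (σ≈τ y))))

    σ-+ : ∀ x y → σ (x + y) ≈ σ x + σ y
    σ-+ x y = begin
      σ (x + y)                       ≈⟨ solve 2 (λ u v → u := v :+ (u :- v)) refl (σ (x + y)) (σ y) ⟩
      σ y + (σ (x + y) - σ y)         ≈⟨ +-congˡ (+-cong (σ≈τ (x + y)) (-‿cong (σ≈τ y))) ⟩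
      σ y + (τ (x + y) - τ y)         ≈⟨ +-congˡ shift ⟨
      σ y + σ x                       ≈⟨ +-comm _ _ ⟩
      σ x + σ y                       ∎
      where
      open ≈-Reasoning
      -- The segment from (0, y) to (x, x + y) is parallel to the one from (0, 0) to (1, 1).
      shift : σ x ≈ τ (x + y) - τ y
      shift = begin
        σ x
          ≈⟨ *-identityʳ _ ⟨
        σ x * 1#
          ≈⟨ *-cong (trans (x-0≈x σ-0) (σ-cong (0+t*1 x))) (trans (x-0≈x τ-0) (trans (τ-cong (0+t*1 1#)) τ-1)) ⟨
        (σ (0# + x * 1#) - σ 0#) * (τ (0# + 1# * 1#) - τ 0#)
          ≈⟨ slopes 0# y 0# 0# 1# 1# x 1# ⟩
        (τ (y + x * 1#) - τ y) * (σ (0# + 1# * 1#) - σ 0#)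
          ≈⟨ *-cong (+-congʳ (τ-cong (trans (+-congˡ (*-identityʳ x)) (+-comm y x)))) (trans (x-0≈x σ-0) (trans (σ-cong (0+t*1 1#)) σ-1)) ⟩
        (τ (x + y) - τ y) * 1#
          ≈⟨ *-identityʳ _ ⟩
        τ (x + y) - τ y  ∎

    semilinear : ∀ x y → φ (x , y) ≈′
      ( σ x * proj₁ e₁ + σ y * proj₁ e₂ + proj₁ O , σ x * proj₂ e₁ + σ y * proj₂ e₂ + proj₂ O )
    semilinear x y = add (proj₁ (φ-O x y)) , add (proj₂ (φ-O x y))
      where
      add : ∀ {u o w v} → u - o ≈ w + τ y * v → u ≈ w + σ y * v + o
      add {u} {o} {w} {v} e = trans (solve 2 (λ u o → u := (u :- o) :+ o) refl u o)
        (+-congʳ (trans e (+-congˡ (*-congʳ (sym (σ≈τ y))))))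

-- Compositions of the generators are automorphisms.

module _ {a b} {A : Set a} {B : Set b} where

  indicator-cong : (A? : Dec A) (B? : Dec B) → (A → B) → (B → A) →
                   (if does A? then 1 else 0) ≡ (if does B? then 1 else 0)
  indicator-cong (yes _) (yes _) f g = ≡.refl
  indicator-cong (no _)  (no _)  f g = ≡.refl
  indicator-cong (yes x) (no ¬y) f g = contradiction (f x) ¬y
  indicator-cong (no ¬x) (yes y) f g = contradiction (g y) ¬x

  indicator-transfer : (A? : Dec A) (B? : Dec B) →
                       (if does A? then 1 else 0) ≡ (if does B? then 1 else 0) → A → B
  indicator-transfer _        (yes y) e x = y
  indicator-transfer (no ¬x)  (no _)  e x = contradiction x ¬x

module Automorphisms (F : FiniteField c ℓ q) {p r n : ℕ} (pr : Prime p)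
  (q≡p^r : q ≡ p ℕ.^ suc r) (q-odd : q ≡ suc (n ℕ.+ n)) where
  open OddField F {r = r} {n = n} pr q≡p^r q-odd
  open Conjugation commutativeRing

  automorphism : (φ : Point F → Point F) →
    (∀ {u v} → u ≈′ v → φ u ≈′ φ v) → (∀ {u v} → φ u ≈′ φ v → u ≈′ v) → (∀ v → ∃ λ u → φ u ≈′ v) →
    (∀ u v → AtIntegralDistance u v → AtIntegralDistance (φ u) (φ v)) →
    (∀ u v → AtIntegralDistance (φ u) (φ v) → AtIntegralDistance u v) →
    (∀ u v → ∃₂ λ u′ v′ → Range (λ t → φ (u +′ ι t *′ v)) ≐ Range (λ t → u′ +′ ι t *′ v′)) →
    IsAutomorphism F φ
  automorphism φ cong injective surjective preserves reflects lines = record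
    { isBijection = record
      { isInjection = record
        { isCongruent = record
          { cong = cong ; isEquivalence₁ = R′.isEquivalence ; isEquivalence₂ = R′.isEquivalence }
        ; injective = injective
        }
      ; surjective = λ v → proj₁ (surjective v) , λ e → R′.trans (cong e) (proj₂ (surjective v))
      }
    ; preserves-Δ = λ u v → indicator-cong (atIntegralDistance? F u v) (atIntegralDistance? F (φ u) (φ v))
                              (preserves u v) (reflects u v)
    ; preserves-lines = lines
    }

  module Automorphism {φ : Point F → Point F} (aut : IsAutomorphism F φ) where
    open IsAutomorphism aut public
    open IsBijection isBijection public using (cong; injective; strictlySurjective)

    preserves : ∀ u v → AtIntegralDistance u v → AtIntegralDistance (φ u) (φ v)
    preserves u v = indicator-transfer (atIntegralDistance? F u v) (atIntegralDistance? F (φ u) (φ v)) (preserves-Δ u v)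

    reflects : ∀ u v → AtIntegralDistance (φ u) (φ v) → AtIntegralDistance u v
    reflects u v = indicator-transfer (atIntegralDistance? F (φ u) (φ v)) (atIntegralDistance? F u v) (≡.sym (preserves-Δ u v))

  d²-cong : ∀ {u u′ v v′} → u ≈′ u′ → v ≈′ v′ → d² u v ≈ d² u′ v′
  d²-cong (e₁ , e₂) (f₁ , f₂) = +-cong (square (+-cong e₁ (-‿cong f₁))) (square (+-cong e₂ (-‿cong f₂)))
    where
    square : ∀ {x y} → x ≈ y → x * x ≈ y * y
    square e = *-cong e e

  automorphism-id : IsAutomorphism F id
  automorphism-id = automorphism id id id (λ v → v , R′.refl) (λ _ _ → id) (λ _ _ → id)
    (λ u v → u , v , id , id)

  automorphism-∘ : ∀ {φ ψ} → IsAutomorphism F φ → IsAutomorphism F ψ → IsAutomorphism F (φ ∘ ψ)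
  automorphism-∘ {φ} {ψ} aut-φ aut-ψ = automorphism (φ ∘ ψ) (Φ.cong ∘ Ψ.cong) (Ψ.injective ∘ Φ.injective)
    (λ v → let u , e = Φ.strictlySurjective v ; w , f = Ψ.strictlySurjective u in w , R′.trans (Φ.cong f) e)
    (λ u v → Φ.preserves (ψ u) (ψ v) ∘ Ψ.preserves u v)
    (λ u v → Ψ.reflects u v ∘ Φ.reflects (ψ u) (ψ v))
    λ u v → let u′ , v′ , into , onto = Ψ.preserves-lines u v
                u″ , v″ , into′ , onto′ = Φ.preserves-lines u′ v′ in
      u″ , v″ ,
      (λ { (t , e) → let s , f = into (t , R′.refl) in into′ (s , R′.trans e (Φ.cong f)) }) ,
      (λ m → let s , e = onto′ m ; t , f = onto (s , R′.refl) in t , R′.trans e (Φ.cong f))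
    where
    module Φ = Automorphism aut-φ
    module Ψ = Automorphism aut-ψ

  automorphism-resp : ∀ {φ ψ} → (∀ z → φ z ≈′ ψ z) → IsAutomorphism F ψ → IsAutomorphism F φ
  automorphism-resp {φ} {ψ} φ≈ψ aut = automorphism φ
    (λ e → R′.trans (φ≈ψ _) (R′.trans (A.cong e) (R′.sym (φ≈ψ _))))
    (λ e → A.injective (R′.trans (R′.sym (φ≈ψ _)) (R′.trans e (φ≈ψ _))))
    (λ v → let u , e = A.strictlySurjective v in u , R′.trans (φ≈ψ u) e)
    (λ u v s → respect (R′.sym (φ≈ψ u)) (R′.sym (φ≈ψ v)) (A.preserves u v s))
    (λ u v s → A.reflects u v (respect (φ≈ψ u) (φ≈ψ v) s))
    λ u v → let u′ , v′ , into , onto = A.preserves-lines u v in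
      u′ , v′ , (λ { (t , e) → into (t , R′.trans e (φ≈ψ _)) }) ,
      (λ m → let t , e = onto m in t , R′.trans e (R′.sym (φ≈ψ _)))
    where
    module A = Automorphism aut
    respect : ∀ {u u′ v v′} → u ≈′ u′ → v ≈′ v′ → AtIntegralDistance u v → AtIntegralDistance u′ v′
    respect e f (t , g) = t , trans (d²-cong (R′.sym e) (R′.sym f)) g

  -- `ρ` is the change of parameter along a line: the identity for the three affine types of
  -- generator, Frobenius for the semilinear one.
  lines-onto : (φ : Point F → Point F) (ρ ρ⁻¹ : Carrier → Carrier) → (∀ t → ρ (ρ⁻¹ t) ≈ t) →
    (∀ u v → ∃₂ λ u′ v′ → ∀ t → φ (u +′ ι t *′ v) ≈′ u′ +′ ι (ρ t) *′ v′) →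
    ∀ u v → ∃₂ λ u′ v′ → Range (λ t → φ (u +′ ι t *′ v)) ≐ Range (λ t → u′ +′ ι t *′ v′)
  lines-onto φ ρ ρ⁻¹ ρρ⁻¹ affine u v = let u′ , v′ , e = affine u v in
    u′ , v′ ,
    (λ { (t , f) → ρ t , R′.trans f (e t) }) ,
    (λ { (t , f) → ρ⁻¹ t , R′.trans f (R′.trans
      (R′.+-congˡ {u′} (R′.*-congʳ {v′} (ι-cong (sym (ρρ⁻¹ t))))) (R′.sym (e (ρ⁻¹ t)))) })

  generator-automorphism : ∀ g → IsAutomorphism F (⟦_⟧ F p g)
  generator-automorphism (translate s) = automorphism (_+′ s) (R′.+-congʳ {s})
    (λ {u} {v} e → R′.trans (cancel u) (R′.trans (R′.+-congʳ {R′.- s} e) (R′.sym (cancel v))))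
    (λ v → v R′.- s , R′.trans (R′.+-assoc v (R′.- s) s) (R′.trans (R′.+-congˡ {v} (R′.-‿inverseˡ s)) (R′.+-identityʳ v)))
    (λ u v (t , e) → t , trans (isometry u v) e)
    (λ u v (t , e) → t , trans (sym (isometry u v)) e)
    (lines-onto (_+′ s) id id (λ _ → refl) λ u v → u +′ s , v , λ t → swap-last u (ι t *′ v) s)
    where
    cancel : ∀ u → u ≈′ (u +′ s) R′.- s
    cancel u = R′.sym (R′.trans (R′.+-assoc u s (R′.- s)) (R′.trans (R′.+-congˡ {u} (R′.-‿inverseʳ s)) (R′.+-identityʳ u)))

    swap-last : ∀ u w s → (u +′ w) +′ s ≈′ (u +′ s) +′ w
    swap-last u w s = R′.trans (R′.+-assoc u w s) (R′.trans (R′.+-congˡ {u} (R′.+-comm w s)) (R′.sym (R′.+-assoc u s w)))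

    isometry : ∀ u v → d² (u +′ s) (v +′ s) ≈ d² u v
    isometry (u₁ , u₂) (v₁ , v₂) = solve 6 (λ u₁ u₂ v₁ v₂ s₁ s₂ →
      let x = (u₁ :+ s₁) :- (v₁ :+ s₁) ; y = (u₂ :+ s₂) :- (v₂ :+ s₂) in x :* x :+ y :* y :=
      (u₁ :- v₁) :* (u₁ :- v₁) :+ (u₂ :- v₂) :* (u₂ :- v₂)) refl u₁ u₂ v₁ v₂ (proj₁ s) (proj₂ s)
  generator-automorphism swap = automorphism swap′ (λ (e , f) → f , e) (λ (e , f) → f , e)
    (λ v → swap′ v , R′.refl)
    (λ u v (t , e) → t , trans (+-comm _ _) e)
    (λ u v (t , e) → t , trans (+-comm _ _) e)
    (lines-onto swap′ id id (λ _ → refl) λ u v → swap′ u , swap′ v , λ t →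
      R′.trans (proj₂ (line-≈ u v t) , proj₁ (line-≈ u v t)) (R′.sym (line-≈ (swap′ u) (swap′ v) t)))
    where
    open Collineation F using (line-≈)
    swap′ : Carrier′ → Carrier′
    swap′ (x , y) = y , x
  generator-automorphism (multiply y (y⁻¹ , y⁻¹y≈1 , yy⁻¹≈1) (s , s≉0 , yȳ≈s²)) = automorphism (_*′ y) (R′.*-congʳ {y})
    (λ {u} {v} e → R′.trans (R′.sym (cancel u yy⁻¹≈1)) (R′.trans (R′.*-congʳ {y⁻¹} e) (cancel v yy⁻¹≈1)))
    (λ v → v *′ y⁻¹ , cancel v y⁻¹y≈1)
    (λ u v (t , e) → s * t , trans (similarity u v) (trans (*-congˡ e)
      (solve 2 (λ s t → s :* s :* (t :* t) := s :* t :* (s :* t)) refl s t)))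
    (λ u v (t , e) → s⁻¹ * t , trans (sym (unscale (d² u v))) (trans (*-congˡ (trans (sym (similarity u v)) e))
      (solve 2 (λ s t → s :* s :* (t :* t) := s :* t :* (s :* t)) refl s⁻¹ t)))
    (lines-onto (_*′ y) id id (λ _ → refl) λ u v → u *′ y , v *′ y , λ t →
      R′.trans (R′.distribʳ y u (ι t *′ v)) (R′.+-congˡ {u *′ y} (R′.*-assoc (ι t) v y)))
    where
    cancel : ∀ u {x w} → x *′ w ≈′ 1′ → u *′ x *′ w ≈′ u
    cancel u {x} {w} e = R′.trans (R′.*-assoc u x w) (R′.trans (R′.*-congˡ {u} e) (R′.*-identityʳ u))

    s⁻¹ = proj₁ (inv s s≉0)

    unscale : ∀ x → s⁻¹ * s⁻¹ * (s * s * x) ≈ x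
    unscale x = trans (solve 3 (λ i s x → i :* i :* (s :* s :* x) := i :* s :* (i :* s) :* x) refl s⁻¹ s x)
      (trans (*-congʳ (trans (*-cong (proj₂ (inv s s≉0)) (proj₂ (inv s s≉0))) (*-identityˡ 1#))) (*-identityˡ x))

    -- The norm is multiplicative and yȳ = s². A nonzero square factor leaves squareness unchanged
    -- in both directions.
    similarity : ∀ u v → d² (u *′ y) (v *′ y) ≈ s * s * d² u v
    similarity (u₁ , u₂) (v₁ , v₂) = trans
      (solve 6 (λ u₁ u₂ v₁ v₂ y₁ y₂ →
        let X = (u₁ :* y₁ :- u₂ :* y₂) :- (v₁ :* y₁ :- v₂ :* y₂) ; Y = (u₁ :* y₂ :+ u₂ :* y₁) :- (v₁ :* y₂ :+ v₂ :* y₁) in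
        X :* X :+ Y :* Y :=
        (y₁ :* y₁ :- y₂ :* (:- y₂)) :* ((u₁ :- v₁) :* (u₁ :- v₁) :+ (u₂ :- v₂) :* (u₂ :- v₂)))
        refl u₁ u₂ v₁ v₂ (proj₁ y) (proj₂ y))
      (*-congʳ (proj₁ yȳ≈s²))
  generator-automorphism (frobenius j) = automorphism frob′ (λ (e , f) → ^-congˡ m e , ^-congˡ m f)
    (λ (e , f) → frob-injective j e , frob-injective j f)
    (λ (x , y) → (frob⁻¹ x , frob⁻¹ y) , proj₂ (inverse x) , proj₂ (inverse y))
    (λ u v (t , e) → frob j t , trans (distance u v) (trans (^-congˡ m e) (^-distrib-* t t m)))
    (λ u v (t , e) → frob⁻¹ t , frob-injective j (trans (sym (distance u v)) (trans e (trans
      (*-cong (sym (proj₂ (inverse t))) (sym (proj₂ (inverse t)))) (sym (^-distrib-* (frob⁻¹ t) (frob⁻¹ t) m))))))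
    (lines-onto frob′ (frob j) frob⁻¹ (λ t → proj₂ (inverse t)) λ u v → frob′ u , frob′ v , λ t →
      R′.trans (affine (proj₁ (line-≈ u v t)) , affine (proj₂ (line-≈ u v t))) (R′.sym (line-≈ (frob′ u) (frob′ v) (frob j t))))
    where
    open Collineation F using (line-≈)
    m = p ℕ.^ j
    frob′ : Carrier′ → Carrier′
    frob′ (x , y) = frob j x , frob j y

    frob⁻¹ : Carrier → Carrier
    frob⁻¹ = frob (proj₁ (frob-inverse j))
    inverse = proj₂ (frob-inverse j)

    affine : ∀ {w u t v} → w ≈ u + t * v → frob j w ≈ frob j u + frob j t * frob j v
    affine {w} {u} {t} {v} e = trans (^-congˡ m e) (trans (frob-+ j u (t * v)) (+-congˡ (^-distrib-* t v m)))

    frob-minus : ∀ x y → frob j x - frob j y ≈ frob j (x - y)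
    frob-minus x y = trans (+-congʳ (trans (^-congˡ m (solve 2 (λ x y → x := (x :- y) :+ y) refl x y)) (frob-+ j (x - y) y)))
      (solve 2 (λ u v → (u :+ v) :- v := u) refl (frob j (x - y)) (frob j y))

    distance : ∀ u v → d² (frob′ u) (frob′ v) ≈ frob j (d² u v)
    distance (u₁ , u₂) (v₁ , v₂) = trans (+-cong (square u₁ v₁) (square u₂ v₂)) (sym (frob-+ j _ _))
      where
      square : ∀ x y → (frob j x - frob j y) * (frob j x - frob j y) ≈ frob j ((x - y) * (x - y))
      square x y = trans (*-cong (frob-minus x y) (frob-minus x y)) (sym (^-distrib-* (x - y) (x - y) m))

  compose-automorphism : ∀ gs → IsAutomorphism F (compose F p gs)
  compose-automorphism []       = automorphism-id
  compose-automorphism (g ∷ gs) = automorphism-∘ (generator-automorphism g) (compose-automorphism gs)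

  composition⇒automorphism : ∀ {φ} → IsComposition F p φ → IsAutomorphism F φ
  composition⇒automorphism (gs , φ≈) = automorphism-resp φ≈ (compose-automorphism gs)

-- Automorphisms are compositions of the generators.

module Classification (F : FiniteField c ℓ q) {p r n : ℕ} (pr : Prime p)
  (q≡p^r : q ≡ p ℕ.^ suc r) (q-odd : q ≡ suc (n ℕ.+ n)) (q≢5 : q ≢ 5) (q≢9 : q ≢ 9)
  {φ : Point F → Point F} (aut : IsAutomorphism F φ) where
  open OddField F {r = r} {n = n} pr q≡p^r q-odd
  open Collineation F
  open Similarity F {p} {r} {n} pr q≡p^r q-odd q≢5 q≢9 using (similarity)
  private module A = Automorphisms.Automorphism F {p} {r} {n} pr q≡p^r q-odd aut

  collineation : Collineation φ
  collineation = record
    { cong      = A.cong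
    ; injective = A.injective
    ; image     = λ u v → let u′ , v′ , _ = A.preserves-lines u v in u′ , v′
    ; into      = λ u v t → let u′ , v′ , into , _ = A.preserves-lines u v
                                s , e = into (t , A.cong (R′.sym (line-≈ u v t))) in
                            s , R′.trans e (line-≈ u′ v′ s)
    ; onto      = λ u v s → let u′ , v′ , _ , onto = A.preserves-lines u v
                                t , e = onto (s , R′.sym (line-≈ u′ v′ s)) in
                            t , R′.trans e (A.cong (line-≈ u v t))
    }

  private
    σ′ : Carrier → Carrier
    σ′ = σ collineation

    σ-frobenius : ∃ λ j → ∀ x → σ′ x ≈ frob j x
    σ-frobenius = FieldEndomorphism.is-frobenius σ′
      (σ-cong collineation) (σ-+ collineation) (σ-* collineation) (σ-1 collineation)

    j = proj₁ σ-frobenius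
    frob⁻¹ = frob (proj₁ (frob-inverse j))
    frobfrob⁻¹ : ∀ x → frob j (frob⁻¹ x) ≈ x
    frobfrob⁻¹ x = proj₂ (proj₂ (frob-inverse j) x)

    o₁ o₂ a b c′ d : Carrier
    o₁ = proj₁ (O collineation)
    o₂ = proj₂ (O collineation)
    a  = proj₁ (e₁ collineation)
    b  = proj₂ (e₁ collineation)
    c′ = proj₁ (e₂ collineation)
    d  = proj₂ (e₂ collineation)

    det≉0 : a * d - b * c′ ≉ 0#
    det≉0 = frame-independent collineation

    φ≈ : ∀ x y → φ (x , y) ≈′ (frob j x * a + frob j y * c′ + o₁ , frob j x * b + frob j y * d + o₂)
    φ≈ x y = R′.trans (semilinear collineation x y)
      (+-congʳ (+-cong (*-congʳ (proj₂ σ-frobenius x)) (*-congʳ (proj₂ σ-frobenius y))) ,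
       +-congʳ (+-cong (*-congʳ (proj₂ σ-frobenius x)) (*-congʳ (proj₂ σ-frobenius y))))

    -- The linear part acts after Frobenius, so it meets (x, y) at the point with coordinates
    -- `frob⁻¹ x`, `frob⁻¹ y`. The squared distance of that point from 0 is the inverse Frobenius of
    -- x² + y², again a square.
    preserving : ∀ x y → IsSquare commutativeRing (x * x + y * y) →
      IsSquare commutativeRing ((x * a + y * c′) * (x * a + y * c′) + (x * b + y * d) * (x * b + y * d))
    preserving x y (t , x²+y²≈t²) = proj₁ image-distance , trans (sym image-d²) (proj₂ image-distance)
      where
      x′ = frob⁻¹ x
      y′ = frob⁻¹ y
      i = p ℕ.^ proj₁ (frob-inverse j)

      origin-distance : AtIntegralDistance (x′ , y′) (0# , 0#)
      origin-distance = frob⁻¹ t , trans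
        (solve 2 (λ x y → (x :- con (+ 0)) :* (x :- con (+ 0)) :+ (y :- con (+ 0)) :* (y :- con (+ 0)) := x :* x :+ y :* y) refl x′ y′)
        (trans (sym (+-cong (^-distrib-* x x i) (^-distrib-* y y i)))
          (trans (sym (frob-+ (proj₁ (frob-inverse j)) (x * x) (y * y)))
            (trans (^-congˡ i x²+y²≈t²) (^-distrib-* t t i))))

      image-distance : AtIntegralDistance (φ (x′ , y′)) (φ (0# , 0#))
      image-distance = A.preserves (x′ , y′) (0# , 0#) origin-distance

      coordinate : ∀ {z w u v o} → z ≈ frob j x′ * u + frob j y′ * v + o → w ≈ o → z - w ≈ x * u + y * v
      coordinate {z} {w} {u} {v} {o} e f = trans (+-cong e (-‿cong f)) (trans
        (solve 2 (λ s o → (s :+ o) :- o := s) refl (frob j x′ * u + frob j y′ * v) o)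
        (+-cong (*-congʳ (frobfrob⁻¹ x)) (*-congʳ (frobfrob⁻¹ y))))

      image-d² : d² (φ (x′ , y′)) (φ (0# , 0#)) ≈ (x * a + y * c′) * (x * a + y * c′) + (x * b + y * d) * (x * b + y * d)
      image-d² = +-cong (*-cong X X) (*-cong Y Y)
        where
        X = coordinate (proj₁ (φ≈ x′ y′)) refl
        Y = coordinate (proj₂ (φ≈ x′ y′)) refl

    L D : Carrier
    L = a * a + b * b
    D = a * d - b * c′

    norms : L ≈ c′ * c′ + d * d
    norms = proj₁ (similarity det≉0 preserving)

    orthogonal : a * c′ + b * d ≈ 0#
    orthogonal = proj₂ (similarity det≉0 preserving)

    -- Lagrange's identity D² = (a² + b²)(c² + d²) - (ac + bd)², combined with the two similarity
    -- conditions.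
    D²≈L² : D * D ≈ L * L
    D²≈L² = trans
      (solve 4 (λ a b c d → (a :* d :- b :* c) :* (a :* d :- b :* c) :=
        (a :* a :+ b :* b) :* (c :* c :+ d :* d) :- (a :* c :+ b :* d) :* (a :* c :+ b :* d)) refl a b c′ d)
      (trans (+-cong (*-congˡ (sym norms)) (-‿cong (trans (*-congʳ orthogonal) (zeroˡ _))))
             (solve 1 (λ n → n :- con (+ 0) := n) refl (L * L)))

    L≉0 : L ≉ 0#
    L≉0 e = *-≉0 det≉0 det≉0 (trans D²≈L² (trans (*-congʳ e) (zeroˡ L)))

    Lc≈-Db : L * c′ ≈ - D * b
    Lc≈-Db = -≈0⇒≈ (trans
      (solve 4 (λ a b c d → (a :* a :+ b :* b) :* c :- :- (a :* d :- b :* c) :* b := a :* (a :* c :+ b :* d)) refl a b c′ d)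
      (trans (*-congˡ orthogonal) (zeroʳ a)))

    Ld≈Da : L * d ≈ D * a
    Ld≈Da = -≈0⇒≈ (trans
      (solve 4 (λ a b c d → (a :* a :+ b :* b) :* d :- (a :* d :- b :* c) :* a := b :* (a :* c :+ b :* d)) refl a b c′ d)
      (trans (*-congˡ orthogonal) (zeroʳ b)))

    -- Orthogonality gives L e₂ = D i e₁, so the conclusion reads e₂ = κ i e₁.
    scale : ∀ κ → D ≈ κ * L → c′ ≈ - κ * b × d ≈ κ * a
    scale κ D≈κL =
        *-cancelˡ _ _ L≉0 (trans Lc≈-Db (trans (*-congʳ (-‿cong D≈κL))
          (solve 3 (λ n κ b → :- (κ :* n) :* b := n :* (:- κ :* b)) refl L κ b)))
      , *-cancelˡ _ _ L≉0 (trans Ld≈Da (trans (*-congʳ D≈κL)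
          (solve 3 (λ n κ a → κ :* n :* a := n :* (κ :* a)) refl L κ a)))

    -- L is the squared distance between the images of 1 and 0.
    L-square : IsSquare commutativeRing L
    L-square = proj₁ s , trans (solve 4 (λ a b c d →
        a :* a :+ b :* b := (con (+ 1) :* a :+ con (+ 0) :* c) :* (con (+ 1) :* a :+ con (+ 0) :* c)
          :+ (con (+ 1) :* b :+ con (+ 0) :* d) :* (con (+ 1) :* b :+ con (+ 0) :* d)) refl a b c′ d) (proj₂ s)
      where
      s = preserving 1# 0# (1# , solve 0 (con (+ 1) :* con (+ 1) :+ con (+ 0) :* con (+ 0) := con (+ 1) :* con (+ 1)) refl)

    multiplication : (y : Carrier′) → norm y ≈ L → Generator F
    multiplication y norm≈L = multiply y
      (ι L⁻¹ *′ conj y , inverse , R′.trans (R′.*-comm y (ι L⁻¹ *′ conj y)) inverse)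
      (proj₁ L-square , r≉0 , R′.trans (*′-conj y) (ι-cong (trans norm≈L (proj₂ L-square))))
      where
      L⁻¹ = proj₁ (inv L L≉0)

      inverse : ι L⁻¹ *′ conj y *′ y ≈′ 1′
      inverse = R′.trans (R′.*-assoc (ι L⁻¹) (conj y) y) (R′.trans
        (R′.*-congˡ {ι L⁻¹} (R′.trans (R′.*-comm (conj y) y) (*′-conj y)))
        (R′.trans (ι-* L⁻¹ (norm y)) (ι-cong (trans (*-congˡ norm≈L) (proj₂ (inv L L≉0))))))

      r≉0 : proj₁ L-square ≉ 0#
      r≉0 e = L≉0 (trans (proj₂ L-square) (trans (*-congʳ e) (zeroˡ _)))

    -- Here e₂ = i e₁, so x e₁ + y e₂ = (x + yi) e₁. The last entry of the list acts first.
    rotation : D ≈ L → IsComposition F p φ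
    rotation D≈L = translate (o₁ , o₂) ∷ multiplication (a , b) refl ∷ frobenius j ∷ [] ,
      λ (x , y) → R′.trans (φ≈ x y)
        ( +-congʳ (trans (+-congˡ (*-congˡ (proj₁ e₂≈)))
            (solve 4 (λ x y a b → x :* a :+ y :* (:- con (+ 1) :* b) := x :* a :- y :* b) refl (frob j x) (frob j y) a b))
        , +-congʳ (+-congˡ (*-congˡ (trans (proj₂ e₂≈) (*-identityˡ a)))))
      where
      e₂≈ = scale 1# (trans D≈L (sym (*-identityˡ L)))

    -- Here e₂ = -i e₁, that is e₁ = i e₂, so x e₁ + y e₂ = (y + xi) e₂: the swap supplies the
    -- conjugation.
    reflection : D ≈ - L → IsComposition F p φ
    reflection D≈-L = translate (o₁ , o₂) ∷ multiplication (c′ , d) (sym norms) ∷ swap ∷ frobenius j ∷ [] ,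
      λ (x , y) → R′.trans (φ≈ x y)
        ( +-congʳ (trans (+-congʳ (*-congˡ a≈-d))
            (solve 4 (λ x y c d → x :* (:- d) :+ y :* c := y :* c :- x :* d) refl (frob j x) (frob j y) c′ d))
        , +-congʳ (trans (+-congʳ (*-congˡ b≈c)) (+-comm _ _)))
      where
      e₂≈ = scale (- 1#) (trans D≈-L (solve 1 (λ n → :- n := :- con (+ 1) :* n) refl L))
      a≈-d : a ≈ - d
      a≈-d = trans (solve 1 (λ a → a := :- (:- con (+ 1) :* a)) refl a) (-‿cong (sym (proj₂ e₂≈)))
      b≈c : b ≈ c′
      b≈c = trans (solve 1 (λ b → b := :- :- con (+ 1) :* b) refl b) (sym (proj₁ e₂≈))

  automorphism⇒composition : IsComposition F p φ
  automorphism⇒composition = cases (domain (D - L) (D - - L) (trans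
    (solve 2 (λ D L → (D :- L) :* (D :- :- L) := D :* D :- L :* L) refl D L) (≈⇒-≈0 D²≈L²)))
    where
    cases : D - L ≈ 0# ⊎ D - - L ≈ 0# → IsComposition F p φ
    cases (inj₁ e) = rotation (-≈0⇒≈ e)
    cases (inj₂ e) = reflection (-≈0⇒≈ e)

open import Data.Nat.Base using (_^_; _≤_)

theorem2 : ∀ {c ℓ} (p r q : ℕ) → Prime p → p ≢ 2 → 1 ≤ r → q ≡ p ^ r →
    q ≢ 5 → q ≢ 9 →
    (F : FiniteField c ℓ q) (φ : Point F → Point F) →
    IsAutomorphism F φ ⇔ IsComposition F p φ
theorem2 p (suc r) q p-prime p≢2 _ q≡p^r q≢5 q≢9 F φ = mk⇔
  (λ aut → Classification.automorphism⇒composition F {r = r} {n = n} p-prime q≡p^r q-odd q≢5 q≢9 aut)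
  (Automorphisms.composition⇒automorphism F {r = r} {n = n} p-prime q≡p^r q-odd)
  where
  odd = odd-^ (oddPrime p-prime p≢2) (suc r)
  n = proj₁ odd
  q-odd = ≡.trans q≡p^r (proj₂ odd)
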